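{- Let $\mathrm{SP}=\mathrm{Ope}(\mathcal{G},\mathcal{R})$ be the binary quadratic operad with two symmetric binary generators $\mu$, $s$ and relations as in the context. The Koszul dual $\mathrm{SP}^!$ of $\mathrm{SP}$ is isomorphic to the operad $\mathrm{Ope}(\mathcal{G}^{\vee},\mathcal{R}')$, where $\mathcal{G}^{\vee}$ has two antisymmetric binary generators $\mu^{\vee}$, $s^{\vee}$ (so $\mu^\vee(x,y)=-\mu^\vee(y,x)$ and $s^\vee(x,y)=-s^\vee(y,x)$), and $\mathcal{R}'$ is the sub-species of $\mathrm{Free}_{\mathcal{G}^{\vee}}$ generated by $$s^{\vee}(a,s^{\vee}(b,c)),$$ $$\mu^{\vee}(a,s^{\vee}(b,c))+s^{\vee}(c,\mu^{\vee}(a,b))+s^{\vee}(b,\mu^{\vee}(c,a)),$$ $$\mu^{\vee}(a,\mu^{\vee}(b,c))+\mu^{\vee}(c,\mu^{\vee}(a,b))+\mu^{\vee}(b,\mu^{\vee}(c,a)).$$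
   Context: $\mathbb{K}$ is a field of characteristic $0$; operads are symmetric operads in $\mathbb{K}$-vector spaces, viewed as species (functors on finite sets and bijections) with partial compositions. For a species $\mathcal{G}$ concentrated on sets of cardinality 2, $\mathrm{Free}_{\mathcal{G}}$ is the free operad on $\mathcal{G}$ (trees with internal nodes decorated by $\mathcal{G}$, composition by grafting), $\mathrm{Free}_{\mathcal{G}}^{(2)}$ its part spanned by trees with two internal nodes, and $\mathrm{Ope}(\mathcal{G},\mathcal{R})=\mathrm{Free}_{\mathcal{G}}/(\mathcal{R})$, $(\mathcal{R})$ being the operad ideal generated by $\mathcal{R}$. The notation $p(x,q(y,z))$ means the grafting of $q$, with leaves $y,z$, on the second input of $p$. $\mathrm{SP}$: the sub-operad, generated by the edgeless graph $\mu$ and the segment graph $s$ on two vertices, of the operad of simple graphs in which $g_1\circ_* g_2$ is the sum over all graphs obtained from $g_1\sqcup g_2$ by removing $*$ and connecting each neighbour of $*$ in $g_1$ independently to an arbitrary vertex of $g_2$. It has the quadratic presentation $\mathrm{SP}\cong\mathrm{Ope}(\mathcal{G},\mathcal{R})$ where $\mathcal{G}$ has the two symmetric binary generators $\mu,s$ and $\mathcal{R}$ is the sub-species of $\mathrm{Free}_{\mathcal{G}}$ generated by $\mu(c,\mu(a,b))-\mu(a,\mu(b,c))$ and $s(a,\mu(b,c))-\mu(c,s(a,b))-\mu(b,s(a,c))$. Koszul dual: for a species $S$, $S^{\vee}[V]=S[V]^*$ with the action twisted by the signature, $S^{\vee}[\sigma](f)=\mathrm{sign}(\sigma)\,f\circ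 S[\sigma^{ -1}]$. For a binary quadratic operad $\mathrm{Ope}(\mathcal{G},\mathcal{R})$, its Koszul dual is $\mathrm{Ope}(\mathcal{G}^{\vee},\mathcal{R}^{\perp})$, with $\mathcal{R}^{\perp}$ the orthogonal of $\mathcal{R}$ for the natural (sign-equivariant) pairing $\langle f_1\circ_* f_2\mid x_1\circ_* x_2\rangle=f_1(x_1)f_2(x_2)$ between $\mathrm{Free}_{\mathcal{G}^{\vee}}^{(2)}$ and $\mathrm{Free}_{\mathcal{G}}^{(2)}$. Explicitly here, on the label set $\{a,b,c\}$: for $p,q,p',q'\in\{s,\mu\}$ and $(x,y,z),(x',y',z')\in\{(a,b,c),(b,c,a),(c,a,b)\}$, $\langle p^{\vee}(x,q^{\vee}(y,z))\mid p'(x',q'(y',z'))\rangle$ equals $1$ if $p=p'$, $q=q'$, $(x,y,z)=(x',y',z')$, and $0$ otherwise. -}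

module Defs where

open import Level using (Level; 0ℓ; _⊔_) renaming (suc to lsuc)
open import Algebra.Bundles using (CommutativeRing)
open import Algebra.Module.Bundles using (LeftModule)
open import Algebra.Module.Morphism.Structures using (module LeftModuleMorphisms)
import Algebra.Module.Construct.TensorUnit as TensorUnit
import Algebra.Definitions.RawMonoid as RawMonoid
import Algebra.Properties.AbelianGroup as AbelianGroupProperties
import Algebra.Properties.CommutativeSemigroup as CommutativeSemigroupProperties
import Algebra.Properties.Ring as RingProperties
open import Data.Bool.Base using (if_then_else_; _∧_)
open import Data.Empty using (⊥)
open import Data.Fin.Base as Fin using (Fin; zero; suc)
open import Data.Fin.Patterns using (0F; 1F; 2F)
import Data.Fin.Properties as Fin
open import Data.Fin.Permutation using (↔⇒≡)
open import Data.List.Base using (List; []; _∷_; map; allFin; tabulate)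
import Data.List.Properties as List
open import Data.List.Membership.Propositional using (_∈_)
open import Data.List.Membership.Propositional.Properties using (∈-map⁺; ∈-allFin)
open import Data.List.Membership.Propositional.Properties.WithK using (unique∧set⇒bag)
open import Data.List.Relation.Binary.BagAndSetEquality using (∼bag⇒↭)
open import Data.List.Relation.Binary.Permutation.Propositional as Perm using (_↭_)
open import Data.List.Relation.Unary.Unique.Propositional using (Unique)
import Data.List.Relation.Unary.Unique.Propositional.Properties as Unique
open import Data.Maybe.Base using (Maybe; just; nothing)
open import Data.Nat.Base as ℕ using (ℕ)
import Data.Nat.Properties as ℕ
open import Data.Product.Base using (_×_; _,_; ∃; proj₁)
open import Data.Sign.Base as Sign using (Sign)
import Data.Sign.Properties as Sign
open import Data.Sum.Algebra using (⊎-assoc)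
open import Data.Sum.Base using (_⊎_; inj₁; inj₂)
open import Data.Sum.Function.Propositional using (_⊎-↔_)
open import Data.Unit.Base using (⊤; tt)
open import Function.Base using (id; _∘_)
open import Function.Bundles using (_↔_; Inverse; mk↔ₛ′; mk⇔; Injection)
open import Function.Construct.Composition using (_↔-∘_)
open import Function.Construct.Identity using (↔-id)
open import Function.Construct.Symmetry using (↔-sym)
open import Function.Properties.Inverse using (↔⇒↣)
open import Relation.Binary.Definitions using (DecidableEquality; tri<; tri≈; tri>)
open import Relation.Binary.PropositionalEquality as ≡
  using (_≡_; _≢_; refl; sym; trans; cong; cong₂; subst)
open import Relation.Nullary using (¬_; yes; no; does; contradiction)
open import Relation.Nullary.Decidable using (True; toWitness; via-injection; dec-true; dec-false; does-⇔)

private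
  variable
    c ℓ m e m′ e′ r : Level

record Field c ℓ : Set (lsuc (c ⊔ ℓ)) where
  field
    commutativeRing : CommutativeRing c ℓ
  open CommutativeRing commutativeRing public
  field
    1≉0     : ¬ (1# ≈ 0#)
    inverse : ∀ x → ¬ (x ≈ 0#) → ∃ λ y → x * y ≈ 1#

CharacteristicZero : Field c ℓ → Set ℓ
CharacteristicZero K = ∀ n → ¬ (ℕ.suc n · 1# ≈ 0#)
  where
  open Field K using (1#; 0#; _≈_; +-rawMonoid)
  open RawMonoid +-rawMonoid using () renaming (_×_ to _·_)

-- Bijections ignore the chosen enumeration; it only serves to orient the
-- set, so that signatures make sense for bijections between different sets.

record FinSet : Set₁ where
  field
    Carrier : Set
    size    : ℕ
    enum    : Carrier ↔ Fin size

  index : Carrier → Fin size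
  index = Inverse.to enum

  elements : List Carrier
  elements = map (Inverse.from enum) (allFin size)

  _≟_ : DecidableEquality Carrier
  _≟_ = via-injection (↔⇒↣ enum) Fin._≟_

open FinSet using (Carrier; size; index; elements)

private
  variable
    U V W X : FinSet

record _≃_ (V W : FinSet) : Set where
  constructor ⟪_⟫
  field
    bijection : Carrier V ↔ Carrier W
  open Inverse bijection public
    using (to; from; strictlyInverseˡ; strictlyInverseʳ)

open _≃_ public using (to; from)

fin : ℕ → FinSet
fin n = record { Carrier = Fin n ; size = n ; enum = ↔-id (Fin n) }

⊤ᶠ ⊥ᶠ : FinSet
⊤ᶠ = record { Carrier = ⊤ ; size = 1 ; enum = ↔-sym Fin.1↔⊤ }
⊥ᶠ = record { Carrier = ⊥ ; size = 0 ; enum = ↔-sym Fin.0↔⊥ }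

infixr 5 _⊎ᶠ_ _⊎≃_
infixr 9 _∘≃_

_⊎ᶠ_ : FinSet → FinSet → FinSet
V ⊎ᶠ W = record
  { Carrier = Carrier V ⊎ Carrier W
  ; size    = size V ℕ.+ size W
  ; enum    = ↔-sym Fin.+↔⊎ ↔-∘ (FinSet.enum V ⊎-↔ FinSet.enum W)
  }

id≃ : V ≃ V
id≃ = ⟪ ↔-id _ ⟫

_∘≃_ : V ≃ W → U ≃ V → U ≃ W
⟪ τ ⟫ ∘≃ ⟪ σ ⟫ = ⟪ τ ↔-∘ σ ⟫

_⁻¹≃ : V ≃ W → W ≃ V
⟪ σ ⟫ ⁻¹≃ = ⟪ ↔-sym σ ⟫

_⊎≃_ : U ≃ V → W ≃ X → (U ⊎ᶠ W) ≃ (V ⊎ᶠ X)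
⟪ σ ⟫ ⊎≃ ⟪ τ ⟫ = ⟪ σ ⊎-↔ τ ⟫

⊥⊎≃ : (⊥ᶠ ⊎ᶠ V) ≃ V
⊥⊎≃ = ⟪ mk↔ₛ′ (λ { (inj₁ ()) ; (inj₂ v) → v }) inj₂ (λ _ → refl)
                (λ { (inj₁ ()) ; (inj₂ _) → refl }) ⟫

assoc≃ : ∀ U V W → ((U ⊎ᶠ V) ⊎ᶠ W) ≃ (U ⊎ᶠ (V ⊎ᶠ W))
assoc≃ U V W = ⟪ ⊎-assoc 0ℓ (Carrier U) (Carrier V) (Carrier W) ⟫

exchange≃ : ∀ U V W → ((U ⊎ᶠ V) ⊎ᶠ W) ≃ ((U ⊎ᶠ W) ⊎ᶠ V)
exchange≃ U V W = ⟪ mk↔ₛ′ f f (λ { (inj₁ (inj₁ _)) → refl ; (inj₁ (inj₂ _)) → refl ; (inj₂ _) → refl })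
                        (λ { (inj₁ (inj₁ _)) → refl ; (inj₁ (inj₂ _)) → refl ; (inj₂ _) → refl }) ⟫
  where
  f : {A B C : Set} → (A ⊎ B) ⊎ C → (A ⊎ C) ⊎ B
  f (inj₁ (inj₁ a)) = inj₁ (inj₁ a)
  f (inj₁ (inj₂ b)) = inj₂ b
  f (inj₂ c)        = inj₁ (inj₂ c)

swap₂ : fin 2 ≃ fin 2
swap₂ = ⟪ mk↔ₛ′ f f inv inv ⟫
  where
  f : Fin 2 → Fin 2
  f 0F = 1F
  f 1F = 0F
  inv : ∀ i → f (f i) ≡ i
  inv 0F = refl
  inv 1F = refl

≃-size : V ≃ W → size V ≡ size W
≃-size {V} {W} ⟪ σ ⟫ = ↔⇒≡ (FinSet.enum W ↔-∘ (σ ↔-∘ ↔-sym (FinSet.enum V)))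

to-injective : (σ : V ≃ W) → ∀ {x y} → to σ x ≡ to σ y → x ≡ y
to-injective ⟪ σ ⟫ = Injection.injective (↔⇒↣ σ)

compareSign : ∀ {n} → Fin n → Fin n → Sign
compareSign i j = if does (i Fin.<? j) then Sign.+ else Sign.-

module _ {A : Set} (h : A → A → Sign) where

  product₁ : A → List A → Sign
  product₁ x []       = Sign.+
  product₁ x (y ∷ ys) = h x y Sign.* product₁ x ys

  pairProduct : List A → Sign
  pairProduct []       = Sign.+
  pairProduct (x ∷ xs) = product₁ x xs Sign.* pairProduct xs

-- (-1) to the number of inversions of a list of distinct elements,
-- relative to the enumeration of V.

orientation : (V : FinSet) → List (Carrier V) → Sign
orientation V = pairProduct (λ x y → compareSign (index V x) (index V y))

sign : V ≃ W → Sign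
sign {V} {W} σ = orientation W (map (to σ) (elements V))

private
  module _ {A : Set} where

    product₁-cong : {h k : A → A → Sign} → (∀ x y → h x y ≡ k x y) →
                    ∀ x ys → product₁ h x ys ≡ product₁ k x ys
    product₁-cong h≡k x []       = refl
    product₁-cong h≡k x (y ∷ ys) = cong₂ Sign._*_ (h≡k x y) (product₁-cong h≡k x ys)

    interchange : ∀ a b c d → (a Sign.* b) Sign.* (c Sign.* d) ≡ (a Sign.* c) Sign.* (b Sign.* d)
    interchange = CommutativeSemigroupProperties.interchange Sign.*-commutativeSemigroup

    product₁-* : (h k : A → A → Sign) → ∀ x ys →
      product₁ (λ a b → h a b Sign.* k a b) x ys ≡ product₁ h x ys Sign.* product₁ k x ys
    product₁-* h k x []       = refl
    product₁-* h k x (y ∷ ys) =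
      trans (cong (h x y Sign.* k x y Sign.*_) (product₁-* h k x ys))
            (interchange (h x y) (k x y) _ _)

    pairProduct-* : (h k : A → A → Sign) → ∀ xs →
      pairProduct (λ a b → h a b Sign.* k a b) xs ≡ pairProduct h xs Sign.* pairProduct k xs
    pairProduct-* h k []       = refl
    pairProduct-* h k (x ∷ xs) =
      trans (cong₂ Sign._*_ (product₁-* h k x xs) (pairProduct-* h k xs))
            (interchange (product₁ h x xs) (product₁ k x xs) _ _)

    product₁-map : {B : Set} (h : A → A → Sign) (f : B → A) → ∀ x ys →
      product₁ h (f x) (map f ys) ≡ product₁ (λ a b → h (f a) (f b)) x ys
    product₁-map h f x []       = refl
    product₁-map h f x (y ∷ ys) = cong (h (f x) (f y) Sign.*_) (product₁-map h f x ys)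

    pairProduct-map : {B : Set} (h : A → A → Sign) (f : B → A) → ∀ xs →
      pairProduct h (map f xs) ≡ pairProduct (λ a b → h (f a) (f b)) xs
    pairProduct-map h f []       = refl
    pairProduct-map h f (x ∷ xs) = cong₂ Sign._*_ (product₁-map h f x xs) (pairProduct-map h f xs)

    product₁-↭ : (h : A → A → Sign) → ∀ x {ys zs} → ys ↭ zs → product₁ h x ys ≡ product₁ h x zs
    product₁-↭ h x Perm.refl         = refl
    product₁-↭ h x (Perm.prep y p)   = cong (h x y Sign.*_) (product₁-↭ h x p)
    product₁-↭ h x (Perm.swap {xs} {ys} y z p) = begin
      h x y Sign.* (h x z Sign.* product₁ h x xs)  ≡⟨ Sign.*-assoc (h x y) _ _ ⟨
      h x y Sign.* h x z Sign.* product₁ h x xs    ≡⟨ cong₂ Sign._*_ (Sign.*-comm (h x y) (h x z)) (product₁-↭ h x p) ⟩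
      h x z Sign.* h x y Sign.* product₁ h x ys    ≡⟨ Sign.*-assoc (h x z) _ _ ⟩
      h x z Sign.* (h x y Sign.* product₁ h x ys)  ∎
      where open ≡.≡-Reasoning
    product₁-↭ h x (Perm.trans p q)  = trans (product₁-↭ h x p) (product₁-↭ h x q)

    pairProduct-↭ : (h : A → A → Sign) → (∀ x y → h x y ≡ h y x) →
                    ∀ {xs ys} → xs ↭ ys → pairProduct h xs ≡ pairProduct h ys
    pairProduct-↭ h s Perm.refl        = refl
    pairProduct-↭ h s (Perm.prep x p)  = cong₂ Sign._*_ (product₁-↭ h x p) (pairProduct-↭ h s p)
    pairProduct-↭ h s (Perm.swap {xs} {ys} x y p) = begin
      h x y Sign.* product₁ h x xs Sign.* (product₁ h y xs Sign.* pairProduct h xs)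
        ≡⟨ cong₂ (λ a b → a Sign.* product₁ h x xs Sign.* b) (s x y)
             (cong₂ Sign._*_ (product₁-↭ h y p) (pairProduct-↭ h s p)) ⟩
      h y x Sign.* product₁ h x xs Sign.* (product₁ h y ys Sign.* pairProduct h ys)
        ≡⟨ interchange (h y x) _ _ _ ⟩
      h y x Sign.* product₁ h y ys Sign.* (product₁ h x xs Sign.* pairProduct h ys)
        ≡⟨ cong (λ a → h y x Sign.* product₁ h y ys Sign.* (a Sign.* pairProduct h ys)) (product₁-↭ h x p) ⟩
      h y x Sign.* product₁ h y ys Sign.* (product₁ h x ys Sign.* pairProduct h ys) ∎
      where open ≡.≡-Reasoning
    pairProduct-↭ h s (Perm.trans p q) = trans (pairProduct-↭ h s p) (pairProduct-↭ h s q)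

    pairProduct-cong : {h k : A → A → Sign} → (∀ x y → h x y ≡ k x y) →
                       ∀ xs → pairProduct h xs ≡ pairProduct k xs
    pairProduct-cong h≡k []       = refl
    pairProduct-cong h≡k (x ∷ xs) = cong₂ Sign._*_ (product₁-cong h≡k x xs) (pairProduct-cong h≡k xs)

compareSign-flip : ∀ {n} {i j : Fin n} → i ≢ j → compareSign i j ≡ Sign.opposite (compareSign j i)
compareSign-flip {i = i} {j} i≢j with Fin.<-cmp i j
... | tri< i<j _ j≮i rewrite dec-true  (i Fin.<? j) i<j | dec-false (j Fin.<? i) j≮i = refl
... | tri≈ _ i≡j _ = contradiction i≡j i≢j
... | tri> i≮j _ j<i rewrite dec-false (i Fin.<? j) i≮j | dec-true  (j Fin.<? i) j<i = refl

elements-map : (σ : V ≃ W) → map (to σ) (elements V) ↭ elements W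
elements-map {V} {W} σ@(⟪ s ⟫) = ∼bag⇒↭ (unique∧set⇒bag
  (Unique.map⁺ (to-injective σ) (Unique.map⁺ (Injection.injective (↔⇒↣ (↔-sym (FinSet.enum V)))) (Unique.allFin⁺ _)))
  (Unique.map⁺ (Injection.injective (↔⇒↣ (↔-sym (FinSet.enum W)))) (Unique.allFin⁺ _))
  (mk⇔ (λ _ → all W _)
       (λ _ → subst (_∈ _) (Inverse.strictlyInverseˡ s _) (∈-map⁺ (to σ) (all V (from σ _))))))
  where
  all : ∀ V v → v ∈ elements V
  all V v = subst (_∈ elements V) (Inverse.strictlyInverseʳ (FinSet.enum V) v)
              (∈-map⁺ (Inverse.from (FinSet.enum V)) (∈-allFin (index V v)))

orientation-elements : (V : FinSet) → orientation V (elements V) ≡ Sign.+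
orientation-elements V = begin
  orientation V (elements V)
    ≡⟨ pairProduct-map (λ x y → compareSign (index V x) (index V y)) (Inverse.from (FinSet.enum V)) (allFin (size V)) ⟩
  pairProduct (λ i j → compareSign (index V (Inverse.from (FinSet.enum V) i)) (index V (Inverse.from (FinSet.enum V) j))) (allFin (size V))
    ≡⟨ pairProduct-cong (λ i j → cong₂ compareSign (Inverse.strictlyInverseˡ (FinSet.enum V) i) (Inverse.strictlyInverseˡ (FinSet.enum V) j)) (allFin (size V)) ⟩
  pairProduct compareSign (tabulate {n = size V} id)
    ≡⟨ increasing {size V} {size V} id (λ i<j → i<j) ⟩
  Sign.+ ∎
  where
  open ≡.≡-Reasoning

  constant : ∀ {k n} (i : Fin n) (f : Fin k → Fin n) → (∀ j → i Fin.< f j) →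
             product₁ compareSign i (tabulate f) ≡ Sign.+
  constant {ℕ.zero}  i f p = refl
  constant {ℕ.suc k} i f p rewrite dec-true (i Fin.<? f zero) (p zero) =
    constant i (f ∘ suc) (p ∘ suc)

  increasing : ∀ {k n} (f : Fin k → Fin n) → (∀ {i j} → i Fin.< j → f i Fin.< f j) →
               pairProduct compareSign (tabulate f) ≡ Sign.+
  increasing {ℕ.zero}  f p = refl
  increasing {ℕ.suc k} f p = cong₂ Sign._*_
    (constant (f zero) (f ∘ suc) (λ j → p (ℕ.s≤s ℕ.z≤n)))
    (increasing (f ∘ suc) (λ i<j → p (ℕ.s≤s i<j)))

orientation-map : (σ : V ≃ W) → ∀ {xs} → xs ↭ elements V →
                  orientation W (map (to σ) xs) ≡ sign σ Sign.* orientation V xs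
orientation-map {V} {W} σ {xs} p = begin
  orientation W (map (to σ) xs)
    ≡⟨ Sign.*-identityʳ _ ⟨
  orientation W (map (to σ) xs) Sign.* Sign.+
    ≡⟨ cong (orientation W (map (to σ) xs) Sign.*_) (Sign.s*s≡+ (orientation V xs)) ⟨
  orientation W (map (to σ) xs) Sign.* (orientation V xs Sign.* orientation V xs)
    ≡⟨ Sign.*-assoc (orientation W (map (to σ) xs)) _ _ ⟨
  orientation W (map (to σ) xs) Sign.* orientation V xs Sign.* orientation V xs
    ≡⟨ cong (Sign._* orientation V xs) (ratio xs) ⟩
  pairProduct h xs Sign.* orientation V xs
    ≡⟨ cong (Sign._* orientation V xs) (pairProduct-↭ h h-sym p) ⟩
  pairProduct h (elements V) Sign.* orientation V xs
    ≡⟨ cong (Sign._* orientation V xs) (ratio (elements V)) ⟨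
  sign σ Sign.* orientation V (elements V) Sign.* orientation V xs
    ≡⟨ cong (λ a → sign σ Sign.* a Sign.* orientation V xs) (orientation-elements V) ⟩
  sign σ Sign.* Sign.+ Sign.* orientation V xs
    ≡⟨ cong (Sign._* orientation V xs) (Sign.*-identityʳ (sign σ)) ⟩
  sign σ Sign.* orientation V xs ∎
  where
  open ≡.≡-Reasoning
  kW kV h : Carrier V → Carrier V → Sign
  kW x y = compareSign (index W (to σ x)) (index W (to σ y))
  kV x y = compareSign (index V x) (index V y)
  h x y = kW x y Sign.* kV x y

  index-injective : ∀ U {x y} → index U x ≡ index U y → x ≡ y
  index-injective U = Injection.injective (↔⇒↣ (FinSet.enum U))

  opposites : ∀ a b → Sign.opposite a Sign.* Sign.opposite b ≡ a Sign.* b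
  opposites Sign.+ Sign.+ = refl
  opposites Sign.+ Sign.- = refl
  opposites Sign.- Sign.+ = refl
  opposites Sign.- Sign.- = refl

  h-sym : ∀ x y → h x y ≡ h y x
  h-sym x y with FinSet._≟_ V x y
  ... | yes refl = refl
  ... | no  x≢y  = trans
    (cong₂ Sign._*_ (compareSign-flip (λ q → x≢y (to-injective σ (index-injective W q))))
                    (compareSign-flip (λ q → x≢y (index-injective V q))))
    (opposites (kW y x) (kV y x))

  ratio : ∀ xs → orientation W (map (to σ) xs) Sign.* orientation V xs ≡ pairProduct h xs
  ratio xs = trans
    (cong (Sign._* orientation V xs) (pairProduct-map (λ x y → compareSign (index W x) (index W y)) (to σ) xs))
    (sym (pairProduct-* kW kV xs))

sign-id : sign (id≃ {V}) ≡ Sign.+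
sign-id {V} = trans (cong (orientation V) (List.map-id (elements V))) (orientation-elements V)

sign-∘ : (τ : V ≃ W) (σ : U ≃ V) → sign (τ ∘≃ σ) ≡ sign τ Sign.* sign σ
sign-∘ {V} {W} {U} τ σ = trans (cong (orientation W) (List.map-∘ (elements U)))
                               (orientation-map τ (elements-map σ))

sign-ext : (σ τ : V ≃ W) → (∀ v → to σ v ≡ to τ v) → sign σ ≡ sign τ
sign-ext {V} {W} σ τ σ≡τ = cong (orientation W) (List.map-cong σ≡τ (elements V))

-- The names of the edgeless graph and the segment graph on two vertices.
data Generator : Set where
  mu seg : Generator

module _ {c ℓ : Level} (K : Field c ℓ) where

  open Field K using (ring; 0#; 1#) renaming (Carrier to 𝕂; _≈_ to _≈ₖ_; _+_ to _+ₖ_; _*_ to _*ₖ_; -_ to -ₖ_)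
  private module 𝕂 = Field K

  VectorSpace : ∀ m e → Set (c ⊔ ℓ ⊔ lsuc (m ⊔ e))
  VectorSpace = LeftModule ring

  scalars : VectorSpace c ℓ
  scalars = TensorUnit.leftModule

  signum : Sign → 𝕂
  signum Sign.+ = 1#
  signum Sign.- = -ₖ 1#

  ∣_∣ : VectorSpace m e → Set m
  ∣_∣ = LeftModule.Carrierᴹ

  infix 4 _∋_≈_
  _∋_≈_ : (M : VectorSpace m e) → ∣ M ∣ → ∣ M ∣ → Set e
  M ∋ x ≈ y = LeftModule._≈ᴹ_ M x y

  IsLinear : (M : VectorSpace m e) (N : VectorSpace m′ e′) →
             (∣ M ∣ → ∣ N ∣) → Set (c ⊔ m ⊔ e ⊔ e′)
  IsLinear M N = LeftModuleMorphisms.IsLeftModuleHomomorphism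
                   (LeftModule.rawLeftModule M) (LeftModule.rawLeftModule N)

  IsLinearIso : (M : VectorSpace m e) (N : VectorSpace m′ e′) →
                (∣ M ∣ → ∣ N ∣) → Set (c ⊔ m ⊔ m′ ⊔ e ⊔ e′)
  IsLinearIso M N = LeftModuleMorphisms.IsLeftModuleIsomorphism
                      (LeftModule.rawLeftModule M) (LeftModule.rawLeftModule N)

  module Linear {m e m′ e′ : Level} {M : VectorSpace m e} {N : VectorSpace m′ e′}
                {f : ∣ M ∣ → ∣ N ∣} (f-linear : IsLinear M N f) where
    open LeftModuleMorphisms.IsLeftModuleHomomorphism f-linear public
      using (⟦⟧-cong; +ᴹ-homo; *ₗ-homo; 0ᴹ-homo; -ᴹ-homo)

  module _ {M : VectorSpace m e} where
    open LeftModule M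
    private module G = AbelianGroupProperties +ᴹ-abelianGroup
    open import Relation.Binary.Reasoning.Setoid ≈ᴹ-setoid

    -1*x≈-x : ∀ x → (-ₖ 1#) *ₗ x ≈ᴹ -ᴹ x
    -1*x≈-x x = G.inverseˡ-unique _ x (begin
      (-ₖ 1#) *ₗ x +ᴹ x         ≈⟨ +ᴹ-congˡ (*ₗ-identityˡ x) ⟨
      (-ₖ 1#) *ₗ x +ᴹ 1# *ₗ x   ≈⟨ *ₗ-distribʳ x _ _ ⟨
      (-ₖ 1# +ₖ 1#) *ₗ x        ≈⟨ *ₗ-cong (𝕂.-‿inverseˡ 1#) ≈ᴹ-refl ⟩
      0# *ₗ x                   ≈⟨ *ₗ-zeroˡ x ⟩
      0ᴹ                        ∎)

    *ₗ-neg : ∀ a x → a *ₗ (-ᴹ x) ≈ᴹ -ᴹ (a *ₗ x)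
    *ₗ-neg a x = begin
      a *ₗ (-ᴹ x)             ≈⟨ *ₗ-cong 𝕂.refl (-1*x≈-x x) ⟨
      a *ₗ ((-ₖ 1#) *ₗ x)     ≈⟨ *ₗ-assoc a _ x ⟨
      (a *ₖ (-ₖ 1#)) *ₗ x     ≈⟨ *ₗ-cong (𝕂.*-comm a _) ≈ᴹ-refl ⟩
      ((-ₖ 1#) *ₖ a) *ₗ x     ≈⟨ *ₗ-assoc _ a x ⟩
      (-ₖ 1#) *ₗ (a *ₗ x)     ≈⟨ -1*x≈-x (a *ₗ x) ⟩
      -ᴹ (a *ₗ x)             ∎

    +ᴹ-interchange : ∀ w x y z → (w +ᴹ x) +ᴹ (y +ᴹ z) ≈ᴹ (w +ᴹ y) +ᴹ (x +ᴹ z)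
    +ᴹ-interchange = CommutativeSemigroupProperties.interchange
      (record { isCommutativeSemigroup = record
        { isSemigroup = LeftModule.+ᴹ-isSemigroup M ; comm = +ᴹ-comm } })

  module _ {M : VectorSpace m e} {N : VectorSpace m′ e′} {f : ∣ M ∣ → ∣ N ∣} where
    private
      module M = LeftModule M
      module N = LeftModule N
    open import Relation.Binary.Reasoning.Setoid N.≈ᴹ-setoid

    linear : (∀ {x y} → M ∋ x ≈ y → N ∋ f x ≈ f y) →
             (∀ x y → N ∋ f (x M.+ᴹ y) ≈ f x N.+ᴹ f y) →
             (∀ a x → N ∋ f (a M.*ₗ x) ≈ a N.*ₗ f x) →
             IsLinear M N f
    linear f-cong f-+ f-* = record
      { +ᴹ-isGroupHomomorphism = record
        { isMonoidHomomorphism = record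
          { isMagmaHomomorphism = record
            { isRelHomomorphism = record { cong = f-cong }
            ; homo = f-+
            }
          ; ε-homo = begin
              f M.0ᴹ               ≈⟨ f-cong (M.*ₗ-zeroˡ M.0ᴹ) ⟨
              f (0# M.*ₗ M.0ᴹ)     ≈⟨ f-* 0# M.0ᴹ ⟩
              0# N.*ₗ f M.0ᴹ       ≈⟨ N.*ₗ-zeroˡ _ ⟩
              N.0ᴹ                 ∎
          }
        ; ⁻¹-homo = λ x → begin
              f (M.-ᴹ x)            ≈⟨ f-cong (-1*x≈-x {M = M} x) ⟨
              f ((-ₖ 1#) M.*ₗ x)    ≈⟨ f-* _ x ⟩
              (-ₖ 1#) N.*ₗ f x      ≈⟨ -1*x≈-x {M = N} (f x) ⟩
              N.-ᴹ (f x)            ∎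
        }
      ; *ₗ-homo = f-*
      }

  record Species m e : Set (lsuc 0ℓ ⊔ c ⊔ ℓ ⊔ lsuc (m ⊔ e)) where
    field
      obj        : FinSet → VectorSpace m e
      act        : V ≃ W → ∣ obj V ∣ → ∣ obj W ∣
      act-linear : (σ : V ≃ W) → IsLinear (obj V) (obj W) (act σ)
      act-ext    : (σ τ : V ≃ W) → (∀ v → to σ v ≡ to τ v) →
                   ∀ x → obj W ∋ act σ x ≈ act τ x
      act-id     : ∀ x → obj V ∋ act id≃ x ≈ x
      act-∘      : (τ : V ≃ W) (σ : U ≃ V) → ∀ x →
                   obj W ∋ act (τ ∘≃ σ) x ≈ act τ (act σ x)

    act-cong : (σ : V ≃ W) → ∀ {x y} → obj V ∋ x ≈ y → obj W ∋ act σ x ≈ act σ y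
    act-cong {V} {W} σ = Linear.⟦⟧-cong {M = obj V} {N = obj W} (act-linear σ)

  Family : Species m e → ∀ r → Set (lsuc 0ℓ ⊔ m ⊔ lsuc r)
  Family S r = ∀ V → ∣ Species.obj S V ∣ → Set r

  data Span (S : Species m e) (G : Family S r) : Family S (lsuc 0ℓ ⊔ c ⊔ m ⊔ e ⊔ r) where
    incl : ∀ {V x} → G V x → Span S G V x
    resp : ∀ {V x y} → Species.obj S V ∋ x ≈ y → Span S G V x → Span S G V y
    zero : ∀ {V} → Span S G V (LeftModule.0ᴹ (Species.obj S V))
    add  : ∀ {V x y} → Span S G V x → Span S G V y →
           Span S G V (LeftModule._+ᴹ_ (Species.obj S V) x y)
    scale : ∀ {V x} a → Span S G V x → Span S G V (LeftModule._*ₗ_ (Species.obj S V) a x)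
    relabel : ∀ {V W x} (σ : V ≃ W) → Span S G V x → Span S G W (Species.act S σ x)

  record Operad m e : Set (lsuc 0ℓ ⊔ c ⊔ ℓ ⊔ lsuc (m ⊔ e)) where
    field
      species : Species m e
    open Species species public

    field
      unit : ∣ obj ⊤ᶠ ∣
      -- The composition point * is the element of ⊤ᶠ.
      comp : ∀ V W → ∣ obj (V ⊎ᶠ ⊤ᶠ) ∣ → ∣ obj W ∣ → ∣ obj (V ⊎ᶠ W) ∣

      comp-linearˡ : ∀ y → IsLinear (obj (V ⊎ᶠ ⊤ᶠ)) (obj (V ⊎ᶠ W)) (λ x → comp V W x y)
      comp-linearʳ : ∀ x → IsLinear (obj W) (obj (V ⊎ᶠ W)) (λ y → comp V W x y)

      comp-equivariant : (σ : U ≃ V) (τ : W ≃ X) → ∀ x y →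
        obj (V ⊎ᶠ X) ∋ comp V X (act (σ ⊎≃ id≃) x) (act τ y) ≈ act (σ ⊎≃ τ) (comp U W x y)

      comp-identityˡ : ∀ y → obj V ∋ act ⊥⊎≃ (comp ⊥ᶠ V (act (⊥⊎≃ ⁻¹≃) unit) y) ≈ y
      comp-identityʳ : ∀ x → obj (V ⊎ᶠ ⊤ᶠ) ∋ comp V ⊤ᶠ x unit ≈ x

      comp-sequential : ∀ x y z → obj (U ⊎ᶠ (V ⊎ᶠ W)) ∋
        act (assoc≃ U V W) (comp (U ⊎ᶠ V) W (act (assoc≃ U V ⊤ᶠ ⁻¹≃) (comp U (V ⊎ᶠ ⊤ᶠ) x y)) z)
        ≈ comp U (V ⊎ᶠ W) x (comp V W y z)

      comp-parallel : ∀ x y z → obj ((U ⊎ᶠ V) ⊎ᶠ W) ∋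
        comp (U ⊎ᶠ V) W (act (exchange≃ U ⊤ᶠ V) (comp (U ⊎ᶠ ⊤ᶠ) V x y)) z
        ≈ act (exchange≃ U W V) (comp (U ⊎ᶠ W) V
            (act (exchange≃ U ⊤ᶠ W) (comp (U ⊎ᶠ ⊤ᶠ) W (act (exchange≃ U ⊤ᶠ ⊤ᶠ) x) z)) y)

  record OperadIso (P : Operad m e) (Q : Operad m′ e′) : Set (lsuc 0ℓ ⊔ c ⊔ m ⊔ e ⊔ m′ ⊔ e′) where
    private
      module P = Operad P
      module Q = Operad Q
    field
      φ      : ∀ V → ∣ P.obj V ∣ → ∣ Q.obj V ∣
      φ-iso  : ∀ V → IsLinearIso (P.obj V) (Q.obj V) (φ V)
      φ-act  : (σ : V ≃ W) → ∀ x → Q.obj W ∋ φ W (P.act σ x) ≈ Q.act σ (φ V x)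
      φ-unit : Q.obj ⊤ᶠ ∋ φ ⊤ᶠ P.unit ≈ Q.unit
      φ-comp : ∀ x y → Q.obj (V ⊎ᶠ W) ∋
               φ (V ⊎ᶠ W) (P.comp V W x y) ≈ Q.comp V W (φ (V ⊎ᶠ ⊤ᶠ) x) (φ W y)

  data Ideal (P : Operad m e) (R : Family (Operad.species P) r) :
             Family (Operad.species P) (lsuc 0ℓ ⊔ c ⊔ m ⊔ e ⊔ r) where
    incl  : ∀ {V x} → R V x → Ideal P R V x
    resp  : ∀ {V x y} → Operad.obj P V ∋ x ≈ y → Ideal P R V x → Ideal P R V y
    zero  : ∀ {V} → Ideal P R V (LeftModule.0ᴹ (Operad.obj P V))
    add   : ∀ {V x y} → Ideal P R V x → Ideal P R V y →
            Ideal P R V (LeftModule._+ᴹ_ (Operad.obj P V) x y)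
    scale : ∀ {V x} a → Ideal P R V x → Ideal P R V (LeftModule._*ₗ_ (Operad.obj P V) a x)
    relabel : ∀ {V W x} (σ : V ≃ W) → Ideal P R V x → Ideal P R W (Operad.act P σ x)
    compˡ : ∀ {V W x} y → Ideal P R (V ⊎ᶠ ⊤ᶠ) x → Ideal P R (V ⊎ᶠ W) (Operad.comp P V W x y)
    compʳ : ∀ {V W y} x → Ideal P R W y → Ideal P R (V ⊎ᶠ W) (Operad.comp P V W x y)

  module _ (P : Operad m e) (R : Family (Operad.species P) r) where
    open Operad P

    private
      module M V = LeftModule (obj V)

      _~_ : ∀ {V} → ∣ obj V ∣ → ∣ obj V ∣ → Set (lsuc 0ℓ ⊔ c ⊔ m ⊔ e ⊔ r)
      _~_ {V} x y = Ideal P R V (M._+ᴹ_ V x (M.-ᴹ_ V y))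

      module _ {V : FinSet} where
        open LeftModule (obj V)
        open AbelianGroupProperties +ᴹ-abelianGroup
        open import Relation.Binary.Reasoning.Setoid ≈ᴹ-setoid

        reflexive : ∀ {x y} → x ≈ᴹ y → x ~ y
        reflexive x≈y = resp (≈ᴹ-sym (x≈y⇒x∙y⁻¹≈ε x≈y)) zero

        ~-sym : ∀ {x y} → x ~ y → y ~ x
        ~-sym {x} {y} p = resp
          (≈ᴹ-trans (-1*x≈-x {M = obj V} _) (⁻¹-anti-homo‿- x y))
          (scale (Field.-_ K (Field.1# K)) p)

        ~-trans : ∀ {x y z} → x ~ y → y ~ z → x ~ z
        ~-trans {x} {y} {z} p q = resp (begin
          (x +ᴹ -ᴹ y) +ᴹ (y +ᴹ -ᴹ z)   ≈⟨ +ᴹ-assoc x _ _ ⟩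
          x +ᴹ (-ᴹ y +ᴹ (y +ᴹ -ᴹ z))   ≈⟨ +ᴹ-congˡ (≈ᴹ-sym (+ᴹ-assoc _ y _)) ⟩
          x +ᴹ ((-ᴹ y +ᴹ y) +ᴹ -ᴹ z)   ≈⟨ +ᴹ-congˡ (+ᴹ-congʳ (-ᴹ‿inverseˡ y)) ⟩
          x +ᴹ (0ᴹ +ᴹ -ᴹ z)            ≈⟨ +ᴹ-congˡ (+ᴹ-identityˡ _) ⟩
          x +ᴹ -ᴹ z                    ∎) (add p q)

        ~-+ : ∀ {x x′ y y′} → x ~ x′ → y ~ y′ → (x +ᴹ y) ~ (x′ +ᴹ y′)
        ~-+ {x} {x′} {y} {y′} p q = resp (begin
          (x +ᴹ -ᴹ x′) +ᴹ (y +ᴹ -ᴹ y′)   ≈⟨ +ᴹ-interchange {M = obj V} x _ y _ ⟩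
          (x +ᴹ y) +ᴹ (-ᴹ x′ +ᴹ -ᴹ y′)   ≈⟨ +ᴹ-congˡ (⁻¹-∙-comm x′ y′) ⟩
          (x +ᴹ y) +ᴹ -ᴹ (x′ +ᴹ y′)      ∎) (add p q)

        ~-* : ∀ {a b x y} → Field._≈_ K a b → x ~ y → (a *ₗ x) ~ (b *ₗ y)
        ~-* {a} {b} {x} {y} a≈b p = resp (begin
          a *ₗ (x +ᴹ -ᴹ y)          ≈⟨ *ₗ-distribˡ a x _ ⟩
          a *ₗ x +ᴹ a *ₗ (-ᴹ y)     ≈⟨ +ᴹ-congˡ (*ₗ-neg {M = obj V} a y) ⟩
          a *ₗ x +ᴹ -ᴹ (a *ₗ y)     ≈⟨ +ᴹ-congˡ (-ᴹ‿cong (*ₗ-cong a≈b ≈ᴹ-refl)) ⟩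
          a *ₗ x +ᴹ -ᴹ (b *ₗ y)     ∎) (scale a p)

        ~-neg : ∀ {x y} → x ~ y → (-ᴹ x) ~ (-ᴹ y)
        ~-neg {x} {y} p = ~-trans (~-trans (reflexive (≈ᴹ-sym (-1*x≈-x {M = obj V} x)))
          (~-* (Field.refl K) p)) (reflexive (-1*x≈-x {M = obj V} y))

      quotientObj : FinSet → VectorSpace m (lsuc 0ℓ ⊔ c ⊔ m ⊔ e ⊔ r)
      quotientObj V = record
        { Carrierᴹ = Carrierᴹ
        ; _≈ᴹ_ = _~_
        ; _+ᴹ_ = _+ᴹ_ ; _*ₗ_ = _*ₗ_ ; 0ᴹ = 0ᴹ ; -ᴹ_ = -ᴹ_
        ; isLeftModule = record
          { isLeftSemimodule = record
            { +ᴹ-isCommutativeMonoid = record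
              { isMonoid = record
                { isSemigroup = record
                  { isMagma = record
                    { isEquivalence = record
                      { refl = reflexive ≈ᴹ-refl ; sym = ~-sym ; trans = ~-trans }
                    ; ∙-cong = ~-+
                    }
                  ; assoc = λ x y z → reflexive (+ᴹ-assoc x y z)
                  }
                ; identity = (λ x → reflexive (+ᴹ-identityˡ x)) , (λ x → reflexive (+ᴹ-identityʳ x))
                }
              ; comm = λ x y → reflexive (+ᴹ-comm x y)
              }
            ; isPreleftSemimodule = record
              { *ₗ-cong = ~-*
              ; *ₗ-zeroˡ = λ x → reflexive (*ₗ-zeroˡ x)
              ; *ₗ-distribʳ = λ x a b → reflexive (*ₗ-distribʳ x a b)
              ; *ₗ-identityˡ = λ x → reflexive (*ₗ-identityˡ x)
              ; *ₗ-assoc = λ a b x → reflexive (*ₗ-assoc a b x)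
              ; *ₗ-zeroʳ = λ a → reflexive (*ₗ-zeroʳ a)
              ; *ₗ-distribˡ = λ a x y → reflexive (*ₗ-distribˡ a x y)
              }
            }
          ; -ᴹ‿cong = ~-neg
          ; -ᴹ‿inverse = (λ x → reflexive (-ᴹ‿inverseˡ x)) , (λ x → reflexive (-ᴹ‿inverseʳ x))
          }
        }
        where open LeftModule (obj V)

      quotientLinear : ∀ {V W} {f : ∣ obj V ∣ → ∣ obj W ∣} → IsLinear (obj V) (obj W) f →
        (∀ {x} → Ideal P R V x → Ideal P R W (f x)) → IsLinear (quotientObj V) (quotientObj W) f
      quotientLinear {V} {W} {f} f-linear f-ideal =
        linear {M = quotientObj V} {N = quotientObj W} {f = f}
        (λ {x} {y} p → resp
          (N.≈ᴹ-trans (f.+ᴹ-homo x _) (N.+ᴹ-congˡ (f.-ᴹ-homo y)))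
          (f-ideal p))
        (λ x y → reflexive (f.+ᴹ-homo x y))
        (λ a x → reflexive (f.*ₗ-homo a x))
        where
        module f = Linear {M = obj V} {N = obj W} f-linear
        module N = LeftModule (obj W)

    infixl 7 _/_

    _/_ : Operad m (lsuc 0ℓ ⊔ c ⊔ m ⊔ e ⊔ r)
    _/_ = record
      { species = record
        { obj = quotientObj
        ; act = act
        ; act-linear = λ σ → quotientLinear (act-linear σ) (relabel σ)
        ; act-ext = λ σ τ σ≡τ x → reflexive (act-ext σ τ σ≡τ x)
        ; act-id = λ x → reflexive (act-id x)
        ; act-∘ = λ τ σ x → reflexive (act-∘ τ σ x)
        }
      ; unit = unit
      ; comp = comp
      ; comp-linearˡ = λ y → quotientLinear (comp-linearˡ y) (compˡ y)
      ; comp-linearʳ = λ x → quotientLinear (comp-linearʳ x) (compʳ x)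
      ; comp-equivariant = λ σ τ x y → reflexive (comp-equivariant σ τ x y)
      ; comp-identityˡ = λ y → reflexive (comp-identityˡ y)
      ; comp-identityʳ = λ x → reflexive (comp-identityʳ x)
      ; comp-sequential = λ {U} {V} {W} x y z → reflexive (comp-sequential {U} {V} {W} x y z)
      ; comp-parallel = λ {U} {V} {W} x y z → reflexive (comp-parallel {U} {V} {W} x y z)
      }

  record Functional (M : VectorSpace m e) : Set (c ⊔ ℓ ⊔ m ⊔ e) where
    field
      ⟦_⟧      : ∣ M ∣ → 𝕂
      isLinear : IsLinear M scalars ⟦_⟧
  open Functional using (⟦_⟧)

  private
    signum-* : ∀ s t → signum (s Sign.* t) ≈ₖ signum s *ₖ signum t
    signum-* Sign.+ t      = 𝕂.sym (𝕂.*-identityˡ _)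
    signum-* Sign.- Sign.+ = 𝕂.sym (𝕂.*-identityʳ _)
    signum-* Sign.- Sign.- = 𝕂.sym (begin
      (-ₖ 1#) *ₖ (-ₖ 1#)   ≈⟨ RingProperties.-1*x≈-x ring (-ₖ 1#) ⟩
      -ₖ (-ₖ 1#)           ≈⟨ RingProperties.-‿involutive ring 1# ⟩
      1#                   ∎)
      where open import Relation.Binary.Reasoning.Setoid 𝕂.setoid

    x*yz≈y*xz : ∀ x y z → x *ₖ (y *ₖ z) ≈ₖ y *ₖ (x *ₖ z)
    x*yz≈y*xz = CommutativeSemigroupProperties.x∙yz≈y∙xz 𝕂.*-commutativeSemigroup

  module _ (M : VectorSpace m e) where

    scaleFunctional : 𝕂 → Functional M → Functional M
    scaleFunctional a f = record
      { ⟦_⟧ = λ x → a *ₖ ⟦ f ⟧ x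
      ; isLinear = linear {M = M} {N = scalars}
          (λ p → 𝕂.*-congˡ (f.⟦⟧-cong p))
          (λ x y → 𝕂.trans (𝕂.*-congˡ (f.+ᴹ-homo x y)) (𝕂.distribˡ a _ _))
          (λ b x → 𝕂.trans (𝕂.*-congˡ (f.*ₗ-homo b x)) (x*yz≈y*xz a b _))
      }
      where module f = Linear {M = M} {N = scalars} (Functional.isLinear f)

    addFunctional : Functional M → Functional M → Functional M
    addFunctional f g = record
      { ⟦_⟧ = λ x → ⟦ f ⟧ x +ₖ ⟦ g ⟧ x
      ; isLinear = linear {M = M} {N = scalars}
          (λ p → 𝕂.+-cong (f.⟦⟧-cong p) (g.⟦⟧-cong p))
          (λ x y → 𝕂.trans (𝕂.+-cong (f.+ᴹ-homo x y) (g.+ᴹ-homo x y))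
                           (+ᴹ-interchange {M = scalars} _ _ _ _))
          (λ a x → 𝕂.trans (𝕂.+-cong (f.*ₗ-homo a x) (g.*ₗ-homo a x)) (𝕂.sym (𝕂.distribˡ a _ _)))
      }
      where
      module f = Linear {M = M} {N = scalars} (Functional.isLinear f)
      module g = Linear {M = M} {N = scalars} (Functional.isLinear g)

    _* : VectorSpace (c ⊔ ℓ ⊔ m ⊔ e) (m ⊔ ℓ)
    _* = record
      { Carrierᴹ = Functional M
      ; _≈ᴹ_ = λ f g → ∀ x → ⟦ f ⟧ x ≈ₖ ⟦ g ⟧ x
      ; _+ᴹ_ = addFunctional
      ; _*ₗ_ = scaleFunctional
      ; 0ᴹ = record
          { ⟦_⟧ = λ _ → 0#
          ; isLinear = linear {M = M} {N = scalars}
              (λ _ → 𝕂.refl) (λ _ _ → 𝕂.sym (𝕂.+-identityˡ 0#)) (λ a _ → 𝕂.sym (𝕂.zeroʳ a))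
          }
      ; -ᴹ_ = scaleFunctional (-ₖ 1#)
      ; isLeftModule = record
        { isLeftSemimodule = record
          { +ᴹ-isCommutativeMonoid = record
            { isMonoid = record
              { isSemigroup = record
                { isMagma = record
                  { isEquivalence = record
                    { refl = λ _ → 𝕂.refl
                    ; sym = λ p x → 𝕂.sym (p x)
                    ; trans = λ p q x → 𝕂.trans (p x) (q x)
                    }
                  ; ∙-cong = λ p q x → 𝕂.+-cong (p x) (q x)
                  }
                ; assoc = λ f g h x → 𝕂.+-assoc _ _ _
                }
              ; identity = (λ f x → 𝕂.+-identityˡ _) , (λ f x → 𝕂.+-identityʳ _)
              }
            ; comm = λ f g x → 𝕂.+-comm _ _
            }
          ; isPreleftSemimodule = record
            { *ₗ-cong = λ p q x → 𝕂.*-cong p (q x)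
            ; *ₗ-zeroˡ = λ f x → 𝕂.zeroˡ _
            ; *ₗ-distribʳ = λ f a b x → 𝕂.distribʳ _ a b
            ; *ₗ-identityˡ = λ f x → 𝕂.*-identityˡ _
            ; *ₗ-assoc = λ a b f x → 𝕂.*-assoc a b _
            ; *ₗ-zeroʳ = λ a x → 𝕂.zeroʳ a
            ; *ₗ-distribˡ = λ a f g x → 𝕂.distribˡ a _ _
            }
          }
        ; -ᴹ‿cong = λ p x → 𝕂.*-congˡ (p x)
        ; -ᴹ‿inverse = (λ f x → 𝕂.trans (𝕂.+-congʳ (RingProperties.-1*x≈-x ring _)) (𝕂.-‿inverseˡ _))
                     , (λ f x → 𝕂.trans (𝕂.+-congˡ (RingProperties.-1*x≈-x ring _)) (𝕂.-‿inverseʳ _))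
        }
      }

  -- For σ : V ≃ W between different sets, sign σ compares the enumerations
  -- of V and W; it is the usual signature when V = W.
  infix 10 _∨

  _∨ : Species m e → Species (c ⊔ ℓ ⊔ m ⊔ e) (m ⊔ ℓ)
  _∨ S = record
    { obj = λ V → obj V *
    ; act = twist
    ; act-linear = λ {V} {W} σ → linear {M = obj V *} {N = obj W *}
        (λ p x → 𝕂.*-congˡ (p _))
        (λ f g x → 𝕂.distribˡ _ _ _)
        (λ a f x → x*yz≈y*xz _ a _)
    ; act-ext = λ {V} {W} σ τ σ≡τ f x → 𝕂.*-cong
        (𝕂.reflexive (cong signum (sign-ext σ τ σ≡τ)))
        (⟦⟧-cong f (act-ext (σ ⁻¹≃) (τ ⁻¹≃) (from-ext σ τ σ≡τ) x))
    ; act-id = λ {V} f x → 𝕂.trans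
        (𝕂.*-cong (𝕂.reflexive (cong signum (sign-id {V})))
                  (⟦⟧-cong f (LeftModule.≈ᴹ-trans (obj V)
                    (act-ext (id≃ ⁻¹≃) id≃ (λ _ → refl) x) (act-id x))))
        (𝕂.*-identityˡ _)
    ; act-∘ = λ {V} {W} {U} τ σ f x → 𝕂.trans
        (𝕂.*-cong (𝕂.trans (𝕂.reflexive (cong signum (sign-∘ τ σ))) (signum-* (sign τ) (sign σ)))
                  (⟦⟧-cong f (LeftModule.≈ᴹ-trans (obj U)
                    (act-ext ((τ ∘≃ σ) ⁻¹≃) ((σ ⁻¹≃) ∘≃ (τ ⁻¹≃)) (λ _ → refl) x)
                    (act-∘ (σ ⁻¹≃) (τ ⁻¹≃) x))))
        (𝕂.*-assoc _ _ _)
    }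
    where
    open Species S

    ⟦⟧-cong : ∀ {V} (f : Functional (obj V)) {x y} → obj V ∋ x ≈ y → ⟦ f ⟧ x ≈ₖ ⟦ f ⟧ y
    ⟦⟧-cong {V} f = Linear.⟦⟧-cong {M = obj V} {N = scalars} (Functional.isLinear f)

    from-ext : (σ τ : V ≃ W) → (∀ v → to σ v ≡ to τ v) → ∀ w → from σ w ≡ from τ w
    from-ext σ τ σ≡τ w = to-injective σ (trans (_≃_.strictlyInverseˡ σ w)
      (sym (trans (σ≡τ (from τ w)) (_≃_.strictlyInverseˡ τ w))))

    twist : V ≃ W → Functional (obj V) → Functional (obj W)
    twist {V} {W} σ f = scaleFunctional (obj W) (signum (sign σ)) (record
      { ⟦_⟧ = λ x → ⟦ f ⟧ (act (σ ⁻¹≃) x)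
      ; isLinear = linear {M = obj W} {N = scalars}
          (λ p → ⟦⟧-cong f (a.⟦⟧-cong p))
          (λ x y → 𝕂.trans (⟦⟧-cong f (a.+ᴹ-homo x y)) (f′.+ᴹ-homo _ _))
          (λ b x → 𝕂.trans (⟦⟧-cong f (a.*ₗ-homo b x)) (f′.*ₗ-homo b _))
      })
      where
      module a = Linear {M = obj W} {N = obj V} (act-linear (σ ⁻¹≃))
      module f′ = Linear {M = obj V} {N = scalars} (Functional.isLinear f)

  -- For a species concentrated on sets of cardinality 2, only binary trees
  -- contribute to the free operad.  They are drawn in the plane: a node is
  -- decorated by an element of S[{0,1}], input 0 being the first subtree and
  -- input 1 the second, and different drawings are identified by _~_ below.
  data Tree (D : Set m) (A : Set) : Set m where
    leaf : A → Tree D A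
    node : D → Tree D A → Tree D A → Tree D A

  module _ {D : Set m} where

    mapTree : {A B : Set} → (A → B) → Tree D A → Tree D B
    mapTree f (leaf a)     = leaf (f a)
    mapTree f (node d t u) = node d (mapTree f t) (mapTree f u)

    -- Grafting u on the leaf * of t.
    graft : {A B : Set} → Tree D (A ⊎ ⊤) → Tree D B → Tree D (A ⊎ B)
    graft (leaf (inj₁ a)) u = leaf (inj₁ a)
    graft (leaf (inj₂ _)) u = mapTree inj₂ u
    graft (node d t t′)   u = node d (graft t u) (graft t′ u)

    nodes : {A : Set} → Tree D A → ℕ
    nodes (leaf _)     = 0
    nodes (node _ t u) = ℕ.suc (nodes t ℕ.+ nodes u)

    occurrences : ∀ V → Tree D (Carrier V) → Carrier V → ℕ
    occurrences V (leaf x)     v = if does (FinSet._≟_ V x v) then 1 else 0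
    occurrences V (node _ t u) v = occurrences V t v ℕ.+ occurrences V u v

  -- Trees whose leaves are in bijection with V.
  record TreeOn (D : Set m) (V : FinSet) : Set m where
    constructor _⊢_
    field
      tree : Tree D (Carrier V)
      once : ∀ v → occurrences V tree v ≡ 1
  open TreeOn public using (tree)

  private
    module _ {D : Set m} where

      occurs-map : (f : Carrier V → Carrier W) (f-inj : ∀ {x y} → f x ≡ f y → x ≡ y) →
                   (t : Tree D (Carrier V)) → ∀ v →
                   occurrences W (mapTree f t) (f v) ≡ occurrences V t v
      occurs-map {V} {W} f f-inj (leaf x) v = cong (if_then 1 else 0)
        (does-⇔ (mk⇔ f-inj (cong f)) (FinSet._≟_ W (f x) (f v)) (FinSet._≟_ V x v))
      occurs-map {V} {W} f f-inj (node _ t u) v =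
        cong₂ ℕ._+_ (occurs-map {V} {W} f f-inj t v) (occurs-map {V} {W} f f-inj u v)

      occurs-inj₂-inj₁ : ∀ V W (u : Tree D (Carrier W)) v → occurrences (V ⊎ᶠ W) (mapTree inj₂ u) (inj₁ v) ≡ 0
      occurs-inj₂-inj₁ V W (leaf x) v rewrite dec-false (FinSet._≟_ (V ⊎ᶠ W) (inj₂ x) (inj₁ v)) (λ ()) = refl
      occurs-inj₂-inj₁ V W (node _ t u) v = cong₂ ℕ._+_ (occurs-inj₂-inj₁ V W t v) (occurs-inj₂-inj₁ V W u v)

      inj₁-injective : {A B : Set} {x y : A} → inj₁ {B = B} x ≡ inj₁ y → x ≡ y
      inj₁-injective refl = refl
      inj₂-injective : {A B : Set} {x y : B} → inj₂ {A = A} x ≡ inj₂ y → x ≡ y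
      inj₂-injective refl = refl

      occurs-graft₁ : ∀ V W (t : Tree D (Carrier V ⊎ ⊤)) (u : Tree D (Carrier W)) v →
        occurrences (V ⊎ᶠ W) (graft t u) (inj₁ v) ≡ occurrences (V ⊎ᶠ ⊤ᶠ) t (inj₁ v)
      occurs-graft₁ V W (leaf (inj₁ x)) u v = trans
        (occurs-map {V} {V ⊎ᶠ W} inj₁ inj₁-injective (leaf x) v)
        (sym (occurs-map {V} {V ⊎ᶠ ⊤ᶠ} inj₁ inj₁-injective (leaf x) v))
      occurs-graft₁ V W (leaf (inj₂ tt)) u v = trans
        (occurs-inj₂-inj₁ V W u v)
        (sym (occurs-inj₂-inj₁ V ⊤ᶠ (leaf tt) v))
      occurs-graft₁ V W (node _ t t′) u v = cong₂ ℕ._+_ (occurs-graft₁ V W t u v) (occurs-graft₁ V W t′ u v)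

      occurs-graft₂ : ∀ V W (t : Tree D (Carrier V ⊎ ⊤)) (u : Tree D (Carrier W)) w →
        occurrences (V ⊎ᶠ W) (graft t u) (inj₂ w) ≡ occurrences (V ⊎ᶠ ⊤ᶠ) t (inj₂ tt) ℕ.* occurrences W u w
      occurs-graft₂ V W (leaf (inj₁ x)) u w
        rewrite dec-false (FinSet._≟_ (V ⊎ᶠ W) (inj₁ x) (inj₂ w)) (λ ())
              | dec-false (FinSet._≟_ (V ⊎ᶠ ⊤ᶠ) (inj₁ x) (inj₂ tt)) (λ ()) = refl
      occurs-graft₂ V W (leaf (inj₂ tt)) u w = trans
        (occurs-map {W} {V ⊎ᶠ W} inj₂ inj₂-injective u w)
        (trans (sym (ℕ.*-identityˡ _))
          (cong (ℕ._* occurrences W u w) (sym (occurs-map {⊤ᶠ} {V ⊎ᶠ ⊤ᶠ} inj₂ inj₂-injective (leaf tt) tt))))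
      occurs-graft₂ V W (node _ t t′) u w = trans
        (cong₂ ℕ._+_ (occurs-graft₂ V W t u w) (occurs-graft₂ V W t′ u w))
        (sym (ℕ.*-distribʳ-+ (occurrences W u w) (occurrences (V ⊎ᶠ ⊤ᶠ) t (inj₂ tt)) _))

  module _ {D : Set m} where

    relabelTree : V ≃ W → TreeOn D V → TreeOn D W
    relabelTree {V} {W} σ (t ⊢ p) = mapTree (to σ) t ⊢ λ w →
      subst (λ z → occurrences W (mapTree (to σ) t) z ≡ 1) (_≃_.strictlyInverseˡ σ w)
        (trans (occurs-map {V = V} {W = W} (to σ) (to-injective σ) t (from σ w)) (p (from σ w)))

    graftTree : TreeOn D (V ⊎ᶠ ⊤ᶠ) → TreeOn D W → TreeOn D (V ⊎ᶠ W)
    graftTree {V} {W} (t ⊢ p) (u ⊢ q) = graft t u ⊢ λ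
      { (inj₁ v) → trans (occurs-graft₁ V W t u v) (p (inj₁ v))
      ; (inj₂ w) → trans (occurs-graft₂ V W t u w) (cong₂ ℕ._*_ (p (inj₂ tt)) (q w))
      }

  data Combination (A : Set m) : Set (c ⊔ m) where
    [_] : A → Combination A
    𝟘   : Combination A
    _⊕_ : Combination A → Combination A → Combination A
    _⊙_ : 𝕂 → Combination A → Combination A

  infixl 6 _⊕_
  infixr 7 _⊙_

  extend : (M : VectorSpace m e) {A : Set m′} → (A → ∣ M ∣) → Combination A → ∣ M ∣
  extend M f [ a ]   = f a
  extend M f 𝟘       = LeftModule.0ᴹ M
  extend M f (x ⊕ y) = LeftModule._+ᴹ_ M (extend M f x) (extend M f y)
  extend M f (a ⊙ x) = LeftModule._*ₗ_ M a (extend M f x)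

  module FreeOperad (S : Species m e) where
    open Species S

    Decoration : Set m
    Decoration = ∣ obj (fin 2) ∣

    private
      module D = LeftModule (obj (fin 2))
      T : Set → Set m
      T = Tree Decoration

    -- Both sides are planar drawings of the same decorated tree.
    data _~_ {A : Set} : T A → T A → Set (m ⊔ e) where
      leaf : ∀ a → leaf a ~ leaf a
      node : ∀ {d d′ t t′ u u′} → d D.≈ᴹ d′ → t ~ t′ → u ~ u′ → node d t u ~ node d′ t′ u′
      swap : ∀ d t u → node d t u ~ node (act swap₂ d) u t

    -- Multilinearity in the decorations: Sum t t₁ t₂ when the three trees
    -- differ only at one node, where the decorations are d₁ + d₂, d₁ and d₂.
    data Sum {A : Set} : T A → T A → T A → Set m where
      here  : ∀ d₁ d₂ t u → Sum (node (d₁ D.+ᴹ d₂) t u) (node d₁ t u) (node d₂ t u)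
      left  : ∀ d u {t t₁ t₂} → Sum t t₁ t₂ → Sum (node d t u) (node d t₁ u) (node d t₂ u)
      right : ∀ d t {u u₁ u₂} → Sum u u₁ u₂ → Sum (node d t u) (node d t u₁) (node d t u₂)

    data Multiple {A : Set} (a : 𝕂) : T A → T A → Set (c ⊔ m) where
      here  : ∀ d t u → Multiple a (node (a D.*ₗ d) t u) (node d t u)
      left  : ∀ d u {t t₁} → Multiple a t t₁ → Multiple a (node d t u) (node d t₁ u)
      right : ∀ d t {u u₁} → Multiple a u u₁ → Multiple a (node d t u) (node d t u₁)

    Element : FinSet → Set (c ⊔ m)
    Element V = Combination (TreeOn Decoration V)

    infix 4 _≈_
    data _≈_ {V : FinSet} : Element V → Element V → Set (c ⊔ ℓ ⊔ m ⊔ e) where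
      same     : ∀ {t u} → tree t ~ tree u → [ t ] ≈ [ u ]
      sum      : ∀ {t t₁ t₂} → Sum (tree t) (tree t₁) (tree t₂) → [ t ] ≈ [ t₁ ] ⊕ [ t₂ ]
      multiple : ∀ {a t u} → Multiple a (tree t) (tree u) → [ t ] ≈ a ⊙ [ u ]
      ≈-refl   : ∀ {x} → x ≈ x
      ≈-sym    : ∀ {x y} → x ≈ y → y ≈ x
      ≈-trans  : ∀ {x y z} → x ≈ y → y ≈ z → x ≈ z
      ⊕-cong   : ∀ {x x′ y y′} → x ≈ x′ → y ≈ y′ → x ⊕ y ≈ x′ ⊕ y′
      ⊙-cong   : ∀ {a a′ x x′} → a ≈ₖ a′ → x ≈ x′ → a ⊙ x ≈ a′ ⊙ x′
      ⊕-assoc     : ∀ x y z → (x ⊕ y) ⊕ z ≈ x ⊕ (y ⊕ z)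
      ⊕-comm      : ∀ x y → x ⊕ y ≈ y ⊕ x
      ⊕-identityˡ : ∀ x → 𝟘 ⊕ x ≈ x
      ⊙-zeroˡ     : ∀ x → 0# ⊙ x ≈ 𝟘
      ⊙-identityˡ : ∀ x → 1# ⊙ x ≈ x
      ⊙-assoc     : ∀ a b x → (a *ₖ b) ⊙ x ≈ a ⊙ (b ⊙ x)
      ⊙-distribˡ  : ∀ a x y → a ⊙ (x ⊕ y) ≈ (a ⊙ x) ⊕ (a ⊙ y)
      ⊙-distribʳ  : ∀ x a b → (a +ₖ b) ⊙ x ≈ (a ⊙ x) ⊕ (b ⊙ x)

    private
      -x+x : ∀ {V} (x : Element V) → ((-ₖ 1#) ⊙ x) ⊕ x ≈ 𝟘
      -x+x x = ≈-trans (⊕-cong ≈-refl (≈-sym (⊙-identityˡ x)))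
        (≈-trans (≈-sym (⊙-distribʳ x _ _)) (≈-trans (⊙-cong (𝕂.-‿inverseˡ 1#) ≈-refl) (⊙-zeroˡ x)))

    freeObj : FinSet → VectorSpace (c ⊔ m) (c ⊔ ℓ ⊔ m ⊔ e)
    freeObj V = record
      { Carrierᴹ = Element V
      ; _≈ᴹ_ = _≈_
      ; _+ᴹ_ = _⊕_ ; _*ₗ_ = _⊙_ ; 0ᴹ = 𝟘 ; -ᴹ_ = (-ₖ 1#) ⊙_
      ; isLeftModule = record
        { isLeftSemimodule = record
          { +ᴹ-isCommutativeMonoid = record
            { isMonoid = record
              { isSemigroup = record
                { isMagma = record
                  { isEquivalence = record { refl = ≈-refl ; sym = ≈-sym ; trans = ≈-trans }
                  ; ∙-cong = ⊕-cong
                  }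
                ; assoc = ⊕-assoc
                }
              ; identity = ⊕-identityˡ , (λ x → ≈-trans (⊕-comm x 𝟘) (⊕-identityˡ x))
              }
            ; comm = ⊕-comm
            }
          ; isPreleftSemimodule = record
            { *ₗ-cong = ⊙-cong
            ; *ₗ-zeroˡ = ⊙-zeroˡ
            ; *ₗ-distribʳ = ⊙-distribʳ
            ; *ₗ-identityˡ = ⊙-identityˡ
            ; *ₗ-assoc = ⊙-assoc
            ; *ₗ-zeroʳ = λ a → ≈-trans (⊙-cong 𝕂.refl (≈-sym (⊙-zeroˡ 𝟘)))
                (≈-trans (≈-sym (⊙-assoc a 0# 𝟘))
                (≈-trans (⊙-cong (𝕂.zeroʳ a) ≈-refl) (⊙-zeroˡ 𝟘)))
            ; *ₗ-distribˡ = ⊙-distribˡ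
            }
          }
        ; -ᴹ‿cong = ⊙-cong 𝕂.refl
        ; -ᴹ‿inverse = -x+x , (λ x → ≈-trans (⊕-comm x _) (-x+x x))
        }
      }

    module _ (M : VectorSpace m′ e′) where
      open LeftModule M

      record Compatible {V} (f : TreeOn Decoration V → ∣ M ∣) : Set (c ⊔ m ⊔ e ⊔ e′) where
        field
          f-same     : ∀ {t u} → tree t ~ tree u → f t ≈ᴹ f u
          f-sum      : ∀ {t t₁ t₂} → Sum (tree t) (tree t₁) (tree t₂) → f t ≈ᴹ f t₁ +ᴹ f t₂
          f-multiple : ∀ {a t u} → Multiple a (tree t) (tree u) → f t ≈ᴹ a *ₗ f u

      module _ {V} {f : TreeOn Decoration V → ∣ M ∣} (compatible : Compatible f) where
        open Compatible compatible

        extend-cong : ∀ {x y} → x ≈ y → extend M f x ≈ᴹ extend M f y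
        extend-cong (same p)            = f-same p
        extend-cong (sum p)             = f-sum p
        extend-cong (multiple p)        = f-multiple p
        extend-cong ≈-refl              = ≈ᴹ-refl
        extend-cong (≈-sym p)           = ≈ᴹ-sym (extend-cong p)
        extend-cong (≈-trans p q)       = ≈ᴹ-trans (extend-cong p) (extend-cong q)
        extend-cong (⊕-cong p q)        = +ᴹ-cong (extend-cong p) (extend-cong q)
        extend-cong (⊙-cong a p)        = *ₗ-cong a (extend-cong p)
        extend-cong (⊕-assoc x y z)     = +ᴹ-assoc _ _ _
        extend-cong (⊕-comm x y)        = +ᴹ-comm _ _
        extend-cong (⊕-identityˡ x)     = +ᴹ-identityˡ _
        extend-cong (⊙-zeroˡ x)         = *ₗ-zeroˡ _
        extend-cong (⊙-identityˡ x)     = *ₗ-identityˡ _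
        extend-cong (⊙-assoc a b x)     = *ₗ-assoc a b _
        extend-cong (⊙-distribˡ a x y)  = *ₗ-distribˡ a _ _
        extend-cong (⊙-distribʳ x a b)  = *ₗ-distribʳ _ a b

        extend-linear : IsLinear (freeObj V) M (extend M f)
        extend-linear = linear {M = freeObj V} {N = M}
          extend-cong (λ _ _ → ≈ᴹ-refl) (λ _ _ → ≈ᴹ-refl)

      module _ {A : Set m} where

        extend-≈ : {f g : A → ∣ M ∣} → (∀ a → f a ≈ᴹ g a) → ∀ x → extend M f x ≈ᴹ extend M g x
        extend-≈ p [ a ]   = p a
        extend-≈ p 𝟘       = ≈ᴹ-refl
        extend-≈ p (x ⊕ y) = +ᴹ-cong (extend-≈ p x) (extend-≈ p y)
        extend-≈ p (a ⊙ x) = *ₗ-cong 𝕂.refl (extend-≈ p x)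

        extend-+ : {f g h : A → ∣ M ∣} → (∀ a → f a ≈ᴹ g a +ᴹ h a) →
                   ∀ x → extend M f x ≈ᴹ extend M g x +ᴹ extend M h x
        extend-+ p [ a ]   = p a
        extend-+ p 𝟘       = ≈ᴹ-sym (+ᴹ-identityˡ 0ᴹ)
        extend-+ p (x ⊕ y) = ≈ᴹ-trans (+ᴹ-cong (extend-+ p x) (extend-+ p y))
                                      (+ᴹ-interchange {M = M} _ _ _ _)
        extend-+ p (a ⊙ x) = ≈ᴹ-trans (*ₗ-cong 𝕂.refl (extend-+ p x)) (*ₗ-distribˡ a _ _)

        extend-* : ∀ {b} {f g : A → ∣ M ∣} → (∀ a → f a ≈ᴹ b *ₗ g a) →
                   ∀ x → extend M f x ≈ᴹ b *ₗ extend M g x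
        extend-* p [ a ]   = p a
        extend-* p 𝟘       = ≈ᴹ-sym (*ₗ-zeroʳ _)
        extend-* p (x ⊕ y) = ≈ᴹ-trans (+ᴹ-cong (extend-* p x) (extend-* p y))
                                      (≈ᴹ-sym (*ₗ-distribˡ _ _ _))
        extend-* {b} p (a ⊙ x) = ≈ᴹ-trans (*ₗ-cong 𝕂.refl (extend-* p x))
          (≈ᴹ-trans (≈ᴹ-sym (*ₗ-assoc a b _))
          (≈ᴹ-trans (*ₗ-cong (𝕂.*-comm a b) ≈ᴹ-refl) (*ₗ-assoc b a _)))

    module _ {A : Set} where

      ~-refl : (t : T A) → t ~ t
      ~-refl (leaf a)     = leaf a
      ~-refl (node d t u) = node D.≈ᴹ-refl (~-refl t) (~-refl u)

      ~-reflexive : {t u : T A} → t ≡ u → t ~ u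
      ~-reflexive refl = ~-refl _

    module _ {A B : Set} where

      map-~ : (f : A → B) {t u : T A} → t ~ u → mapTree f t ~ mapTree f u
      map-~ f (leaf a)     = leaf (f a)
      map-~ f (node d p q) = node d (map-~ f p) (map-~ f q)
      map-~ f (swap d t u) = swap d _ _

      map-Sum : (f : A → B) {t t₁ t₂ : T A} → Sum t t₁ t₂ → Sum (mapTree f t) (mapTree f t₁) (mapTree f t₂)
      map-Sum f (here d₁ d₂ t u) = here d₁ d₂ _ _
      map-Sum f (left d u p)     = left d _ (map-Sum f p)
      map-Sum f (right d t p)    = right d _ (map-Sum f p)

      map-Multiple : ∀ {a} (f : A → B) {t t₁ : T A} → Multiple a t t₁ → Multiple a (mapTree f t) (mapTree f t₁)
      map-Multiple f (here d t u)  = here d _ _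
      map-Multiple f (left d u p)  = left d _ (map-Multiple f p)
      map-Multiple f (right d t p) = right d _ (map-Multiple f p)

    module _ {A B : Set} where

      graft-~ˡ : {t t′ : T (A ⊎ ⊤)} (u : T B) → t ~ t′ → graft t u ~ graft t′ u
      graft-~ˡ u (leaf a)      = ~-refl _
      graft-~ˡ u (node d p q)  = node d (graft-~ˡ u p) (graft-~ˡ u q)
      graft-~ˡ u (swap d t t′) = swap d _ _

      graft-Sumˡ : {t t₁ t₂ : T (A ⊎ ⊤)} (u : T B) → Sum t t₁ t₂ → Sum (graft t u) (graft t₁ u) (graft t₂ u)
      graft-Sumˡ u (here d₁ d₂ t t′) = here d₁ d₂ _ _
      graft-Sumˡ u (left d t′ p)     = left d _ (graft-Sumˡ u p)
      graft-Sumˡ u (right d t p)     = right d _ (graft-Sumˡ u p)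

      graft-Multipleˡ : ∀ {a} {t t₁ : T (A ⊎ ⊤)} (u : T B) → Multiple a t t₁ → Multiple a (graft t u) (graft t₁ u)
      graft-Multipleˡ u (here d t t′) = here d _ _
      graft-Multipleˡ u (left d t′ p) = left d _ (graft-Multipleˡ u p)
      graft-Multipleˡ u (right d t p) = right d _ (graft-Multipleˡ u p)

      graft-~ʳ : (t : T (A ⊎ ⊤)) {u u′ : T B} → u ~ u′ → graft t u ~ graft t u′
      graft-~ʳ (leaf (inj₁ a)) p = leaf _
      graft-~ʳ (leaf (inj₂ _)) p = map-~ inj₂ p
      graft-~ʳ (node d t t′)   p = node D.≈ᴹ-refl (graft-~ʳ t p) (graft-~ʳ t′ p)

    stars : {A : Set} → T (A ⊎ ⊤) → ℕ
    stars (leaf (inj₁ _)) = 0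
    stars (leaf (inj₂ _)) = 1
    stars (node _ t u)    = stars t ℕ.+ stars u

    occurs-star : ∀ V (t : T (Carrier V ⊎ ⊤)) → occurrences (V ⊎ᶠ ⊤ᶠ) t (inj₂ tt) ≡ stars t
    occurs-star V (leaf (inj₁ x)) rewrite dec-false (FinSet._≟_ (V ⊎ᶠ ⊤ᶠ) (inj₁ x) (inj₂ tt)) (λ ()) = refl
    occurs-star V (leaf (inj₂ tt)) rewrite dec-true (FinSet._≟_ (V ⊎ᶠ ⊤ᶠ) (inj₂ tt) (inj₂ tt)) refl = refl
    occurs-star V (node _ t u) = cong₂ ℕ._+_ (occurs-star V t) (occurs-star V u)

    one-star : (t : TreeOn Decoration (V ⊎ᶠ ⊤ᶠ)) → stars (tree t) ≡ 1
    one-star {V} (t ⊢ p) = trans (sym (occurs-star V t)) (p (inj₂ tt))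

    split : ∀ m n → m ℕ.+ n ≡ 1 → (m ≡ 0 × n ≡ 1) ⊎ (m ≡ 1 × n ≡ 0)
    split 0 n p = inj₁ (refl , p)
    split 1 0 p = inj₂ (refl , refl)

    module _ {A B : Set} where

      graft-none : (t : T (A ⊎ ⊤)) (u u′ : T B) → stars t ≡ 0 → graft t u ≡ graft t u′
      graft-none (leaf (inj₁ a)) u u′ p = refl
      graft-none (node d t t′)   u u′ p = cong₂ (node d)
        (graft-none t u u′ (ℕ.m+n≡0⇒m≡0 (stars t) p))
        (graft-none t′ u u′ (ℕ.m+n≡0⇒n≡0 (stars t) p))

      graft-Sumʳ : (t : T (A ⊎ ⊤)) → stars t ≡ 1 → {u u₁ u₂ : T B} →
                   Sum u u₁ u₂ → Sum (graft t u) (graft t u₁) (graft t u₂)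
      graft-Sumʳ (leaf (inj₂ _)) s p = map-Sum inj₂ p
      graft-Sumʳ (node d t t′) s {u} {u₁} {u₂} p with split (stars t) (stars t′) s
      ... | inj₁ (s₀ , s₁) rewrite graft-none t u u₁ s₀ | graft-none t u₁ u₂ s₀ = right d _ (graft-Sumʳ t′ s₁ p)
      ... | inj₂ (s₁ , s₀) rewrite graft-none t′ u u₁ s₀ | graft-none t′ u₁ u₂ s₀ = left d _ (graft-Sumʳ t s₁ p)

      graft-Multipleʳ : ∀ {a} (t : T (A ⊎ ⊤)) → stars t ≡ 1 → {u u₁ : T B} →
                        Multiple a u u₁ → Multiple a (graft t u) (graft t u₁)
      graft-Multipleʳ (leaf (inj₂ _)) s p = map-Multiple inj₂ p
      graft-Multipleʳ (node d t t′) s {u} {u₁} p with split (stars t) (stars t′) s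
      ... | inj₁ (s₀ , s₁) rewrite graft-none t u u₁ s₀ = right d _ (graft-Multipleʳ t′ s₁ p)
      ... | inj₂ (s₁ , s₀) rewrite graft-none t′ u u₁ s₀ = left d _ (graft-Multipleʳ t s₁ p)

    relabelling : V ≃ W → Element V → Element W
    relabelling {W = W} σ = extend (freeObj W) (λ t → [ relabelTree σ t ])

    composite : ∀ V W → Element (V ⊎ᶠ ⊤ᶠ) → Element W → Element (V ⊎ᶠ W)
    composite V W x y = extend M (λ t → extend M (λ u → [ graftTree t u ]) y) x
      where M = freeObj (V ⊎ᶠ W)

    private
      relabelling-compatible : (σ : V ≃ W) → Compatible (freeObj W) (λ t → [ relabelTree σ t ])
      relabelling-compatible σ = record
        { f-same = λ p → same (map-~ (to σ) p)
        ; f-sum = λ p → sum (map-Sum (to σ) p)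
        ; f-multiple = λ p → multiple (map-Multiple (to σ) p)
        }

      composite-compatibleʳ : (t : TreeOn Decoration (V ⊎ᶠ ⊤ᶠ)) →
        Compatible (freeObj (V ⊎ᶠ W)) {W} (λ u → [ graftTree t u ])
      composite-compatibleʳ t = record
        { f-same = λ p → same (graft-~ʳ (tree t) p)
        ; f-sum = λ p → sum (graft-Sumʳ (tree t) (one-star t) p)
        ; f-multiple = λ p → multiple (graft-Multipleʳ (tree t) (one-star t) p)
        }

      composite-compatibleˡ : ∀ V W y → Compatible (freeObj (V ⊎ᶠ W)) {V ⊎ᶠ ⊤ᶠ} (λ t → composite V W [ t ] y)
      composite-compatibleˡ V W y = record
        { f-same = λ p → extend-≈ (freeObj (V ⊎ᶠ W)) (λ u → same (graft-~ˡ (tree u) p)) y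
        ; f-sum = λ p → extend-+ (freeObj (V ⊎ᶠ W)) (λ u → sum (graft-Sumˡ (tree u) p)) y
        ; f-multiple = λ p → extend-* (freeObj (V ⊎ᶠ W)) (λ u → multiple (graft-Multipleˡ (tree u) p)) y
        }

      composite-+ʳ : ∀ V W x y y′ → composite V W x (y ⊕ y′) ≈ composite V W x y ⊕ composite V W x y′
      composite-+ʳ V W x y y′ = extend-+ (freeObj (V ⊎ᶠ W)) (λ t → ≈-refl) x

      composite-*ʳ : ∀ V W x a y → composite V W x (a ⊙ y) ≈ a ⊙ composite V W x y
      composite-*ʳ V W x a y = extend-* (freeObj (V ⊎ᶠ W)) (λ t → ≈-refl) x

      composite-0ʳ : ∀ V W x → composite V W x 𝟘 ≈ 𝟘
      composite-0ʳ V W x = ≈-trans (extend-* (freeObj (V ⊎ᶠ W)) {b = 0#} {g = λ _ → 𝟘} (λ t → ≈-sym (⊙-zeroˡ 𝟘)) x) (⊙-zeroˡ _)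

      composite-congʳ : ∀ V W x {y y′} → y ≈ y′ → composite V W x y ≈ composite V W x y′
      composite-congʳ V W x p = extend-≈ (freeObj (V ⊎ᶠ W)) (λ t → extend-cong _ (composite-compatibleʳ t) p) x

      same≡ : {t u : TreeOn Decoration V} → tree t ≡ tree u → [ t ] ≈ [ u ]
      same≡ p = same (~-reflexive p)

      module _ {A B C : Set} where

        map-map : (g : B → C) (f : A → B) (t : T A) → mapTree g (mapTree f t) ≡ mapTree (g ∘ f) t
        map-map g f (leaf a)     = refl
        map-map g f (node d t u) = cong₂ (node d) (map-map g f t) (map-map g f u)

      module _ {A B : Set} where

        map-ext : {f g : A → B} → (∀ a → f a ≡ g a) → (t : T A) → mapTree f t ≡ mapTree g t
        map-ext p (leaf a)     = cong leaf (p a)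
        map-ext p (node d t u) = cong₂ (node d) (map-ext p t) (map-ext p u)

      map-id : {A : Set} (t : T A) → mapTree id t ≡ t
      map-id (leaf a)     = refl
      map-id (node d t u) = cong₂ (node d) (map-id t) (map-id u)

      bind : {A B : Set} → (A → T B) → T A → T B
      bind f (leaf a)     = f a
      bind f (node d t u) = node d (bind f t) (bind f u)

      onStar : {A B : Set} → T B → A ⊎ ⊤ → T (A ⊎ B)
      onStar u (inj₁ a) = leaf (inj₁ a)
      onStar u (inj₂ _) = mapTree inj₂ u

      graft-bind : {A B : Set} (t : T (A ⊎ ⊤)) (u : T B) → graft t u ≡ bind (onStar u) t
      graft-bind (leaf (inj₁ a)) u = refl
      graft-bind (leaf (inj₂ _)) u = refl
      graft-bind (node d t t′)   u = cong₂ (node d) (graft-bind t u) (graft-bind t′ u)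

      bind-ext : {A B : Set} {f g : A → T B} → (∀ a → f a ≡ g a) → (t : T A) → bind f t ≡ bind g t
      bind-ext p (leaf a)     = p a
      bind-ext p (node d t u) = cong₂ (node d) (bind-ext p t) (bind-ext p u)

      bind-map : {A B C : Set} (g : B → T C) (f : A → B) (t : T A) → bind g (mapTree f t) ≡ bind (g ∘ f) t
      bind-map g f (leaf a)     = refl
      bind-map g f (node d t u) = cong₂ (node d) (bind-map g f t) (bind-map g f u)

      map-bind : {A B C : Set} (g : B → C) (f : A → T B) (t : T A) → mapTree g (bind f t) ≡ bind (mapTree g ∘ f) t
      map-bind g f (leaf a)     = refl
      map-bind g f (node d t u) = cong₂ (node d) (map-bind g f t) (map-bind g f u)

      bind-bind : {A B C : Set} (g : B → T C) (f : A → T B) (t : T A) → bind g (bind f t) ≡ bind (bind g ∘ f) t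
      bind-bind g f (leaf a)     = refl
      bind-bind g f (node d t u) = cong₂ (node d) (bind-bind g f t) (bind-bind g f u)

      leafᵀ : {A : Set} → A → T A
      leafᵀ = leaf

      bind-leaf : {A B : Set} (f : A → B) (t : T A) → bind (leafᵀ ∘ f) t ≡ mapTree f t
      bind-leaf f (leaf a)     = refl
      bind-leaf f (node d t u) = cong₂ (node d) (bind-leaf f t) (bind-leaf f u)

    freeSpecies : Species (c ⊔ m) (c ⊔ ℓ ⊔ m ⊔ e)
    freeSpecies = record
      { obj = freeObj
      ; act = relabelling
      ; act-linear = λ σ → extend-linear _ (relabelling-compatible σ)
      ; act-ext = λ {V} {W} σ τ σ≡τ → extend-≈ (freeObj W) (λ t → same≡ (map-ext σ≡τ (tree t)))
      ; act-id = identity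
      ; act-∘ = composition
      }
      where
      identity : (x : Element V) → relabelling id≃ x ≈ x
      identity [ t ]   = same≡ (map-id (tree t))
      identity 𝟘       = ≈-refl
      identity (x ⊕ y) = ⊕-cong (identity x) (identity y)
      identity (a ⊙ x) = ⊙-cong 𝕂.refl (identity x)

      composition : (τ : V ≃ W) (σ : U ≃ V) → ∀ x → relabelling (τ ∘≃ σ) x ≈ relabelling τ (relabelling σ x)
      composition τ σ [ t ]   = same≡ (sym (map-map (to τ) (to σ) (tree t)))
      composition τ σ 𝟘       = ≈-refl
      composition τ σ (x ⊕ y) = ⊕-cong (composition τ σ x) (composition τ σ y)
      composition τ σ (a ⊙ x) = ⊙-cong 𝕂.refl (composition τ σ x)

    freeUnit : Element ⊤ᶠ
    freeUnit = [ leaf tt ⊢ (λ _ → refl) ]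

    private
      equivariant : (σ : U ≃ V) (τ : W ≃ X) → ∀ x y →
        composite V X (relabelling (σ ⊎≃ id≃) x) (relabelling τ y) ≈ relabelling (σ ⊎≃ τ) (composite U W x y)
      equivariant {U} {V} {W} {X} σ τ [ t ] [ u ] = same≡ (begin
        graft (mapTree σ∗ (tree t)) (mapTree (to τ) (tree u))
          ≡⟨ graft-bind (mapTree σ∗ (tree t)) _ ⟩
        bind (onStar (mapTree (to τ) (tree u))) (mapTree σ∗ (tree t))
          ≡⟨ bind-map (onStar (mapTree (to τ) (tree u))) σ∗ (tree t) ⟩
        bind (onStar (mapTree (to τ) (tree u)) ∘ σ∗) (tree t)
          ≡⟨ bind-ext (λ { (inj₁ _) → refl
                         ; (inj₂ _) → trans (map-map inj₂ (to τ) (tree u)) (sym (map-map στ inj₂ (tree u))) }) (tree t) ⟩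
        bind (mapTree στ ∘ onStar (tree u)) (tree t)
          ≡⟨ map-bind στ (onStar (tree u)) (tree t) ⟨
        mapTree στ (bind (onStar (tree u)) (tree t))
          ≡⟨ cong (mapTree στ) (graft-bind (tree t) (tree u)) ⟨
        mapTree στ (graft (tree t) (tree u)) ∎)
        where
        open ≡.≡-Reasoning
        σ∗ : Carrier U ⊎ ⊤ → Carrier V ⊎ ⊤
        σ∗ = to (σ ⊎≃ id≃ {⊤ᶠ})
        στ : Carrier U ⊎ Carrier W → Carrier V ⊎ Carrier X
        στ = to (σ ⊎≃ τ)
      equivariant σ τ [ t ] 𝟘        = ≈-refl
      equivariant σ τ [ t ] (y ⊕ y′) = ⊕-cong (equivariant σ τ [ t ] y) (equivariant σ τ [ t ] y′)
      equivariant σ τ [ t ] (a ⊙ y)  = ⊙-cong 𝕂.refl (equivariant σ τ [ t ] y)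
      equivariant σ τ 𝟘 y            = ≈-refl
      equivariant σ τ (x ⊕ x′) y     = ⊕-cong (equivariant σ τ x y) (equivariant σ τ x′ y)
      equivariant σ τ (a ⊙ x) y      = ⊙-cong 𝕂.refl (equivariant σ τ x y)

      identityˡ : (y : Element V) →
        relabelling ⊥⊎≃ (composite ⊥ᶠ V (relabelling (⊥⊎≃ ⁻¹≃) freeUnit) y) ≈ y
      identityˡ [ u ]    = same≡ (trans (map-map (to ⊥⊎≃) inj₂ (tree u)) (map-id (tree u)))
      identityˡ 𝟘        = ≈-refl
      identityˡ (y ⊕ y′) = ⊕-cong (identityˡ y) (identityˡ y′)
      identityˡ (a ⊙ y)  = ⊙-cong 𝕂.refl (identityˡ y)

      identityʳ : (x : Element (V ⊎ᶠ ⊤ᶠ)) → composite V ⊤ᶠ x freeUnit ≈ x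
      identityʳ [ t ]    = same≡ (trans (graft-bind (tree t) (leaf tt))
        (trans (bind-ext (λ { (inj₁ _) → refl ; (inj₂ _) → refl }) (tree t))
        (trans (bind-leaf id (tree t)) (map-id (tree t)))))
      identityʳ 𝟘        = ≈-refl
      identityʳ (x ⊕ x′) = ⊕-cong (identityʳ x) (identityʳ x′)
      identityʳ (a ⊙ x)  = ⊙-cong 𝕂.refl (identityʳ x)

      sequential : ∀ U V W x y z →
        relabelling (assoc≃ U V W) (composite (U ⊎ᶠ V) W (relabelling (assoc≃ U V ⊤ᶠ ⁻¹≃) (composite U (V ⊎ᶠ ⊤ᶠ) x y)) z)
        ≈ composite U (V ⊎ᶠ W) x (composite V W y z)
      sequential U V W [ t ] [ u ] [ w ] = same≡ (begin
        mapTree α (graft (mapTree α⁻¹ (graft (tree t) (tree u))) (tree w))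
          ≡⟨ cong (mapTree α) (trans (graft-bind (mapTree α⁻¹ (graft (tree t) (tree u))) (tree w))
               (trans (bind-map _ α⁻¹ (graft (tree t) (tree u)))
               (trans (cong (bind (onStar (tree w) ∘ α⁻¹)) (graft-bind (tree t) (tree u)))
                      (bind-bind _ _ (tree t))))) ⟩
        mapTree α (bind (bind (onStar (tree w) ∘ α⁻¹) ∘ onStar (tree u)) (tree t))
          ≡⟨ map-bind α _ (tree t) ⟩
        bind (mapTree α ∘ bind (onStar (tree w) ∘ α⁻¹) ∘ onStar (tree u)) (tree t)
          ≡⟨ bind-ext (λ { (inj₁ _) → refl ; (inj₂ _) → inner }) (tree t) ⟩
        bind (onStar (graft (tree u) (tree w))) (tree t)
          ≡⟨ graft-bind (tree t) _ ⟨
        graft (tree t) (graft (tree u) (tree w)) ∎)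
        where
        open ≡.≡-Reasoning
        α = to (assoc≃ U V W)
        α⁻¹ = from (assoc≃ U V ⊤ᶠ)
        inner : mapTree α (bind (onStar (tree w) ∘ α⁻¹) (mapTree inj₂ (tree u))) ≡ mapTree inj₂ (graft (tree u) (tree w))
        inner = begin
          mapTree α (bind (onStar (tree w) ∘ α⁻¹) (mapTree inj₂ (tree u)))
            ≡⟨ cong (mapTree α) (bind-map _ inj₂ (tree u)) ⟩
          mapTree α (bind (onStar (tree w) ∘ α⁻¹ ∘ inj₂) (tree u))
            ≡⟨ map-bind α _ (tree u) ⟩
          bind (mapTree α ∘ onStar (tree w) ∘ α⁻¹ ∘ inj₂) (tree u)
            ≡⟨ bind-ext (λ { (inj₁ _) → refl
                           ; (inj₂ _) → trans (map-map α inj₂ (tree w)) (sym (map-map inj₂ inj₂ (tree w))) }) (tree u) ⟩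
          bind (mapTree inj₂ ∘ onStar (tree w)) (tree u)
            ≡⟨ map-bind inj₂ _ (tree u) ⟨
          mapTree inj₂ (bind (onStar (tree w)) (tree u))
            ≡⟨ cong (mapTree inj₂) (graft-bind (tree u) (tree w)) ⟨
          mapTree inj₂ (graft (tree u) (tree w)) ∎
      sequential U V W [ t ] [ u ] 𝟘        = ≈-refl
      sequential U V W [ t ] [ u ] (z ⊕ z′) = ⊕-cong (sequential U V W [ t ] [ u ] z) (sequential U V W [ t ] [ u ] z′)
      sequential U V W [ t ] [ u ] (a ⊙ z)  = ⊙-cong 𝕂.refl (sequential U V W [ t ] [ u ] z)
      sequential U V W [ t ] 𝟘 z            = ≈-refl
      sequential U V W [ t ] (y ⊕ y′) z     = ⊕-cong (sequential U V W [ t ] y z) (sequential U V W [ t ] y′ z)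
      sequential U V W [ t ] (a ⊙ y) z      = ⊙-cong 𝕂.refl (sequential U V W [ t ] y z)
      sequential U V W 𝟘 y z                = ≈-refl
      sequential U V W (x ⊕ x′) y z         = ⊕-cong (sequential U V W x y z) (sequential U V W x′ y z)
      sequential U V W (a ⊙ x) y z          = ⊙-cong 𝕂.refl (sequential U V W x y z)

      grafted : ∀ U W → TreeOn Decoration ((U ⊎ᶠ ⊤ᶠ) ⊎ᶠ ⊤ᶠ) → Element W → Element ((U ⊎ᶠ W) ⊎ᶠ ⊤ᶠ)
      grafted U W t z = relabelling (exchange≃ U ⊤ᶠ W) (composite (U ⊎ᶠ ⊤ᶠ) W (relabelling (exchange≃ U ⊤ᶠ ⊤ᶠ) [ t ]) z)

      parallel : ∀ U V W x y z →
        composite (U ⊎ᶠ V) W (relabelling (exchange≃ U ⊤ᶠ V) (composite (U ⊎ᶠ ⊤ᶠ) V x y)) z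
        ≈ relabelling (exchange≃ U W V) (composite (U ⊎ᶠ W) V
            (relabelling (exchange≃ U ⊤ᶠ W) (composite (U ⊎ᶠ ⊤ᶠ) W (relabelling (exchange≃ U ⊤ᶠ ⊤ᶠ) x) z)) y)
      parallel U V W [ t ] [ u ] [ w ] = same≡ (begin
        graft (mapTree χ₁ (graft (tree t) (tree u))) (tree w)
          ≡⟨ trans (graft-bind (mapTree χ₁ (graft (tree t) (tree u))) (tree w))
             (trans (bind-map _ χ₁ (graft (tree t) (tree u)))
             (trans (cong (bind (onStar (tree w) ∘ χ₁)) (graft-bind (tree t) (tree u)))
                    (bind-bind _ _ (tree t)))) ⟩
        bind (bind (onStar (tree w) ∘ χ₁) ∘ onStar (tree u)) (tree t)
          ≡⟨ bind-ext cases (tree t) ⟩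
        bind (mapTree χ₄ ∘ bind (onStar (tree u) ∘ χ₃) ∘ onStar (tree w) ∘ χ₂) (tree t)
          ≡⟨ map-bind χ₄ _ (tree t) ⟨
        mapTree χ₄ (bind (bind (onStar (tree u) ∘ χ₃) ∘ onStar (tree w) ∘ χ₂) (tree t))
          ≡⟨ cong (mapTree χ₄)
             (trans (graft-bind (mapTree χ₃ (graft (mapTree χ₂ (tree t)) (tree w))) (tree u))
             (trans (bind-map _ χ₃ (graft (mapTree χ₂ (tree t)) (tree w)))
             (trans (cong (bind (onStar (tree u) ∘ χ₃)) (trans (graft-bind (mapTree χ₂ (tree t)) (tree w)) (bind-map _ χ₂ (tree t))))
                    (bind-bind _ _ (tree t))))) ⟨
        mapTree χ₄ (graft (mapTree χ₃ (graft (mapTree χ₂ (tree t)) (tree w))) (tree u)) ∎)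
        where
        open ≡.≡-Reasoning
        χ₁ = to (exchange≃ U ⊤ᶠ V)
        χ₂ = to (exchange≃ U ⊤ᶠ ⊤ᶠ)
        χ₃ = to (exchange≃ U ⊤ᶠ W)
        χ₄ = to (exchange≃ U W V)
        cases : ∀ a → bind (onStar (tree w) ∘ χ₁) (onStar (tree u) a)
                      ≡ mapTree χ₄ (bind (onStar (tree u) ∘ χ₃) (onStar (tree w) (χ₂ a)))
        cases (inj₁ (inj₁ _)) = refl
        cases (inj₁ (inj₂ _)) = begin
          mapTree inj₂ (tree w)
            ≡⟨ map-map χ₄ (inj₁ ∘ inj₂) (tree w) ⟨
          mapTree χ₄ (mapTree (inj₁ ∘ inj₂) (tree w))
            ≡⟨ cong (mapTree χ₄) (bind-leaf (inj₁ ∘ inj₂) (tree w)) ⟨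
          mapTree χ₄ (bind (leafᵀ ∘ inj₁ ∘ inj₂) (tree w))
            ≡⟨ cong (mapTree χ₄) (bind-map _ inj₂ (tree w)) ⟨
          mapTree χ₄ (bind (onStar (tree u) ∘ χ₃) (mapTree inj₂ (tree w))) ∎
        cases (inj₂ _) = begin
          bind (onStar (tree w) ∘ χ₁) (mapTree inj₂ (tree u))
            ≡⟨ bind-map _ inj₂ (tree u) ⟩
          bind (leafᵀ ∘ inj₁ ∘ inj₂) (tree u)
            ≡⟨ bind-leaf (inj₁ ∘ inj₂) (tree u) ⟩
          mapTree (inj₁ ∘ inj₂) (tree u)
            ≡⟨ map-map χ₄ inj₂ (tree u) ⟨
          mapTree χ₄ (mapTree inj₂ (tree u)) ∎
      parallel U V W [ t ] [ u ] 𝟘        = ≈-refl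
      parallel U V W [ t ] [ u ] (z ⊕ z′) = ⊕-cong (parallel U V W [ t ] [ u ] z) (parallel U V W [ t ] [ u ] z′)
      parallel U V W [ t ] [ u ] (a ⊙ z)  = ⊙-cong 𝕂.refl (parallel U V W [ t ] [ u ] z)
      parallel U V W [ t ] 𝟘 z =
        ≈-sym (extend-cong _ (relabelling-compatible (exchange≃ U W V)) (composite-0ʳ (U ⊎ᶠ W) V (grafted U W t z)))
      parallel U V W [ t ] (y ⊕ y′) z = ≈-trans
        (⊕-cong (parallel U V W [ t ] y z) (parallel U V W [ t ] y′ z))
        (≈-sym (extend-cong _ (relabelling-compatible (exchange≃ U W V)) (composite-+ʳ (U ⊎ᶠ W) V (grafted U W t z) y y′)))
      parallel U V W [ t ] (a ⊙ y) z = ≈-trans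
        (⊙-cong 𝕂.refl (parallel U V W [ t ] y z))
        (≈-sym (extend-cong _ (relabelling-compatible (exchange≃ U W V)) (composite-*ʳ (U ⊎ᶠ W) V (grafted U W t z) a y)))
      parallel U V W 𝟘 y z        = ≈-refl
      parallel U V W (x ⊕ x′) y z = ⊕-cong (parallel U V W x y z) (parallel U V W x′ y z)
      parallel U V W (a ⊙ x) y z  = ⊙-cong 𝕂.refl (parallel U V W x y z)

    Free : Operad (c ⊔ m) (c ⊔ ℓ ⊔ m ⊔ e)
    Free = record
      { species = freeSpecies
      ; unit = freeUnit
      ; comp = composite
      ; comp-linearˡ = λ {V} {W} y → extend-linear _ (composite-compatibleˡ V W y)
      ; comp-linearʳ = λ {W} {V} x → linear {M = freeObj W} {N = freeObj (V ⊎ᶠ W)}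
          (composite-congʳ V W x) (composite-+ʳ V W x) (composite-*ʳ V W x)
      ; comp-equivariant = equivariant
      ; comp-identityˡ = identityˡ
      ; comp-identityʳ = identityʳ
      ; comp-sequential = λ {U} {V} {W} → sequential U V W
      ; comp-parallel = λ {U} {V} {W} → parallel U V W
      }

    data TwoNodeTree : Family freeSpecies (lsuc 0ℓ ⊔ c ⊔ m) where
      two : ∀ {V t} → nodes (tree t) ≡ 2 → TwoNodeTree V [ t ]

    Free² : Family freeSpecies (lsuc 0ℓ ⊔ c ⊔ ℓ ⊔ m ⊔ e)
    Free² = Span freeSpecies TwoNodeTree

  open FreeOperad public using (Free; Free²; Element; two)

  -- outer(x, inner(y, z))
  record Grafting (S : Species m e) (A : Set) : Set m where
    constructor _⟨_,_⟨_,_⟩⟩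
    field
      outer : ∣ Species.obj S (fin 2) ∣
      x     : A
      inner : ∣ Species.obj S (fin 2) ∣
      y z   : A

  module _ (S : Species m e) {A : Set} where

    grafting : Tree ∣ Species.obj S (fin 2) ∣ A → Maybe (Grafting S A)
    grafting (node p (leaf x) (node q (leaf y) (leaf z))) = just (p ⟨ x , q ⟨ y , z ⟩⟩)
    grafting (node p (node q (leaf y) (leaf z)) (leaf x)) = just (Species.act S swap₂ p ⟨ x , q ⟨ y , z ⟩⟩)
    grafting _ = nothing

    drawn : Grafting S A → Tree ∣ Species.obj S (fin 2) ∣ A
    drawn (p ⟨ x , q ⟨ y , z ⟩⟩) = node p (leaf x) (node q (leaf y) (leaf z))

  OnceEach : (S : Species m e) → Grafting S (Fin 3) → Set
  OnceEach S g = True (Fin.all? (λ v → occurrences (fin 3) (drawn S g) v ℕ.≟ 1))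

  treeElement : (S : Species m e) (g : Grafting S (Fin 3)) → OnceEach S g → Element S (fin 3)
  treeElement S g once = [ drawn S g ⊢ toWitness once ]

  module _ (S : Species m e) where
    open Species S

    -- ⟨ f ∘* g ∣ p ∘* q ⟩ = f(p) g(q) when (x, y, z) is a cyclic rotation of
    -- the enumeration of V; ε makes this sign-equivariant.  The second
    -- case redraws p(x′,q(y′,z′)) as p(x,q·swap(y,z)).
    pairGraftings : ∀ V → Grafting (S ∨) (Carrier V) → Grafting S (Carrier V) → 𝕂
    pairGraftings V (f ⟨ x , g ⟨ y , z ⟩⟩) (p ⟨ x′ , q ⟨ y′ , z′ ⟩⟩) =
      if does (x ≟ x′) ∧ does (y ≟ y′) ∧ does (z ≟ z′)
        then ε *ₖ (⟦ f ⟧ p *ₖ ⟦ g ⟧ q)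
      else if does (x ≟ x′) ∧ does (y ≟ z′) ∧ does (z ≟ y′)
        then ε *ₖ (⟦ f ⟧ p *ₖ ⟦ g ⟧ (act swap₂ q))
      else 0#
      where
      open FinSet V using (_≟_)
      ε = signum (orientation V (x ∷ y ∷ z ∷ []))

    -- Only meaningful for trees with two nodes; zero on all others.
    pairTrees : ∀ V → TreeOn ∣ Species.obj (S ∨) (fin 2) ∣ V → TreeOn ∣ obj (fin 2) ∣ V → 𝕂
    pairTrees V t u with grafting (S ∨) (tree t) | grafting S (tree u)
    ... | just a  | just b  = pairGraftings V a b
    ... | just _  | nothing = 0#
    ... | nothing | _       = 0#

    ⟨_∣_⟩ : ∀ {V} → Element (S ∨) V → Element S V → 𝕂
    ⟨_∣_⟩ {V} f x = extend scalars (λ t → extend scalars (pairTrees V t) x) f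

    Orthogonal : Family (Operad.species (Free S)) r →
                 Family (Operad.species (Free (S ∨))) (lsuc 0ℓ ⊔ c ⊔ ℓ ⊔ m ⊔ e ⊔ r)
    Orthogonal R V f = Free² (S ∨) V f × (∀ x → R V x → ⟨ f ∣ x ⟩ ≈ₖ 0#)

  ConcentratedIn2 : Species m e → Set (lsuc 0ℓ ⊔ m ⊔ e)
  ConcentratedIn2 S = ∀ V → size V ≢ 2 → ∀ x → Species.obj S V ∋ x ≈ LeftModule.0ᴹ (Species.obj S V)

  record BinaryQuadratic m e r : Set (lsuc 0ℓ ⊔ c ⊔ ℓ ⊔ lsuc (m ⊔ e ⊔ r)) where
    field
      generators : Species m e
      binary     : ConcentratedIn2 generators
      relators   : Family (Operad.species (Free generators)) r
      quadratic  : ∀ {V x} → relators V x → Free² generators V x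

    -- The sub-species R; relators only generates it.
    relations : Family (Operad.species (Free generators)) (lsuc 0ℓ ⊔ c ⊔ ℓ ⊔ m ⊔ e ⊔ r)
    relations = Span (Operad.species (Free generators)) relators

  Ope : (P : BinaryQuadratic m e r) → Operad (c ⊔ m) (lsuc 0ℓ ⊔ c ⊔ ℓ ⊔ m ⊔ e ⊔ r)
  Ope P = Free generators / relations
    where open BinaryQuadratic P

  ∨-concentrated : (S : Species m e) → ConcentratedIn2 S → ConcentratedIn2 (S ∨)
  ∨-concentrated S S-binary V ∣V∣≢2 f x = 𝕂.trans (f.⟦⟧-cong (S-binary V ∣V∣≢2 x)) f.0ᴹ-homo
    where module f = Linear {M = Species.obj S V} {N = scalars} (Functional.isLinear f)

  infix 10 _!

  _! : BinaryQuadratic m e r → BinaryQuadratic (c ⊔ ℓ ⊔ m ⊔ e) (m ⊔ ℓ) (lsuc 0ℓ ⊔ c ⊔ ℓ ⊔ m ⊔ e ⊔ r)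
  P ! = record
    { generators = generators ∨
    ; binary     = ∨-concentrated generators binary
    ; relators   = Orthogonal generators relations
    ; quadratic  = proj₁
    }
    where open BinaryQuadratic P

  KoszulDual : (P : BinaryQuadratic m e r) →
               Operad (c ⊔ ℓ ⊔ m ⊔ e) (lsuc 0ℓ ⊔ c ⊔ ℓ ⊔ m ⊔ e ⊔ r)
  KoszulDual P = Ope (P !)

  -- Functions that vanish unless ∣V∣ = 2, where they are the coordinates
  -- in the basis mu, seg, fixed by all bijections.
  𝒢 : Species c ℓ
  𝒢 = record
    { obj = λ V → record
      { Carrierᴹ = Generator → size V ≡ 2 → 𝕂
      ; _≈ᴹ_ = λ x y → ∀ p q → x p q ≈ₖ y p q
      ; _+ᴹ_ = λ x y p q → x p q +ₖ y p q
      ; _*ₗ_ = λ a x p q → a *ₖ x p q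
      ; 0ᴹ = λ _ _ → 0#
      ; -ᴹ_ = λ x p q → -ₖ x p q
      ; isLeftModule = record
        { isLeftSemimodule = record
          { +ᴹ-isCommutativeMonoid = record
            { isMonoid = record
              { isSemigroup = record
                { isMagma = record
                  { isEquivalence = record
                    { refl = λ _ _ → 𝕂.refl
                    ; sym = λ h p q → 𝕂.sym (h p q)
                    ; trans = λ h k p q → 𝕂.trans (h p q) (k p q)
                    }
                  ; ∙-cong = λ h k p q → 𝕂.+-cong (h p q) (k p q)
                  }
                ; assoc = λ x y z p q → 𝕂.+-assoc _ _ _
                }
              ; identity = (λ x p q → 𝕂.+-identityˡ _) , (λ x p q → 𝕂.+-identityʳ _)
              }
            ; comm = λ x y p q → 𝕂.+-comm _ _
            }
          ; isPreleftSemimodule = record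
            { *ₗ-cong = λ h k p q → 𝕂.*-cong h (k p q)
            ; *ₗ-zeroˡ = λ x p q → 𝕂.zeroˡ _
            ; *ₗ-distribʳ = λ x a b p q → 𝕂.distribʳ _ a b
            ; *ₗ-identityˡ = λ x p q → 𝕂.*-identityˡ _
            ; *ₗ-assoc = λ a b x p q → 𝕂.*-assoc a b _
            ; *ₗ-zeroʳ = λ a p q → 𝕂.zeroʳ a
            ; *ₗ-distribˡ = λ a x y p q → 𝕂.distribˡ a _ _
            }
          }
        ; -ᴹ‿cong = λ h p q → 𝕂.-‿cong (h p q)
        ; -ᴹ‿inverse = (λ x p q → 𝕂.-‿inverseˡ _) , (λ x p q → 𝕂.-‿inverseʳ _)
        }
      }
    ; act = λ σ x p ∣W∣≡2 → x p (trans (≃-size σ) ∣W∣≡2)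
    ; act-linear = λ σ → record
      { +ᴹ-isGroupHomomorphism = record
        { isMonoidHomomorphism = record
          { isMagmaHomomorphism = record
            { isRelHomomorphism = record { cong = λ h p q → h p _ }
            ; homo = λ _ _ _ _ → 𝕂.refl
            }
          ; ε-homo = λ _ _ → 𝕂.refl
          }
        ; ⁻¹-homo = λ _ _ _ → 𝕂.refl
        }
      ; *ₗ-homo = λ _ _ _ _ → 𝕂.refl
      }
    ; act-ext = λ σ τ σ≡τ x p q → 𝕂.reflexive (cong (x p) (ℕ.≡-irrelevant _ _))
    ; act-id = λ x p q → 𝕂.reflexive (cong (x p) (ℕ.≡-irrelevant _ _))
    ; act-∘ = λ τ σ x p q → 𝕂.reflexive (cong (x p) (ℕ.≡-irrelevant _ _))
    }

  private module 𝒢 = Species 𝒢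

  generator : Generator → ∣ 𝒢.obj (fin 2) ∣
  generator mu  mu  _ = 1#
  generator mu  seg _ = 0#
  generator seg mu  _ = 0#
  generator seg seg _ = 1#

  cogenerator : Generator → ∣ Species.obj (𝒢 ∨) (fin 2) ∣
  cogenerator p = record
    { ⟦_⟧ = λ x → x p refl
    ; isLinear = linear {M = 𝒢.obj (fin 2)} {N = scalars}
        (λ h → h p refl) (λ _ _ → 𝕂.refl) (λ _ _ → 𝕂.refl)
    }

  record AntisymmetricGenerators (S : Species m e) (x y : ∣ Species.obj S (fin 2) ∣) : Set (c ⊔ ℓ ⊔ m ⊔ e) where
    open Species S using (obj; act)
    open LeftModule (obj (fin 2)) using (_≈ᴹ_; _+ᴹ_; _*ₗ_; -ᴹ_)
    field
      antisymmetric₁ : act swap₂ x ≈ᴹ -ᴹ x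
      antisymmetric₂ : act swap₂ y ≈ᴹ -ᴹ y
      spanning       : ∀ w → ∃ λ a → ∃ λ b → w ≈ᴹ (a *ₗ x) +ᴹ (b *ₗ y)
      independent    : ∀ {a b a′ b′} → (a *ₗ x) +ᴹ (b *ₗ y) ≈ᴹ (a′ *ₗ x) +ᴹ (b′ *ₗ y) →
                       a ≈ₖ a′ × b ≈ₖ b′

  infixl 6 _⊖_
  _⊖_ : {A : Set m} → Combination A → Combination A → Combination A
  x ⊖ y = x ⊕ (-ₖ 1#) ⊙ y

  private
    𝑎 𝑏 𝑐 : Fin 3
    𝑎 = 0F
    𝑏 = 1F
    𝑐 = 2F

    μ σ : ∣ 𝒢.obj (fin 2) ∣
    μ = generator mu
    σ = generator seg

    μ∨ s∨ : ∣ Species.obj (𝒢 ∨) (fin 2) ∣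
    μ∨ = cogenerator mu
    s∨ = cogenerator seg

    ⌈_⌉ : (g : Grafting 𝒢 (Fin 3)) {_ : OnceEach 𝒢 g} → Element 𝒢 (fin 3)
    ⌈ g ⌉ {once} = treeElement 𝒢 g once

    ⌈_⌉∨ : (g : Grafting (𝒢 ∨) (Fin 3)) {_ : OnceEach (𝒢 ∨) g} → Element (𝒢 ∨) (fin 3)
    ⌈ g ⌉∨ {once} = treeElement (𝒢 ∨) g once

  data SP-Relator : Family (Operad.species (Free 𝒢)) 0ℓ where
    associativity : SP-Relator (fin 3)
      (⌈ μ ⟨ 𝑐 , μ ⟨ 𝑎 , 𝑏 ⟩⟩ ⌉ ⊖ ⌈ μ ⟨ 𝑎 , μ ⟨ 𝑏 , 𝑐 ⟩⟩ ⌉)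
    derivation    : SP-Relator (fin 3)
      (⌈ σ ⟨ 𝑎 , μ ⟨ 𝑏 , 𝑐 ⟩⟩ ⌉ ⊖ ⌈ μ ⟨ 𝑐 , σ ⟨ 𝑎 , 𝑏 ⟩⟩ ⌉ ⊖ ⌈ μ ⟨ 𝑏 , σ ⟨ 𝑎 , 𝑐 ⟩⟩ ⌉)

  SP : BinaryQuadratic c ℓ 0ℓ
  SP = record
    { generators = 𝒢
    ; binary     = λ V ∣V∣≢2 x p ∣V∣≡2 → contradiction ∣V∣≡2 ∣V∣≢2
    ; relators   = SP-Relator
    ; quadratic  = λ
      { associativity → add (incl (two refl)) (scale _ (incl (two refl)))
      ; derivation    → add (add (incl (two refl)) (scale _ (incl (two refl)))) (scale _ (incl (two refl)))
      }
    }

  data SP!-Relator : Family (Operad.species (Free (𝒢 ∨))) 0ℓ where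
    nilpotency : SP!-Relator (fin 3)
      ⌈ s∨ ⟨ 𝑎 , s∨ ⟨ 𝑏 , 𝑐 ⟩⟩ ⌉∨
    mixed      : SP!-Relator (fin 3)
      (⌈ μ∨ ⟨ 𝑎 , s∨ ⟨ 𝑏 , 𝑐 ⟩⟩ ⌉∨ ⊕ ⌈ s∨ ⟨ 𝑐 , μ∨ ⟨ 𝑎 , 𝑏 ⟩⟩ ⌉∨ ⊕ ⌈ s∨ ⟨ 𝑏 , μ∨ ⟨ 𝑐 , 𝑎 ⟩⟩ ⌉∨)
    jacobi     : SP!-Relator (fin 3)
      (⌈ μ∨ ⟨ 𝑎 , μ∨ ⟨ 𝑏 , 𝑐 ⟩⟩ ⌉∨ ⊕ ⌈ μ∨ ⟨ 𝑐 , μ∨ ⟨ 𝑎 , 𝑏 ⟩⟩ ⌉∨ ⊕ ⌈ μ∨ ⟨ 𝑏 , μ∨ ⟨ 𝑐 , 𝑎 ⟩⟩ ⌉∨)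

  SP!-presentation : BinaryQuadratic (c ⊔ ℓ) (c ⊔ ℓ) 0ℓ
  SP!-presentation = record
    { generators = 𝒢 ∨
    ; binary     = ∨-concentrated 𝒢 (BinaryQuadratic.binary SP)
    ; relators   = SP!-Relator
    ; quadratic  = λ
      { nilpotency → incl (two refl)
      ; mixed      → add (add (incl (two refl)) (incl (two refl))) (incl (two refl))
      ; jacobi     → add (add (incl (two refl)) (incl (two refl))) (incl (two refl))
      }
    }

{-# OPTIONS --safe #-}
-- The isomorphism is induced by the identity, so it suffices that R⊥ and R′ generate the same ideal.
-- Two-node trees exist only on sets with three elements.  On {a, b, c} the twelve trees p(x, q(y, z)),
-- with (x, y, z) a rotation of (a, b, c), form bases of Free⁽²⁾ for G and for G∨, dual to each other
-- under the pairing.  Writing c(x, p, q) for the coordinates of an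
-- element of the dual, orthogonality to R says that c(x, μ, μ) does not depend on x and that
-- c(x, s, μ) = c(y, μ, s) + c(z, μ, s), while c(x, s, s) and c(x, μ, s) are free.  The elements with
-- these coordinates are exactly the combinations of the Jacobi relator, of the three rotations of the
-- mixed relator and of the three rotations of the nilpotency relator.
module Submission where

open import Defs
open import Level using (Level; _⊔_)
import Algebra.Properties.AbelianGroup as AbelianGroupProperties
import Algebra.Solver.CommutativeMonoid as CommutativeMonoidSolver
import Algebra.Properties.Ring as RingProperties
import Algebra.Properties.CommutativeSemigroup as CommutativeSemigroupProperties
open import Algebra.Module.Bundles using (LeftModule)
open import Data.Bool.Base using (Bool; true; false; if_then_else_; _∧_)
open import Data.Fin.Base using (Fin)
open import Data.Fin.Patterns using (0F; 1F; 2F)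
import Data.Bool.Properties as Bool
import Data.Fin.Properties as Fin
open import Data.List.Base using ([]; _∷_)
open import Data.Maybe.Base as Maybe using (Maybe; just; nothing; maybe′)
open import Data.Nat.Base as ℕ using (ℕ)
import Data.Nat.Properties as ℕ
open import Data.Product using (_×_; _,_; ∃; proj₁; proj₂)
open import Data.Sign.Base as Sign using (Sign)
open import Data.Sum.Base using (_⊎_; inj₁; inj₂)
open import Data.Unit.Base using (tt)
open import Function.Base using (id; _∘_; case_of_)
open import Function.Bundles using (_↔_; Injection; mk↔ₛ′; mk⇔)
open import Function.Properties.Inverse using (↔⇒↣)
open import Relation.Binary.Definitions using (DecidableEquality)
open import Relation.Binary.PropositionalEquality
  using (_≡_; _≢_; refl; sym; trans; cong; cong₂; subst)
open import Relation.Nullary using (¬_; yes; no; does; contradiction)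
open import Relation.Nullary.Decidable using (toWitness; dec-true; does-⇔; ¬?; _⊎-dec_; _×-dec_; _→-dec_)

open FinSet using (Carrier; index)

-- The combination of relators needs no comparison of dimensions: its scalars can be read off. The
-- i-th rotation of the mixed relator is the only one to contain the tree μ(i, s), the Jacobi
-- relator contains every μ, μ tree once, and a rotation of the nilpotency relator is a single tree.
-- So c(x, μ, s), c(a, μ, μ) and c(x, s, s) are themselves the coefficients, and the two equations
-- say that all other coordinates agree. Two obstacles shape the rest. Species live on all finite
-- sets and a span may pass through other label sets, so claims about {a, b, c} are proved for every
-- V together with every bijection to {a, b, c}, and the pairing must be equivariant up to
-- signature. And the free operad is made of planar drawings, so the pairing must not depend on
-- them: redrawing the inner node of a dual tree flips the orientation of its leaves, a sign that
-- cancels against the twist of the dual action.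

Three : FinSet
Three = fin 3

-- Rotations, labellings and orientations of three leaves.

next : Fin 3 → Fin 3
next 0F = 1F
next 1F = 2F
next 2F = 0F

-- Settled by deciding all 27 triples. Up to exchanging the two inner leaves, it leaves only three
-- trees for each pair of decorations.
distinct-rotation : ∀ x y z → x ≢ y → x ≢ z → y ≢ z →
  (y ≡ next x × z ≡ next (next x)) ⊎ (z ≡ next x × y ≡ next (next x))
distinct-rotation = toWitness {a? = Fin.all? λ x → Fin.all? λ y → Fin.all? λ z →
  ¬? (x Fin.≟ y) →-dec ¬? (x Fin.≟ z) →-dec ¬? (y Fin.≟ z) →-dec
  (((y Fin.≟ next x) ×-dec (z Fin.≟ next (next x))) ⊎-dec
   ((z Fin.≟ next x) ×-dec (y Fin.≟ next (next x))))} tt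

permutation-rotation : ∀ (τ : Three ≃ Three) →
  (to τ 1F ≡ next (to τ 0F) × to τ 2F ≡ next (next (to τ 0F))) ⊎
  (to τ 2F ≡ next (to τ 0F) × to τ 1F ≡ next (next (to τ 0F)))
permutation-rotation τ = distinct-rotation (to τ 0F) (to τ 1F) (to τ 2F)
  (λ eq → case to-injective τ eq of λ ()) (λ eq → case to-injective τ eq of λ ())
  (λ eq → case to-injective τ eq of λ ())

module _ {A : Set} (_≟_ : DecidableEquality A) where

  indicator : A → A → ℕ
  indicator x v = if does (x ≟ v) then 1 else 0

  -- A count of exactly one excludes both a missing label (count 0) and a coincidence (count at
  -- least 2). The sum is bracketed as `occurrences` computes it on p(x, q(y, z)).
  once⇒bijection : ∀ x y z → (∀ v → indicator x v ℕ.+ (indicator y v ℕ.+ indicator z v) ≡ 1) →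
                   Fin 3 ↔ A
  once⇒bijection x y z once = mk↔ₛ′ label position label-position position-label
    where
    label : Fin 3 → A
    label 0F = x
    label 1F = y
    label 2F = z

    position : A → Fin 3
    -- The last branch tests nothing: a `v` other than `x` and `y` has to be `z`, its count being
    -- one.
    position v = if does (x ≟ v) then 0F else if does (y ≟ v) then 1F else 2F

    label-position : ∀ v → label (position v) ≡ v
    label-position v with x ≟ v | y ≟ v | z ≟ v | once v
    ... | yes x≡v | _       | _       | _ = x≡v
    ... | no _    | yes y≡v | _       | _ = y≡v
    ... | no _    | no _    | yes z≡v | _ = z≡v

    position-label : ∀ i → position (label i) ≡ i
    position-label 0F rewrite dec-true (x ≟ x) refl = refl
    position-label 1F with x ≟ y | once y
    ... | no _ | _ rewrite dec-true (y ≟ y) refl = refl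
    ... | yes _ | eq rewrite dec-true (y ≟ y) refl with () ← eq
    position-label 2F with x ≟ z | y ≟ z | once z
    ... | no _  | no _  | _ = refl
    ... | no _  | yes _ | eq rewrite dec-true (z ≟ z) refl with () ← eq
    ... | yes _ | no _  | eq rewrite dec-true (z ≟ z) refl with () ← eq
    ... | yes _ | yes _ | ()

labelling : ∀ V x y z →
  (∀ v → indicator (FinSet._≟_ V) x v ℕ.+ (indicator (FinSet._≟_ V) y v ℕ.+ indicator (FinSet._≟_ V) z v) ≡ 1) →
  Three ≃ V
labelling V x y z once = ⟪ once⇒bijection (FinSet._≟_ V) x y z once ⟫

module _ {A : Set} (_≟_ : DecidableEquality A) where

  -- These are the two tests that `pairGraftings` tries in turn. For distinct inner leaves they
  -- exclude each other, so the order of the tests does not affect the pairing.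
  both-matches : ∀ x y z x′ y′ z′ →
    does (x ≟ x′) ∧ does (y ≟ y′) ∧ does (z ≟ z′) ≡ true →
    does (x ≟ x′) ∧ does (y ≟ z′) ∧ does (z ≟ y′) ≡ true → y ≡ z × y′ ≡ z′
  both-matches x y z x′ y′ z′ p q with x ≟ x′ | y ≟ y′ | z ≟ z′ | y ≟ z′ | z ≟ y′
  ... | yes _ | yes refl | yes refl | yes refl | yes _ = refl , refl
  both-matches _ _ _ _ _ _ () q | no _  | _     | _     | _     | _
  both-matches _ _ _ _ _ _ () q | yes _ | no _  | _     | _     | _
  both-matches _ _ _ _ _ _ () q | yes _ | yes _ | no _  | _     | _
  both-matches _ _ _ _ _ _ p () | yes _ | yes _ | yes _ | no _  | _
  both-matches _ _ _ _ _ _ p () | yes _ | yes _ | yes _ | yes _ | no _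

  swap-matches : ∀ x y z x′ y′ z′ →
    does (x ≟ x′) ∧ does (z ≟ y′) ∧ does (y ≟ z′) ≡ does (x ≟ x′) ∧ does (y ≟ z′) ∧ does (z ≟ y′)
  swap-matches x y z x′ y′ z′ = cong (does (x ≟ x′) ∧_) (Bool.∧-comm (does (z ≟ y′)) (does (y ≟ z′)))

-- Of the three comparisons only that of `y` with `z` changes sign; the other two trade places.
-- Equal leaves would break this, as `compareSign` of equal indices is minus both ways.
orientation-swap : ∀ V {x y z} → y ≢ z →
  orientation V (x ∷ z ∷ y ∷ []) ≡ Sign.opposite (orientation V (x ∷ y ∷ z ∷ []))
orientation-swap V {x} {y} {z} y≢z
  rewrite compareSign-flip {i = index V z} {index V y}
    (λ eq → y≢z (sym (Injection.injective (↔⇒↣ (FinSet.enum V)) eq))) =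
  signs (compareSign (index V x) (index V y)) (compareSign (index V x) (index V z)) (compareSign (index V y) (index V z))
  where
  signs : ∀ a b c → (b Sign.* (a Sign.* Sign.+)) Sign.* ((Sign.opposite c Sign.* Sign.+) Sign.* Sign.+)
                    ≡ Sign.opposite ((a Sign.* (b Sign.* Sign.+)) Sign.* ((c Sign.* Sign.+) Sign.* Sign.+))
  signs Sign.+ Sign.+ Sign.+ = refl
  signs Sign.+ Sign.+ Sign.- = refl
  signs Sign.+ Sign.- Sign.+ = refl
  signs Sign.+ Sign.- Sign.- = refl
  signs Sign.- Sign.+ Sign.+ = refl
  signs Sign.- Sign.+ Sign.- = refl
  signs Sign.- Sign.- Sign.+ = refl
  signs Sign.- Sign.- Sign.- = refl

module _ {c ℓ : Level} (K : Field c ℓ) where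

  open Field K using (ring; 0#; 1#) renaming (Carrier to 𝕂; _≈_ to _≈ₖ_; _+_ to _+ₖ_; _*_ to _*ₖ_; -_ to -ₖ_)
  private module 𝕂 = Field K

  -- Linear algebra: subspaces and linear maps.

  module _ {m e : Level} (M : LeftModule ring m e) where
    open LeftModule M
    open CommutativeMonoidSolver +ᴹ-commutativeMonoid using (solve; _⊜_) renaming (_⊕_ to _:+_)
    open import Relation.Binary.Reasoning.Setoid ≈ᴹ-setoid

    -- Read xᵢ as the tree μ(i, s) and yᵢ as s(i, μ). The left side is the mixed part of an element
    -- satisfying the equations of R⊥, the right side a combination of the three rotations of the
    -- mixed relator.
    regroup : ∀ a b c x₀ x₁ x₂ y₀ y₁ y₂ →
      ((a *ₗ x₀ +ᴹ b *ₗ x₁) +ᴹ c *ₗ x₂) +ᴹ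
        (((b +ₖ c) *ₗ y₀ +ᴹ (c +ₖ a) *ₗ y₁) +ᴹ (a +ₖ b) *ₗ y₂)
      ≈ᴹ (a *ₗ ((x₀ +ᴹ y₂) +ᴹ y₁) +ᴹ b *ₗ ((x₁ +ᴹ y₀) +ᴹ y₂)) +ᴹ c *ₗ ((x₂ +ᴹ y₁) +ᴹ y₀)
    regroup a b c x₀ x₁ x₂ y₀ y₁ y₂ = begin
      ((a *ₗ x₀ +ᴹ b *ₗ x₁) +ᴹ c *ₗ x₂) +ᴹ (((b +ₖ c) *ₗ y₀ +ᴹ (c +ₖ a) *ₗ y₁) +ᴹ (a +ₖ b) *ₗ y₂)
        ≈⟨ +ᴹ-congˡ (+ᴹ-cong (+ᴹ-cong (*ₗ-distribʳ y₀ b c) (*ₗ-distribʳ y₁ c a)) (*ₗ-distribʳ y₂ a b)) ⟩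
      ((a *ₗ x₀ +ᴹ b *ₗ x₁) +ᴹ c *ₗ x₂) +ᴹ
        (((b *ₗ y₀ +ᴹ c *ₗ y₀) +ᴹ (c *ₗ y₁ +ᴹ a *ₗ y₁)) +ᴹ (a *ₗ y₂ +ᴹ b *ₗ y₂))
        ≈⟨ solve 9 (λ ax bx cx by₀ cy₀ cy₁ ay₁ ay₂ by₂ →
             (((ax :+ bx) :+ cx) :+ (((by₀ :+ cy₀) :+ (cy₁ :+ ay₁)) :+ (ay₂ :+ by₂)))
             ⊜ ((((ax :+ ay₂) :+ ay₁) :+ ((bx :+ by₀) :+ by₂)) :+ ((cx :+ cy₁) :+ cy₀))) ≈ᴹ-refl
             (a *ₗ x₀) (b *ₗ x₁) (c *ₗ x₂) (b *ₗ y₀) (c *ₗ y₀) (c *ₗ y₁) (a *ₗ y₁) (a *ₗ y₂) (b *ₗ y₂) ⟩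
      (((a *ₗ x₀ +ᴹ a *ₗ y₂) +ᴹ a *ₗ y₁) +ᴹ ((b *ₗ x₁ +ᴹ b *ₗ y₀) +ᴹ b *ₗ y₂)) +ᴹ ((c *ₗ x₂ +ᴹ c *ₗ y₁) +ᴹ c *ₗ y₀)
        ≈⟨ +ᴹ-cong (+ᴹ-cong (distrib a x₀ y₂ y₁) (distrib b x₁ y₀ y₂)) (distrib c x₂ y₁ y₀) ⟨
      (a *ₗ ((x₀ +ᴹ y₂) +ᴹ y₁) +ᴹ b *ₗ ((x₁ +ᴹ y₀) +ᴹ y₂)) +ᴹ c *ₗ ((x₂ +ᴹ y₁) +ᴹ y₀) ∎
      where
      distrib : ∀ d x y z → d *ₗ ((x +ᴹ y) +ᴹ z) ≈ᴹ (d *ₗ x +ᴹ d *ₗ y) +ᴹ d *ₗ z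
      distrib d x y z = ≈ᴹ-trans (*ₗ-distribˡ d _ z) (+ᴹ-congʳ (*ₗ-distribˡ d x y))

  record IsSubspace {m e r : Level} (M : LeftModule ring m e) (Q : LeftModule.Carrierᴹ M → Set r) :
                    Set (c ⊔ m ⊔ e ⊔ r) where
    open LeftModule M
    field
      Q-resp  : ∀ {x y} → x ≈ᴹ y → Q x → Q y
      Q-zero  : Q 0ᴹ
      Q-add   : ∀ {x y} → Q x → Q y → Q (x +ᴹ y)
      Q-scale : ∀ {x} a → Q x → Q (a *ₗ x)

  module _ {m e m′ e′ : Level} {M : LeftModule ring m e} {N : LeftModule ring m′ e′} where
    private
      module M = LeftModule M
      module N = LeftModule N

    zero-linear : IsLinear K M N (λ _ → N.0ᴹ)
    zero-linear = linear K {M = M} {N = N} (λ _ → N.≈ᴹ-refl)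
      (λ _ _ → N.≈ᴹ-sym (N.+ᴹ-identityˡ N.0ᴹ)) (λ a _ → N.≈ᴹ-sym (N.*ₗ-zeroʳ a))

    sum-linear : ∀ {f g} → IsLinear K M N f → IsLinear K M N g → IsLinear K M N (λ x → f x N.+ᴹ g x)
    sum-linear f-linear g-linear = linear K {M = M} {N = N}
      (λ p → N.+ᴹ-cong (f.⟦⟧-cong p) (g.⟦⟧-cong p))
      (λ x y → N.≈ᴹ-trans (N.+ᴹ-cong (f.+ᴹ-homo x y) (g.+ᴹ-homo x y)) (+ᴹ-interchange K {M = N} _ _ _ _))
      (λ a x → N.≈ᴹ-trans (N.+ᴹ-cong (f.*ₗ-homo a x) (g.*ₗ-homo a x)) (N.≈ᴹ-sym (N.*ₗ-distribˡ a _ _)))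
      where
      module f = Linear K {M = M} {N = N} f-linear
      module g = Linear K {M = M} {N = N} g-linear

    multiple-linear : ∀ {f} → IsLinear K M (scalars K) f → ∀ n → IsLinear K M N (λ x → f x N.*ₗ n)
    multiple-linear f-linear n = linear K {M = M} {N = N}
      (λ p → N.*ₗ-congʳ (f.⟦⟧-cong p))
      (λ x y → N.≈ᴹ-trans (N.*ₗ-congʳ (f.+ᴹ-homo x y)) (N.*ₗ-distribʳ n _ _))
      (λ a x → N.≈ᴹ-trans (N.*ₗ-congʳ (f.*ₗ-homo a x)) (N.*ₗ-assoc a _ n))
      where module f = Linear K {M = M} {N = scalars K} f-linear

    -- Serves twice: against the zero map it gives the kernel of the pairing with a fixed element,
    -- against the identity the elements fixed by `reconstruction`.
    equalizer-subspace : ∀ {f g} → IsLinear K M N f → IsLinear K M N g → IsSubspace M (λ x → f x N.≈ᴹ g x)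
    equalizer-subspace f-linear g-linear = record
      { Q-resp = λ p fx≈gx → N.≈ᴹ-trans (N.≈ᴹ-sym (f.⟦⟧-cong p)) (N.≈ᴹ-trans fx≈gx (g.⟦⟧-cong p))
      ; Q-zero = N.≈ᴹ-trans f.0ᴹ-homo (N.≈ᴹ-sym g.0ᴹ-homo)
      ; Q-add = λ p q → N.≈ᴹ-trans (f.+ᴹ-homo _ _) (N.≈ᴹ-trans (N.+ᴹ-cong p q) (N.≈ᴹ-sym (g.+ᴹ-homo _ _)))
      ; Q-scale = λ a p → N.≈ᴹ-trans (f.*ₗ-homo a _) (N.≈ᴹ-trans (N.*ₗ-congˡ p) (N.≈ᴹ-sym (g.*ₗ-homo a _)))
      }
      where
      module f = Linear K {M = M} {N = N} f-linear
      module g = Linear K {M = M} {N = N} g-linear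

  identity-linear : ∀ {m e} (M : LeftModule ring m e) → IsLinear K M M id
  identity-linear M = linear K {M = M} {N = M} id (λ _ _ → ≈ᴹ-refl) (λ _ _ → ≈ᴹ-refl)
    where open LeftModule M

  -- Spans and ideals.

  module _ {m e : Level} (S : Species K m e) where
    open Species S

    act-inverseʳ : ∀ {V W} (σ : V ≃ W) x → LeftModule._≈ᴹ_ (obj W) (act σ (act (σ ⁻¹≃) x)) x
    act-inverseʳ {V} {W} σ x = ≈ᴹ-trans (≈ᴹ-sym (act-∘ σ (σ ⁻¹≃) x))
      (≈ᴹ-trans (act-ext (σ ∘≃ (σ ⁻¹≃)) id≃ (_≃_.strictlyInverseˡ σ) x) (act-id x))
      where open LeftModule (obj W)

  module _ {m e r r′ : Level} (P : Operad K m e) {R : Family K (Operad.species P) r}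
           {R′ : Family K (Operad.species P) r′} where

    span⊆ideal : (∀ {V x} → R V x → Ideal K P R′ V x) → ∀ {V x} → Span K (Operad.species P) R V x → Ideal K P R′ V x
    span⊆ideal R⊆I (incl p)      = R⊆I p
    span⊆ideal R⊆I (resp p s)    = resp p (span⊆ideal R⊆I s)
    span⊆ideal R⊆I zero          = zero
    span⊆ideal R⊆I (add s t)     = add (span⊆ideal R⊆I s) (span⊆ideal R⊆I t)
    span⊆ideal R⊆I (scale a s)   = scale a (span⊆ideal R⊆I s)
    span⊆ideal R⊆I (relabel σ s) = relabel σ (span⊆ideal R⊆I s)

    ideal⊆ideal : (∀ {V x} → R V x → Ideal K P R′ V x) → ∀ {V x} → Ideal K P R V x → Ideal K P R′ V x
    ideal⊆ideal R⊆I (incl p)      = R⊆I p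
    ideal⊆ideal R⊆I (resp p s)    = resp p (ideal⊆ideal R⊆I s)
    ideal⊆ideal R⊆I zero          = zero
    ideal⊆ideal R⊆I (add s t)     = add (ideal⊆ideal R⊆I s) (ideal⊆ideal R⊆I t)
    ideal⊆ideal R⊆I (scale a s)   = scale a (ideal⊆ideal R⊆I s)
    ideal⊆ideal R⊆I (relabel σ s) = relabel σ (ideal⊆ideal R⊆I s)
    ideal⊆ideal R⊆I (compˡ y s)   = compˡ y (ideal⊆ideal R⊆I s)
    ideal⊆ideal R⊆I (compʳ x s)   = compʳ x (ideal⊆ideal R⊆I s)

  open BinaryQuadratic

  relatorIdeal : ∀ {m e r} (P : BinaryQuadratic K m e r) → Family K (Operad.species (Free K (generators P))) _
  relatorIdeal P = Ideal K (Free K (generators P)) (relations P)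

  -- The generators are compared by an equation between abstract species, so that the inductions on
  -- spans and ideals never meet the concrete ones.
  relatorIdeal-mono : ∀ {m e r r′} (P : BinaryQuadratic K m e r) (Q : BinaryQuadratic K m e r′)
    (eq : generators P ≡ generators Q) →
    (∀ {V f} → relators P V f → relatorIdeal Q V (subst (λ S → Element K S V) eq f)) →
    ∀ {V f} → relatorIdeal P V f → relatorIdeal Q V (subst (λ S → Element K S V) eq f)
  -- Splitting `Q` turns its generators into a variable, which `refl` can then identify with those
  -- of `P`.
  relatorIdeal-mono P Q@record { generators = _ } refl P⊆Q =
    ideal⊆ideal (Free K (generators P)) {relations P} {relations Q}
      (span⊆ideal (Free K (generators P)) {relators P} {relations Q} P⊆Q)

  module _ {m e r q : Level} (S : Species K m e) {G : Family K S r} {W : FinSet} where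
    open Species S
    private module M V = LeftModule (obj V)

    -- A derivation of an element on `W` may pass through other label sets, where `Q` makes no
    -- sense. Quantifying over all bijections to `W` gives an induction hypothesis that absorbs each
    -- relabelling by composition.
    span-relabel : {Q : M.Carrierᴹ W → Set q} → IsSubspace (obj W) Q →
      (∀ {V x} → G V x → (σ : V ≃ W) → Q (act σ x)) →
      ∀ {V x} → Span K S G V x → (σ : V ≃ W) → Q (act σ x)
    span-relabel {Q} Q-subspace G⊆Q = go
      where
      open IsSubspace Q-subspace
      module act {V} (σ : V ≃ W) = Linear K {M = obj V} {N = obj W} (act-linear σ)

      go : ∀ {V x} → Span K S G V x → (σ : V ≃ W) → Q (act σ x)
      go (incl g) σ      = G⊆Q g σ
      go (resp p s) σ    = Q-resp (act-cong σ p) (go s σ)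
      go zero σ          = Q-resp (M.≈ᴹ-sym W (act.0ᴹ-homo σ)) Q-zero
      go (add s t) σ     = Q-resp (M.≈ᴹ-sym W (act.+ᴹ-homo σ _ _)) (Q-add (go s σ) (go t σ))
      go (scale a s) σ   = Q-resp (M.≈ᴹ-sym W (act.*ₗ-homo σ a _)) (Q-scale a (go s σ))
      go (relabel τ s) σ = Q-resp (act-∘ σ τ _) (go s (σ ∘≃ τ))

  module _ {m e m′ e′ : Level} (S : Species K m e) (M : LeftModule ring m′ e′) where
    open FreeOperad K S hiding (Element; Free; Free²; two)
    open LeftModule M

    compatible-resp : ∀ {V} {f g : TreeOn K Decoration V → Carrierᴹ} → (∀ t → f t ≈ᴹ g t) →
                      Compatible M g → Compatible M f
    compatible-resp f≈g g-compatible = record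
      { f-same = λ p → ≈ᴹ-trans (f≈g _) (≈ᴹ-trans (f-same p) (≈ᴹ-sym (f≈g _)))
      ; f-sum = λ p → ≈ᴹ-trans (f≈g _) (≈ᴹ-trans (f-sum p) (≈ᴹ-sym (+ᴹ-cong (f≈g _) (f≈g _))))
      ; f-multiple = λ p → ≈ᴹ-trans (f≈g _) (≈ᴹ-trans (f-multiple p) (≈ᴹ-sym (*ₗ-congˡ (f≈g _))))
      }
      where open Compatible g-compatible

  -- Two-node trees and functions of their decorations

  module Graftings {m e : Level} (S : Species K m e) where
    open FreeOperad K S hiding (Element; Free; Free²; two)
    open Species S

    private module D = LeftModule (obj (fin 2))

    swap-swap : ∀ d → act swap₂ (act swap₂ d) D.≈ᴹ d
    swap-swap d = D.≈ᴹ-trans (D.≈ᴹ-sym (act-∘ swap₂ swap₂ d))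
      (D.≈ᴹ-trans (act-ext (swap₂ ∘≃ swap₂) id≃ (λ { 0F → refl ; 1F → refl }) d) (act-id d))

    GraftingOn : FinSet → Set m
    GraftingOn V = Grafting K S (Carrier V)

    graftingOf : ∀ {A : Set} → Tree K Decoration A → Maybe (Grafting K S A)
    graftingOf = grafting K S

    -- What a function of p(x, q(y, z)) must satisfy to descend, extended by zero to all other
    -- trees, to the free operad. Redrawing the outer node is absorbed by `grafting`, which moves
    -- the lone leaf to the first input.
    record Multilinear {A : Set} (F : Grafting K S A → 𝕂) : Set (c ⊔ ℓ ⊔ m ⊔ e) where
      field
        F-cong : ∀ {p p′ q q′ x y z} → p D.≈ᴹ p′ → q D.≈ᴹ q′ →
                 F (p ⟨ x , q ⟨ y , z ⟩⟩) ≈ₖ F (p′ ⟨ x , q′ ⟨ y , z ⟩⟩)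
        -- Leaves of a `TreeOn` are distinct; for equal inner leaves the orientation in the pairing
        -- would not change sign.
        F-swap : ∀ {p q x y z} → y ≢ z →
                 F (p ⟨ x , q ⟨ y , z ⟩⟩) ≈ₖ F (p ⟨ x , act swap₂ q ⟨ z , y ⟩⟩)
        F-+ˡ   : ∀ {p p′ q x y z} →
                 F ((p D.+ᴹ p′) ⟨ x , q ⟨ y , z ⟩⟩) ≈ₖ F (p ⟨ x , q ⟨ y , z ⟩⟩) +ₖ F (p′ ⟨ x , q ⟨ y , z ⟩⟩)
        F-+ʳ   : ∀ {p q q′ x y z} →
                 F (p ⟨ x , (q D.+ᴹ q′) ⟨ y , z ⟩⟩) ≈ₖ F (p ⟨ x , q ⟨ y , z ⟩⟩) +ₖ F (p ⟨ x , q′ ⟨ y , z ⟩⟩)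
        F-*ˡ   : ∀ {a p q x y z} → F ((a D.*ₗ p) ⟨ x , q ⟨ y , z ⟩⟩) ≈ₖ a *ₖ F (p ⟨ x , q ⟨ y , z ⟩⟩)
        F-*ʳ   : ∀ {a p q x y z} → F (p ⟨ x , (a D.*ₗ q) ⟨ y , z ⟩⟩) ≈ₖ a *ₖ F (p ⟨ x , q ⟨ y , z ⟩⟩)

    zero-multilinear : {A : Set} → Multilinear {A} (λ _ → 0#)
    zero-multilinear = record
      { F-cong = λ _ _ → 𝕂.refl
      ; F-swap = λ _ → 𝕂.refl
      ; F-+ˡ = 𝕂.sym (𝕂.+-identityˡ 0#)
      ; F-+ʳ = 𝕂.sym (𝕂.+-identityˡ 0#)
      ; F-*ˡ = 𝕂.sym (𝕂.zeroʳ _)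
      ; F-*ʳ = 𝕂.sym (𝕂.zeroʳ _)
      }

    module _ {V : FinSet} {F : GraftingOn V → 𝕂} (multilinear : Multilinear F) where
      open Multilinear multilinear
      private
        T : Set m
        T = Tree K Decoration (Carrier V)

        onTree : T → 𝕂
        onTree t = maybe′ F 0# (graftingOf t)

        Once : T → Set
        Once t = ∀ v → occurrences K V t v ≡ 1

        module act = Linear K {M = obj (fin 2)} {N = obj (fin 2)} (act-linear swap₂)

        inner-distinctˡ : ∀ {p q x y z} → Once (node p (leaf x) (node q (leaf y) (leaf z))) → y ≢ z
        inner-distinctˡ {x = x} {y} {z} once y≡z with () ←
          to-injective (labelling V x y z once) {1F} {2F} y≡z

        inner-distinctʳ : ∀ {p q x y z} → Once (node p (node q (leaf y) (leaf z)) (leaf x)) → y ≢ z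
        inner-distinctʳ {x = x} {y} {z} once y≡z with () ←
          to-injective (labelling V x y z
            (λ v → trans (ℕ.+-comm (indicator (FinSet._≟_ V) x v) _) (once v))) {1F} {2F} y≡z

        -- Most clauses only refine the trees until `grafting` computes to `nothing` on both sides.
        -- On two-node trees there remain congruence in the decorations, a swap at the inner node
        -- (`F-swap`), and a swap at the root, where the redrawing done by `grafting` costs at most
        -- a double swap of the decoration.
        onTree-~ : ∀ {t u} → Once t → t ~ u → onTree t ≈ₖ onTree u
        onTree-~ o (leaf a) = 𝕂.refl
        onTree-~ o (node d (leaf x) (leaf y)) = 𝕂.refl
        onTree-~ o (node d (leaf x) (node q (leaf y) (leaf z))) = F-cong d q
        onTree-~ o (node d (leaf x) (node q (leaf y) (node _ _ _))) = 𝕂.refl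
        onTree-~ o (node d (leaf x) (node q (leaf y) (swap _ _ _))) = 𝕂.refl
        onTree-~ o (node d (leaf x) (node q (node _ _ _) _)) = 𝕂.refl
        onTree-~ o (node d (leaf x) (node q (swap _ _ _) _)) = 𝕂.refl
        onTree-~ o (node {d = p} d (leaf x) (swap q (leaf y) (leaf z))) =
          𝕂.trans (F-swap (inner-distinctˡ {p} {q} o)) (F-cong d D.≈ᴹ-refl)
        onTree-~ o (node d (leaf x) (swap q (leaf y) (node _ _ _))) = 𝕂.refl
        onTree-~ o (node d (leaf x) (swap q (node _ _ _) (leaf z))) = 𝕂.refl
        onTree-~ o (node d (leaf x) (swap q (node _ _ _) (node _ _ _))) = 𝕂.refl
        onTree-~ o (node d (node q (leaf y) (leaf z)) (leaf x)) = F-cong (act.⟦⟧-cong d) q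
        onTree-~ o (node d (node q (leaf y) (leaf z)) (node _ _ _)) = 𝕂.refl
        onTree-~ o (node d (node q (leaf y) (leaf z)) (swap _ _ _)) = 𝕂.refl
        onTree-~ o (node d (node q (leaf y) (node _ _ _)) _) = 𝕂.refl
        onTree-~ o (node d (node q (leaf y) (swap _ _ _)) _) = 𝕂.refl
        onTree-~ o (node d (node q (node _ _ _) _) _) = 𝕂.refl
        onTree-~ o (node d (node q (swap _ _ _) _) _) = 𝕂.refl
        onTree-~ o (node {d = p} d (swap q (leaf y) (leaf z)) (leaf x)) =
          𝕂.trans (F-swap (inner-distinctʳ {p} {q} o)) (F-cong (act.⟦⟧-cong d) D.≈ᴹ-refl)
        onTree-~ o (node d (swap q (leaf y) (leaf z)) (node _ _ _)) = 𝕂.refl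
        onTree-~ o (node d (swap q (leaf y) (leaf z)) (swap _ _ _)) = 𝕂.refl
        onTree-~ o (node d (swap q (leaf y) (node _ _ _)) _) = 𝕂.refl
        onTree-~ o (node d (swap q (node _ _ _) (leaf z)) _) = 𝕂.refl
        onTree-~ o (node d (swap q (node _ _ _) (node _ _ _)) _) = 𝕂.refl
        onTree-~ o (swap d (leaf x) (leaf y)) = 𝕂.refl
        onTree-~ o (swap d (leaf x) (node q (leaf y) (leaf z))) = F-cong (D.≈ᴹ-sym (swap-swap d)) D.≈ᴹ-refl
        onTree-~ o (swap d (leaf x) (node q (leaf y) (node _ _ _))) = 𝕂.refl
        onTree-~ o (swap d (leaf x) (node q (node _ _ _) _)) = 𝕂.refl
        onTree-~ o (swap d (node q (leaf y) (leaf z)) (leaf x)) = 𝕂.refl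
        onTree-~ o (swap d (node q (leaf y) (leaf z)) (node r (leaf _) (leaf _))) = 𝕂.refl
        onTree-~ o (swap d (node q (leaf y) (leaf z)) (node r (leaf _) (node _ _ _))) = 𝕂.refl
        onTree-~ o (swap d (node q (leaf y) (leaf z)) (node r (node _ _ _) _)) = 𝕂.refl
        onTree-~ o (swap d (node q (leaf y) (node _ _ _)) (leaf x)) = 𝕂.refl
        onTree-~ o (swap d (node q (leaf y) (node _ _ _)) (node r (leaf _) (leaf _))) = 𝕂.refl
        onTree-~ o (swap d (node q (leaf y) (node _ _ _)) (node r (leaf _) (node _ _ _))) = 𝕂.refl
        onTree-~ o (swap d (node q (leaf y) (node _ _ _)) (node r (node _ _ _) _)) = 𝕂.refl
        onTree-~ o (swap d (node q (node _ _ _) _) (leaf x)) = 𝕂.refl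
        onTree-~ o (swap d (node q (node _ _ _) _) (node r (leaf _) (leaf _))) = 𝕂.refl
        onTree-~ o (swap d (node q (node _ _ _) _) (node r (leaf _) (node _ _ _))) = 𝕂.refl
        onTree-~ o (swap d (node q (node _ _ _) _) (node r (node _ _ _) _)) = 𝕂.refl

        0≈0+0 : 0# ≈ₖ 0# +ₖ 0#
        0≈0+0 = 𝕂.sym (𝕂.+-identityˡ 0#)

        onTree-Sum : ∀ {t t₁ t₂} → Sum t t₁ t₂ → onTree t ≈ₖ onTree t₁ +ₖ onTree t₂
        onTree-Sum (here d₁ d₂ (leaf x) (leaf y)) = 0≈0+0
        onTree-Sum (here d₁ d₂ (leaf x) (node q (leaf y) (leaf z))) = F-+ˡ
        onTree-Sum (here d₁ d₂ (leaf x) (node q (leaf y) (node _ _ _))) = 0≈0+0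
        onTree-Sum (here d₁ d₂ (leaf x) (node q (node _ _ _) _)) = 0≈0+0
        onTree-Sum (here d₁ d₂ (node q (leaf y) (leaf z)) (leaf x)) =
          𝕂.trans (F-cong (act.+ᴹ-homo d₁ d₂) D.≈ᴹ-refl) F-+ˡ
        onTree-Sum (here d₁ d₂ (node q (leaf y) (leaf z)) (node _ _ _)) = 0≈0+0
        onTree-Sum (here d₁ d₂ (node q (leaf y) (node _ _ _)) _) = 0≈0+0
        onTree-Sum (here d₁ d₂ (node q (node _ _ _) _) _) = 0≈0+0
        onTree-Sum (left d (leaf x) (here q₁ q₂ (leaf y) (leaf z))) = F-+ʳ
        onTree-Sum (left d (node _ _ _) (here q₁ q₂ (leaf y) (leaf z))) = 0≈0+0
        onTree-Sum (left d u (here q₁ q₂ (leaf y) (node _ _ _))) = 0≈0+0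
        onTree-Sum (left d u (here q₁ q₂ (node _ _ _) _)) = 0≈0+0
        onTree-Sum (left d u (left q _ (here _ _ _ _))) = 0≈0+0
        onTree-Sum (left d u (left q _ (left _ _ _))) = 0≈0+0
        onTree-Sum (left d u (left q _ (right _ _ _))) = 0≈0+0
        onTree-Sum (left d u (right q (leaf y) (here _ _ _ _))) = 0≈0+0
        onTree-Sum (left d u (right q (leaf y) (left _ _ _))) = 0≈0+0
        onTree-Sum (left d u (right q (leaf y) (right _ _ _))) = 0≈0+0
        onTree-Sum (left d u (right q (node _ _ _) _)) = 0≈0+0
        onTree-Sum (right d (leaf x) (here q₁ q₂ (leaf y) (leaf z))) = F-+ʳ
        onTree-Sum (right d (leaf x) (here q₁ q₂ (leaf y) (node _ _ _))) = 0≈0+0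
        onTree-Sum (right d (leaf x) (here q₁ q₂ (node _ _ _) _)) = 0≈0+0
        onTree-Sum (right d (leaf x) (left q _ (here _ _ _ _))) = 0≈0+0
        onTree-Sum (right d (leaf x) (left q _ (left _ _ _))) = 0≈0+0
        onTree-Sum (right d (leaf x) (left q _ (right _ _ _))) = 0≈0+0
        onTree-Sum (right d (leaf x) (right q (leaf y) (here _ _ _ _))) = 0≈0+0
        onTree-Sum (right d (leaf x) (right q (leaf y) (left _ _ _))) = 0≈0+0
        onTree-Sum (right d (leaf x) (right q (leaf y) (right _ _ _))) = 0≈0+0
        onTree-Sum (right d (leaf x) (right q (node _ _ _) _)) = 0≈0+0
        onTree-Sum (right d (node q (leaf y) (leaf z)) (here _ _ _ _)) = 0≈0+0
        onTree-Sum (right d (node q (leaf y) (leaf z)) (left _ _ _)) = 0≈0+0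
        onTree-Sum (right d (node q (leaf y) (leaf z)) (right _ _ _)) = 0≈0+0
        onTree-Sum (right d (node q (leaf y) (node _ _ _)) _) = 0≈0+0
        onTree-Sum (right d (node q (node _ _ _) _) _) = 0≈0+0

        onTree-Multiple : ∀ {a t t₁} → Multiple a t t₁ → onTree t ≈ₖ a *ₖ onTree t₁
        onTree-Multiple {a} = go
          where
          0≈a0 : 0# ≈ₖ a *ₖ 0#
          0≈a0 = 𝕂.sym (𝕂.zeroʳ a)

          go : ∀ {t t₁} → Multiple a t t₁ → onTree t ≈ₖ a *ₖ onTree t₁
          go (here d (leaf x) (leaf y)) = 0≈a0
          go (here d (leaf x) (node q (leaf y) (leaf z))) = F-*ˡ
          go (here d (leaf x) (node q (leaf y) (node _ _ _))) = 0≈a0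
          go (here d (leaf x) (node q (node _ _ _) _)) = 0≈a0
          go (here d (node q (leaf y) (leaf z)) (leaf x)) =
            𝕂.trans (F-cong (act.*ₗ-homo a d) D.≈ᴹ-refl) F-*ˡ
          go (here d (node q (leaf y) (leaf z)) (node _ _ _)) = 0≈a0
          go (here d (node q (leaf y) (node _ _ _)) _) = 0≈a0
          go (here d (node q (node _ _ _) _) _) = 0≈a0
          go (left d (leaf x) (here q (leaf y) (leaf z))) = F-*ʳ
          go (left d (node _ _ _) (here q (leaf y) (leaf z))) = 0≈a0
          go (left d u (here q (leaf y) (node _ _ _))) = 0≈a0
          go (left d u (here q (node _ _ _) _)) = 0≈a0
          go (left d u (left q _ (here _ _ _))) = 0≈a0
          go (left d u (left q _ (left _ _ _))) = 0≈a0
          go (left d u (left q _ (right _ _ _))) = 0≈a0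
          go (left d u (right q (leaf y) (here _ _ _))) = 0≈a0
          go (left d u (right q (leaf y) (left _ _ _))) = 0≈a0
          go (left d u (right q (leaf y) (right _ _ _))) = 0≈a0
          go (left d u (right q (node _ _ _) _)) = 0≈a0
          go (right d (leaf x) (here q (leaf y) (leaf z))) = F-*ʳ
          go (right d (leaf x) (here q (leaf y) (node _ _ _))) = 0≈a0
          go (right d (leaf x) (here q (node _ _ _) _)) = 0≈a0
          go (right d (leaf x) (left q _ (here _ _ _))) = 0≈a0
          go (right d (leaf x) (left q _ (left _ _ _))) = 0≈a0
          go (right d (leaf x) (left q _ (right _ _ _))) = 0≈a0
          go (right d (leaf x) (right q (leaf y) (here _ _ _))) = 0≈a0
          go (right d (leaf x) (right q (leaf y) (left _ _ _))) = 0≈a0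
          go (right d (leaf x) (right q (leaf y) (right _ _ _))) = 0≈a0
          go (right d (leaf x) (right q (node _ _ _) _)) = 0≈a0
          go (right d (node q (leaf y) (leaf z)) (here _ _ _)) = 0≈a0
          go (right d (node q (leaf y) (leaf z)) (left _ _ _)) = 0≈a0
          go (right d (node q (leaf y) (leaf z)) (right _ _ _)) = 0≈a0
          go (right d (node q (leaf y) (node _ _ _)) _) = 0≈a0
          go (right d (node q (node _ _ _) _) _) = 0≈a0

      onTree-compatible : Compatible (scalars K) {V} (onTree ∘ tree)
      onTree-compatible = record
        { f-same = λ {t} → onTree-~ (TreeOn.once t)
        ; f-sum = onTree-Sum
        ; f-multiple = onTree-Multiple
        }

    relabelGrafting : {A B : Set} → (A → B) → Grafting K S A → Grafting K S B
    relabelGrafting f (p ⟨ x , q ⟨ y , z ⟩⟩) = p ⟨ f x , q ⟨ f y , f z ⟩⟩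

    graftingOf-map : {A B : Set} (f : A → B) (t : Tree K Decoration A) →
                     graftingOf (mapTree K f t) ≡ Maybe.map (relabelGrafting f) (graftingOf t)
    graftingOf-map f (leaf _) = refl
    graftingOf-map f (node _ (leaf _) (leaf _)) = refl
    graftingOf-map f (node _ (leaf _) (node _ (leaf _) (leaf _))) = refl
    graftingOf-map f (node _ (leaf _) (node _ (leaf _) (node _ _ _))) = refl
    graftingOf-map f (node _ (leaf _) (node _ (node _ _ _) _)) = refl
    graftingOf-map f (node _ (node _ (leaf _) (leaf _)) (leaf _)) = refl
    graftingOf-map f (node _ (node _ (leaf _) (leaf _)) (node _ _ _)) = refl
    graftingOf-map f (node _ (node _ (leaf _) (node _ _ _)) _) = refl
    graftingOf-map f (node _ (node _ (node _ _ _) _) _) = refl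

    -- The leaves are presented as the image of (0, 1, 2) under a bijection, the form in which their
    -- orientation can be compared with signatures.
    data Labelled (V : FinSet) : GraftingOn V → Set m where
      labelled : ∀ p q (τ : Three ≃ V) → Labelled V (p ⟨ to τ 0F , q ⟨ to τ 1F , to τ 2F ⟩⟩)

    graftingOf-labelled : ∀ {V a} (t : TreeOn K Decoration V) → graftingOf (tree t) ≡ just a → Labelled V a
    graftingOf-labelled {V} (node p (leaf x) (node q (leaf y) (leaf z)) ⊢ once) refl =
      labelled p q (labelling V x y z once)
    graftingOf-labelled {V} (node p (node q (leaf y) (leaf z)) (leaf x) ⊢ once) refl =
      labelled (act swap₂ p) q (labelling V x y z (λ v → trans (ℕ.+-comm (indicator (FinSet._≟_ V) x v) _) (once v)))

    two-nodes : ∀ {A : Set} (t : Tree K Decoration A) → nodes K t ≡ 2 →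
                ∃ λ a → graftingOf t ≡ just a × t ~ drawn K S a
    two-nodes (node p (leaf x) (node q (leaf y) (leaf z))) _ = _ , refl , ~-refl _
    two-nodes (node p (node q (leaf y) (leaf z)) (leaf x)) _ = _ , refl , swap p _ _
    two-nodes (node _ (leaf _) (node _ (leaf _) (node _ _ _))) ()
    two-nodes (node _ (leaf _) (node _ (node _ _ _) _)) ()
    two-nodes (node _ (node _ (leaf _) (leaf _)) (node _ _ _)) ()
    two-nodes (node _ (node _ (leaf _) (node _ _ _)) _) ()
    two-nodes (node _ (node _ (node _ _ _) _) _) ()

    canonical : Fin 3 → Decoration → Decoration → TreeOn K Decoration Three
    -- The leaf count is decided for all three roots at once, since it does not compute for a
    -- variable `i`.
    canonical i p q = t i ⊢ toWitness {a? = Fin.all? λ i → Fin.all? λ v → occurrences K Three (t i) v ℕ.≟ 1} tt i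
      where
      t : Fin 3 → Tree K Decoration (Fin 3)
      t i = drawn K S (p ⟨ i , q ⟨ next i , next (next i) ⟩⟩)

    -- If the image of (0, 1, 2) is not a rotation, exchanging the two inner leaves makes it one, at
    -- the price of swapping the inner decoration.
    canonical-form : ∀ (τ : Three ≃ Three) p q →
      ([ relabelTree K τ (canonical 0F p q) ] ≈ [ canonical (to τ 0F) p q ]) ⊎
      ([ relabelTree K τ (canonical 0F p q) ] ≈ [ canonical (to τ 0F) p (act swap₂ q) ])
    canonical-form τ p q with permutation-rotation τ
    ... | inj₁ (eq₁ , eq₂) = inj₁ (same (~-reflexive
      (cong₂ (λ y z → drawn K S (p ⟨ to τ 0F , q ⟨ y , z ⟩⟩)) eq₁ eq₂)))
    ... | inj₂ (eq₂ , eq₁) = inj₂ (same (subst (drawn K S (p ⟨ to τ 0F , q ⟨ to τ 1F , to τ 2F ⟩⟩) ~_)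
      (cong₂ (λ z y → drawn K S (p ⟨ to τ 0F , act swap₂ q ⟨ z , y ⟩⟩)) eq₂ eq₁)
      (node D.≈ᴹ-refl (leaf _) (swap q _ _))))

    two-node-tree : ∀ {V} (t : TreeOn K Decoration V) → nodes K (tree t) ≡ 2 →
      ∃ λ p → ∃ λ q → ∃ λ (τ : Three ≃ V) → [ t ] ≈ [ relabelTree K τ (canonical 0F p q) ]
    two-node-tree t two-nodes-t with two-nodes (tree t) two-nodes-t
    ... | a , eq , t~a with graftingOf-labelled t eq
    ... | labelled p q τ = p , q , τ , same t~a

    private
      module free {V W} (σ : V ≃ W) = Linear K {M = freeObj V} {N = freeObj W} (Species.act-linear freeSpecies σ)

    module _ {r : Level} {Q : Element K S Three → Set r} (Q-subspace : IsSubspace (freeObj Three) Q)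
             (Q-canonical : ∀ i p q → Q [ canonical i p q ]) where
      open IsSubspace Q-subspace

      -- The decorations of the canonical trees are arbitrary, so the swap that `canonical-form` may
      -- introduce is harmless and only the three roots remain to be checked.
      Free²-induction : ∀ {V f} → Free² K S V f → (σ : V ≃ Three) → Q (relabelling σ f)
      Free²-induction = span-relabel freeSpecies Q-subspace onTwoNodeTree
        where
        onTwoNodeTree : ∀ {V f} → TwoNodeTree V f → (σ : V ≃ Three) → Q (relabelling σ f)
        onTwoNodeTree (two {t = t} n) σ with two-node-tree t n
        ... | p , q , τ , t≈ = Q-resp (≈-sym (≈-trans (free.⟦⟧-cong σ t≈)
                (≈-sym (Species.act-∘ freeSpecies σ τ [ canonical 0F p q ]))))
              (on (canonical-form (σ ∘≃ τ) p q))
          where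
          on : ∀ {x i r} → (x ≈ [ canonical i p q ]) ⊎ (x ≈ [ canonical i p r ]) → Q x
          on (inj₁ eq) = Q-resp (≈-sym eq) (Q-canonical _ _ _)
          on (inj₂ eq) = Q-resp (≈-sym eq) (Q-canonical _ _ _)

    -- Zero belongs to `Free²` on every set, so membership alone does not bound the size of `V`. A
    -- derivation either uses a tree, whose leaves label `V`, or uses none and builds zero.
    Free²-support : ∀ {V f} → Free² K S V f → (V ≃ Three) ⊎ (f ≈ 𝟘)
    Free²-support (incl (two {t = t} n)) = let _ , _ , τ , _ = two-node-tree t n in inj₁ (τ ⁻¹≃)
    Free²-support (resp p s) with Free²-support s
    ... | inj₁ σ  = inj₁ σ
    ... | inj₂ eq = inj₂ (≈-trans (≈-sym p) eq)
    Free²-support zero = inj₂ ≈-refl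
    Free²-support (add s t) with Free²-support s | Free²-support t
    ... | inj₁ σ  | _       = inj₁ σ
    ... | inj₂ _  | inj₁ σ  = inj₁ σ
    ... | inj₂ eq | inj₂ eq′ = inj₂ (≈-trans (⊕-cong eq eq′) (⊕-identityˡ 𝟘))
    Free²-support {V} (scale a s) with Free²-support s
    ... | inj₁ σ  = inj₁ σ
    ... | inj₂ eq = inj₂ (≈-trans (⊙-cong 𝕂.refl eq) (LeftModule.*ₗ-zeroʳ (freeObj V) a))
    Free²-support (relabel σ s) with Free²-support s
    ... | inj₁ τ  = inj₁ (τ ∘≃ (σ ⁻¹≃))
    ... | inj₂ eq = inj₂ (free.⟦⟧-cong σ eq)

  -- The pairing

  -1*-1≈1 : (-ₖ 1#) *ₖ (-ₖ 1#) ≈ₖ 1#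
  -1*-1≈1 = 𝕂.trans (RingProperties.-1*x≈-x ring _) (RingProperties.-‿involutive ring 1#)

  signum-opposite : ∀ s → signum K (Sign.opposite s) ≈ₖ (-ₖ 1#) *ₖ signum K s
  signum-opposite Sign.+ = 𝕂.sym (𝕂.*-identityʳ _)
  signum-opposite Sign.- = 𝕂.sym -1*-1≈1

  signum-* : ∀ s t → signum K (s Sign.* t) ≈ₖ signum K s *ₖ signum K t
  signum-* Sign.+ t = 𝕂.sym (𝕂.*-identityˡ _)
  signum-* Sign.- t = signum-opposite t

  open CommutativeSemigroupProperties 𝕂.*-commutativeSemigroup using (x∙yz≈y∙xz)
    renaming (interchange to *-interchange)

  -- One minus sign comes from the orientation of the leaves, the other from the twisted action on
  -- the dual.
  cancel-signs : ∀ e f g → ((-ₖ 1#) *ₖ e) *ₖ (f *ₖ ((-ₖ 1#) *ₖ g)) ≈ₖ e *ₖ (f *ₖ g)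
  cancel-signs e f g = begin
    ((-ₖ 1#) *ₖ e) *ₖ (f *ₖ ((-ₖ 1#) *ₖ g))   ≈⟨ 𝕂.*-congˡ (x∙yz≈y∙xz f _ g) ⟩
    ((-ₖ 1#) *ₖ e) *ₖ ((-ₖ 1#) *ₖ (f *ₖ g))   ≈⟨ *-interchange (-ₖ 1#) e (-ₖ 1#) (f *ₖ g) ⟩
    ((-ₖ 1#) *ₖ (-ₖ 1#)) *ₖ (e *ₖ (f *ₖ g))   ≈⟨ 𝕂.*-congʳ -1*-1≈1 ⟩
    1# *ₖ (e *ₖ (f *ₖ g))                     ≈⟨ 𝕂.*-identityˡ _ ⟩
    e *ₖ (f *ₖ g)                             ∎
    where open import Relation.Binary.Reasoning.Setoid 𝕂.setoid

  -- The nested conditional of `pairGraftings` with its tests abstracted, so that each property is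
  -- checked on Booleans.
  branch : Bool → Bool → 𝕂 → 𝕂 → 𝕂
  branch b b′ u v = if b then u else if b′ then v else 0#

  branch-≡ : ∀ {b b′ c c′ u v} → b ≡ c → b′ ≡ c′ → branch b b′ u v ≡ branch c c′ u v
  branch-≡ refl refl = refl

  branch-cong : ∀ b b′ {u v u′ v′} → u ≈ₖ u′ → v ≈ₖ v′ → branch b b′ u v ≈ₖ branch b b′ u′ v′
  branch-cong true  _     p q = p
  branch-cong false true  p q = q
  branch-cong false false p q = 𝕂.refl

  branch-+ : ∀ b b′ {u v u₁ v₁ u₂ v₂} → u ≈ₖ u₁ +ₖ u₂ → v ≈ₖ v₁ +ₖ v₂ →
             branch b b′ u v ≈ₖ branch b b′ u₁ v₁ +ₖ branch b b′ u₂ v₂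
  branch-+ true  _     p q = p
  branch-+ false true  p q = q
  branch-+ false false p q = 𝕂.sym (𝕂.+-identityˡ 0#)

  branch-* : ∀ b b′ {a u v u₁ v₁} → u ≈ₖ a *ₖ u₁ → v ≈ₖ a *ₖ v₁ →
             branch b b′ u v ≈ₖ a *ₖ branch b b′ u₁ v₁
  branch-* true  _     p q = p
  branch-* false true  p q = q
  branch-* false false p q = 𝕂.sym (𝕂.zeroʳ _)

  -- The first test takes priority, so the tests may change places only if they never both succeed.
  branch-swap : ∀ b b′ {u v u′ v′} → (b ≡ true → ¬ b′ ≡ true) → u ≈ₖ v′ → v ≈ₖ u′ →
                branch b b′ u v ≈ₖ branch b′ b u′ v′
  branch-swap true  true  e p q = contradiction refl (e refl)
  branch-swap true  false e p q = p
  branch-swap false true  e p q = q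
  branch-swap false false e p q = 𝕂.refl

  *-+ˡ : ∀ e {f f₁ f₂} g → f ≈ₖ f₁ +ₖ f₂ → e *ₖ (f *ₖ g) ≈ₖ e *ₖ (f₁ *ₖ g) +ₖ e *ₖ (f₂ *ₖ g)
  *-+ˡ e g p = 𝕂.trans (𝕂.*-congˡ (𝕂.trans (𝕂.*-congʳ p) (𝕂.distribʳ g _ _))) (𝕂.distribˡ e _ _)

  *-+ʳ : ∀ e f {g g₁ g₂} → g ≈ₖ g₁ +ₖ g₂ → e *ₖ (f *ₖ g) ≈ₖ e *ₖ (f *ₖ g₁) +ₖ e *ₖ (f *ₖ g₂)
  *-+ʳ e f p = 𝕂.trans (𝕂.*-congˡ (𝕂.trans (𝕂.*-congˡ p) (𝕂.distribˡ f _ _))) (𝕂.distribˡ e _ _)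

  *-*ˡ : ∀ a e {f f₁} g → f ≈ₖ a *ₖ f₁ → e *ₖ (f *ₖ g) ≈ₖ a *ₖ (e *ₖ (f₁ *ₖ g))
  *-*ˡ a e g p = 𝕂.trans (𝕂.*-congˡ (𝕂.trans (𝕂.*-congʳ p) (𝕂.*-assoc a _ g))) (x∙yz≈y∙xz e a _)

  *-*ʳ : ∀ a e f {g g₁} → g ≈ₖ a *ₖ g₁ → e *ₖ (f *ₖ g) ≈ₖ a *ₖ (e *ₖ (f *ₖ g₁))
  *-*ʳ a e f p = 𝕂.trans (𝕂.*-congˡ (𝕂.trans (𝕂.*-congˡ p) (x∙yz≈y∙xz f a _))) (x∙yz≈y∙xz e a _)

  module Pairing {m e : Level} (S : Species K m e) where
    open Species S
    private
      S∨ = _∨ K S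
      module D = LeftModule (obj (fin 2))
      module F = FreeOperad K S
      module F∨ = FreeOperad K S∨
      module G = Graftings S
      module G∨ = Graftings S∨
      module swap = Linear K {M = obj (fin 2)} {N = obj (fin 2)} (act-linear swap₂)

      ⟦_⟧ : Functional K (obj (fin 2)) → D.Carrierᴹ → 𝕂
      ⟦ f ⟧ = Functional.⟦_⟧ f

      module functional (f : Functional K (obj (fin 2))) =
        Linear K {M = obj (fin 2)} {N = scalars K} (Functional.isLinear f)

    module _ (V : FinSet) where
      open FinSet V using (_≟_)

      ε : Carrier V → Carrier V → Carrier V → 𝕂
      ε x y z = signum K (orientation V (x ∷ y ∷ z ∷ []))

      direct crossed : (x y z x′ y′ z′ : Carrier V) → Bool
      direct  x y z x′ y′ z′ = does (x ≟ x′) ∧ does (y ≟ y′) ∧ does (z ≟ z′)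
      crossed x y z x′ y′ z′ = does (x ≟ x′) ∧ does (y ≟ z′) ∧ does (z ≟ y′)

      -- Exchanging `y′` and `z′` turns the direct test into the crossed one and conversely. No sign
      -- appears, as the orientation is taken from the dual tree.
      pairGraftings-multilinearʳ : (a : G∨.GraftingOn V) → G.Multilinear (pairGraftings K S V a)
      pairGraftings-multilinearʳ (f ⟨ x , g ⟨ y , z ⟩⟩) = record
        { F-cong = λ {_} {_} {_} {_} {x′} {y′} {z′} p q →
            branch-cong (direct x y z x′ y′ z′) (crossed x y z x′ y′ z′)
              (𝕂.*-congˡ (𝕂.*-cong (f.⟦⟧-cong p) (g.⟦⟧-cong q)))
              (𝕂.*-congˡ (𝕂.*-cong (f.⟦⟧-cong p) (g.⟦⟧-cong (swap.⟦⟧-cong q))))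
        ; F-swap = λ {p} {q} {x′} {y′} {z′} y′≢z′ →
            branch-swap (direct x y z x′ y′ z′) (crossed x y z x′ y′ z′)
              (λ d c → y′≢z′ (proj₂ (both-matches _≟_ x y z x′ y′ z′ d c)))
              (𝕂.*-congˡ (𝕂.*-congˡ (g.⟦⟧-cong (D.≈ᴹ-sym (G.swap-swap q)))))
              𝕂.refl
        ; F-+ˡ = λ {p} {p′} {q} {x′} {y′} {z′} →
            branch-+ (direct x y z x′ y′ z′) (crossed x y z x′ y′ z′)
              (*-+ˡ _ _ (f.+ᴹ-homo p p′)) (*-+ˡ _ _ (f.+ᴹ-homo p p′))
        ; F-+ʳ = λ {p} {q} {q′} {x′} {y′} {z′} →
            branch-+ (direct x y z x′ y′ z′) (crossed x y z x′ y′ z′)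
              (*-+ʳ _ _ (g.+ᴹ-homo q q′))
              (*-+ʳ _ _ (𝕂.trans (g.⟦⟧-cong (swap.+ᴹ-homo q q′)) (g.+ᴹ-homo _ _)))
        ; F-*ˡ = λ {a} {p} {q} {x′} {y′} {z′} →
            branch-* (direct x y z x′ y′ z′) (crossed x y z x′ y′ z′)
              (*-*ˡ _ _ _ (f.*ₗ-homo a p)) (*-*ˡ _ _ _ (f.*ₗ-homo a p))
        ; F-*ʳ = λ {a} {p} {q} {x′} {y′} {z′} →
            branch-* (direct x y z x′ y′ z′) (crossed x y z x′ y′ z′)
              (*-*ʳ _ _ _ (g.*ₗ-homo a q))
              (*-*ʳ _ _ _ (𝕂.trans (g.⟦⟧-cong (swap.*ₗ-homo a q)) (g.*ₗ-homo a _)))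
        }
        where
        module f = functional f
        module g = functional g

      -- Here the exchange also reverses the orientation of the dual tree, and the sign of the
      -- twisted `swap₂` compensates for it.
      pairGraftings-multilinearˡ : (b : G.GraftingOn V) → G∨.Multilinear (λ a → pairGraftings K S V a b)
      pairGraftings-multilinearˡ (p ⟨ x′ , q ⟨ y′ , z′ ⟩⟩) = record
        { F-cong = λ {_} {_} {_} {_} {x} {y} {z} f≈ g≈ →
            branch-cong (direct x y z x′ y′ z′) (crossed x y z x′ y′ z′)
              (𝕂.*-congˡ (𝕂.*-cong (f≈ p) (g≈ q)))
              (𝕂.*-congˡ (𝕂.*-cong (f≈ p) (g≈ _)))
        ; F-swap = λ {f} {g} {x} {y} {z} y≢z → begin
            branch (direct x y z x′ y′ z′) (crossed x y z x′ y′ z′)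
              (ε x y z *ₖ (⟦ f ⟧ p *ₖ ⟦ g ⟧ q)) (ε x y z *ₖ (⟦ f ⟧ p *ₖ ⟦ g ⟧ (act swap₂ q)))
              ≈⟨ branch-swap (direct x y z x′ y′ z′) (crossed x y z x′ y′ z′)
                   (λ d c → y≢z (proj₁ (both-matches _≟_ x y z x′ y′ z′ d c)))
                   (swapped f g (act swap₂ q) q y≢z (D.≈ᴹ-trans (swap⁻¹ _) (G.swap-swap q)))
                   (swapped f g q (act swap₂ q) y≢z (swap⁻¹ q)) ⟩
            branch (crossed x y z x′ y′ z′) (direct x y z x′ y′ z′)
              (ε x z y *ₖ (⟦ f ⟧ p *ₖ ⟦ Species.act S∨ swap₂ g ⟧ q))
              (ε x z y *ₖ (⟦ f ⟧ p *ₖ ⟦ Species.act S∨ swap₂ g ⟧ (act swap₂ q)))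
              ≡⟨ branch-≡
                   (swap-matches _≟_ x z y x′ z′ y′) (swap-matches _≟_ x z y x′ y′ z′) ⟩
            branch (direct x z y x′ y′ z′) (crossed x z y x′ y′ z′)
              (ε x z y *ₖ (⟦ f ⟧ p *ₖ ⟦ Species.act S∨ swap₂ g ⟧ q))
              (ε x z y *ₖ (⟦ f ⟧ p *ₖ ⟦ Species.act S∨ swap₂ g ⟧ (act swap₂ q))) ∎
        ; F-+ˡ = λ {f} {f′} {g} {x} {y} {z} →
            branch-+ (direct x y z x′ y′ z′) (crossed x y z x′ y′ z′)
              (*-+ˡ _ _ 𝕂.refl) (*-+ˡ _ _ 𝕂.refl)
        ; F-+ʳ = λ {f} {g} {g′} {x} {y} {z} →
            branch-+ (direct x y z x′ y′ z′) (crossed x y z x′ y′ z′)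
              (*-+ʳ _ _ 𝕂.refl) (*-+ʳ _ _ 𝕂.refl)
        ; F-*ˡ = λ {a} {f} {g} {x} {y} {z} →
            branch-* (direct x y z x′ y′ z′) (crossed x y z x′ y′ z′)
              (*-*ˡ _ _ _ 𝕂.refl) (*-*ˡ _ _ _ 𝕂.refl)
        ; F-*ʳ = λ {a} {f} {g} {x} {y} {z} →
            branch-* (direct x y z x′ y′ z′) (crossed x y z x′ y′ z′)
              (*-*ʳ _ _ _ 𝕂.refl) (*-*ʳ _ _ _ 𝕂.refl)
        }
        where
        open import Relation.Binary.Reasoning.Setoid 𝕂.setoid

        swap⁻¹ : ∀ d → act (swap₂ ⁻¹≃) d D.≈ᴹ act swap₂ d
        swap⁻¹ = act-ext (swap₂ ⁻¹≃) swap₂ (λ { 0F → refl ; 1F → refl })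

        swapped : ∀ f g d d′ {x y z} → y ≢ z → act (swap₂ ⁻¹≃) d D.≈ᴹ d′ →
          ε x y z *ₖ (⟦ f ⟧ p *ₖ ⟦ g ⟧ d′) ≈ₖ ε x z y *ₖ (⟦ f ⟧ p *ₖ ⟦ Species.act S∨ swap₂ g ⟧ d)
        swapped f g d d′ {x} {y} {z} y≢z d≈d′ = 𝕂.sym (begin
          ε x z y *ₖ (⟦ f ⟧ p *ₖ ⟦ Species.act S∨ swap₂ g ⟧ d)
            ≈⟨ 𝕂.*-cong
                 (𝕂.trans (𝕂.reflexive (cong (signum K) (orientation-swap V {x} {y} {z} y≢z)))
                          (signum-opposite (orientation V (x ∷ y ∷ z ∷ []))))
                 (𝕂.*-congˡ (𝕂.*-congˡ (functional.⟦⟧-cong g d≈d′))) ⟩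
          ((-ₖ 1#) *ₖ ε x y z) *ₖ (⟦ f ⟧ p *ₖ ((-ₖ 1#) *ₖ ⟦ g ⟧ d′))
            ≈⟨ cancel-signs _ _ _ ⟩
          ε x y z *ₖ (⟦ f ⟧ p *ₖ ⟦ g ⟧ d′) ∎)

      -- Exposes the pairing as a function of two graftings, so that either one can be fixed while
      -- the other varies.
      pairTrees-maybe : ∀ t u → pairTrees K S V t u ≡
        maybe′ (λ a → maybe′ (pairGraftings K S V a) 0# (G.graftingOf (tree u))) 0# (G∨.graftingOf (tree t))
      pairTrees-maybe t u with G∨.graftingOf (tree t) | G.graftingOf (tree u)
      ... | just _  | just _  = refl
      ... | just _  | nothing = refl
      ... | nothing | _       = refl

      pairTrees-compatibleʳ : ∀ t → F.Compatible (scalars K) {V} (pairTrees K S V t)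
      pairTrees-compatibleʳ t = compatible-resp S (scalars K) (λ u → 𝕂.reflexive (pairTrees-maybe t u)) fixed
        where
        fixed : F.Compatible (scalars K) {V}
          (λ u → maybe′ (λ a → maybe′ (pairGraftings K S V a) 0# (G.graftingOf (tree u))) 0# (G∨.graftingOf (tree t)))
        fixed with G∨.graftingOf (tree t)
        ... | just a  = G.onTree-compatible (pairGraftings-multilinearʳ a)
        ... | nothing = compatible-resp S (scalars K)
          (λ u → 𝕂.reflexive (maybe-zero (G.graftingOf (tree u)))) (G.onTree-compatible {V} G.zero-multilinear)
          where
          maybe-zero : ∀ {A : Set m} (b : Maybe A) → 0# ≡ maybe′ (λ _ → 0#) 0# b
          maybe-zero (just _) = refl
          maybe-zero nothing  = refl

      pairTrees-compatibleˡ : ∀ u → F∨.Compatible (scalars K) {V} (λ t → pairTrees K S V t u)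
      pairTrees-compatibleˡ u = compatible-resp S∨ (scalars K) (λ t → 𝕂.reflexive (pairTrees-maybe t u)) fixed
        where
        fixed : F∨.Compatible (scalars K) {V}
          (λ t → maybe′ (λ a → maybe′ (pairGraftings K S V a) 0# (G.graftingOf (tree u))) 0# (G∨.graftingOf (tree t)))
        fixed with G.graftingOf (tree u)
        ... | just b  = G∨.onTree-compatible (pairGraftings-multilinearˡ b)
        ... | nothing = G∨.onTree-compatible {V} G∨.zero-multilinear

      private
        ⟨_∣_⟩ₛ : Element K S∨ V → Element K S V → 𝕂
        ⟨ f ∣ x ⟩ₛ = ⟨_∣_⟩ K S {V} f x

      pairing-congʳ : ∀ f {x y} → x F.≈ y → ⟨ f ∣ x ⟩ₛ ≈ₖ ⟨ f ∣ y ⟩ₛ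
      pairing-congʳ f p = F∨.extend-≈ (scalars K) (λ t → F.extend-cong (scalars K) (pairTrees-compatibleʳ t) p) f

      pairing-+ʳ : ∀ f x y → ⟨ f ∣ x ⊕ y ⟩ₛ ≈ₖ ⟨ f ∣ x ⟩ₛ +ₖ ⟨ f ∣ y ⟩ₛ
      pairing-+ʳ f x y = F∨.extend-+ (scalars K) (λ _ → 𝕂.refl) f

      pairing-*ʳ : ∀ f a x → ⟨ f ∣ a ⊙ x ⟩ₛ ≈ₖ a *ₖ ⟨ f ∣ x ⟩ₛ
      pairing-*ʳ f a x = F∨.extend-* (scalars K) (λ _ → 𝕂.refl) f

      pairing-linearʳ : ∀ f → IsLinear K (F.freeObj V) (scalars K) ⟨ f ∣_⟩ₛ
      pairing-linearʳ f = linear K {M = F.freeObj V} {N = scalars K} (pairing-congʳ f) (pairing-+ʳ f) (pairing-*ʳ f)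

      pairing-congˡ : ∀ {f g} x → f F∨.≈ g → ⟨ f ∣ x ⟩ₛ ≈ₖ ⟨ g ∣ x ⟩ₛ
      pairing-congˡ x = F∨.extend-cong (scalars K) (record
        { f-same = λ {t} {t′} p → F.extend-≈ (scalars K)
            (λ u → F∨.Compatible.f-same (pairTrees-compatibleˡ u) {t} {t′} p) x
        ; f-sum = λ {t} {t₁} {t₂} p → F.extend-+ (scalars K)
            (λ u → F∨.Compatible.f-sum (pairTrees-compatibleˡ u) {t} {t₁} {t₂} p) x
        ; f-multiple = λ {a} {t} {t′} p → F.extend-* (scalars K)
            (λ u → F∨.Compatible.f-multiple (pairTrees-compatibleˡ u) {a} {t} {t′} p) x
        })

      pairing-linearˡ : ∀ x → IsLinear K (F∨.freeObj V) (scalars K) ⟨_∣ x ⟩ₛ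
      pairing-linearˡ x = linear K {M = F∨.freeObj V} {N = scalars K}
        (pairing-congˡ x) (λ _ _ → 𝕂.refl) (λ _ _ → 𝕂.refl)

    module _ {V W : FinSet} (σ : V ≃ W) where
      private
        s : 𝕂
        s = signum K (sign σ)

        module V = FinSet V
        module W = FinSet W

      does-relabel : ∀ x y → does (to σ x W.≟ to σ y) ≡ does (x V.≟ y)
      does-relabel x y = does-⇔ (mk⇔ (to-injective σ) (cong (to σ))) (to σ x W.≟ to σ y) (x V.≟ y)

      -- The tests are unchanged because σ is injective, and the orientation is multiplied by the
      -- signature of σ because the leaves of `a` enumerate all of `V`.
      pairGraftings-relabel : ∀ {a} b → G∨.Labelled V a →
        pairGraftings K S W (G∨.relabelGrafting (to σ) a) (G.relabelGrafting (to σ) b) ≈ₖ s *ₖ pairGraftings K S V a b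
      pairGraftings-relabel (p ⟨ x′ , q ⟨ y′ , z′ ⟩⟩) (G∨.labelled f g τ) = begin
        branch (direct W (to σ x) (to σ y) (to σ z) (to σ x′) (to σ y′) (to σ z′))
               (crossed W (to σ x) (to σ y) (to σ z) (to σ x′) (to σ y′) (to σ z′))
               (εσ *ₖ (⟦ f ⟧ p *ₖ ⟦ g ⟧ q)) (εσ *ₖ (⟦ f ⟧ p *ₖ ⟦ g ⟧ (act swap₂ q)))
          ≡⟨ branch-≡
               (cong₂ _∧_ (does-relabel x x′) (cong₂ _∧_ (does-relabel y y′) (does-relabel z z′)))
               (cong₂ _∧_ (does-relabel x x′) (cong₂ _∧_ (does-relabel y z′) (does-relabel z y′))) ⟩
        branch (direct V x y z x′ y′ z′) (crossed V x y z x′ y′ z′)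
               (εσ *ₖ (⟦ f ⟧ p *ₖ ⟦ g ⟧ q)) (εσ *ₖ (⟦ f ⟧ p *ₖ ⟦ g ⟧ (act swap₂ q)))
          ≈⟨ branch-* (direct V x y z x′ y′ z′) (crossed V x y z x′ y′ z′) (signed _) (signed _) ⟩
        s *ₖ branch (direct V x y z x′ y′ z′) (crossed V x y z x′ y′ z′)
               (ε V x y z *ₖ (⟦ f ⟧ p *ₖ ⟦ g ⟧ q)) (ε V x y z *ₖ (⟦ f ⟧ p *ₖ ⟦ g ⟧ (act swap₂ q))) ∎
        where
        open import Relation.Binary.Reasoning.Setoid 𝕂.setoid
        x = to τ 0F
        y = to τ 1F
        z = to τ 2F
        εσ = ε W (to σ x) (to σ y) (to σ z)

        signed : ∀ a → εσ *ₖ a ≈ₖ s *ₖ (ε V x y z *ₖ a)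
        signed a = 𝕂.trans (𝕂.*-congʳ (𝕂.trans
          (𝕂.reflexive (cong (signum K) (orientation-map σ (elements-map τ)))) (signum-* (sign σ) _)))
          (𝕂.*-assoc s _ a)

      pairTrees-relabel : ∀ t u → pairTrees K S W (relabelTree K σ t) (relabelTree K σ u) ≈ₖ s *ₖ pairTrees K S V t u
      pairTrees-relabel t u = 𝕂.trans (𝕂.reflexive (trans (pairTrees-maybe W (relabelTree K σ t) (relabelTree K σ u))
        (cong₂ (λ a b → maybe′ (λ a → maybe′ (pairGraftings K S W a) 0# b) 0# a)
          (G∨.graftingOf-map (to σ) (tree t)) (G.graftingOf-map (to σ) (tree u)))))
        (𝕂.trans (cases (G.graftingOf (tree u)) (G∨.graftingOf (tree t)) refl)
          (𝕂.*-congˡ (𝕂.reflexive (sym (pairTrees-maybe V t u)))))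
        where
        cases : ∀ b a → G∨.graftingOf (tree t) ≡ a →
          maybe′ (λ a → maybe′ (pairGraftings K S W a) 0# (Maybe.map (G.relabelGrafting (to σ)) b)) 0#
            (Maybe.map (G∨.relabelGrafting (to σ)) a)
          ≈ₖ s *ₖ maybe′ (λ a → maybe′ (pairGraftings K S V a) 0# b) 0# a
        cases b        nothing  eq = 𝕂.sym (𝕂.zeroʳ s)
        cases nothing  (just a) eq = 𝕂.sym (𝕂.zeroʳ s)
        cases (just b) (just a) eq = pairGraftings-relabel b (G∨.graftingOf-labelled t eq)

      -- Sign-equivariance of the pairing: orthogonality on any `V` can be tested on `Three`, a
      -- common sign not affecting vanishing.
      pairing-relabel : ∀ f x → ⟨_∣_⟩ K S {W} (F∨.relabelling σ f) (F.relabelling σ x) ≈ₖ s *ₖ ⟨_∣_⟩ K S {V} f x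
      pairing-relabel [ t ] [ u ]    = pairTrees-relabel t u
      pairing-relabel [ t ] 𝟘        = 𝕂.sym (𝕂.zeroʳ s)
      pairing-relabel [ t ] (x ⊕ y)  =
        𝕂.trans (𝕂.+-cong (pairing-relabel [ t ] x) (pairing-relabel [ t ] y)) (𝕂.sym (𝕂.distribˡ s _ _))
      pairing-relabel [ t ] (a ⊙ x)  = 𝕂.trans (𝕂.*-congˡ (pairing-relabel [ t ] x)) (x∙yz≈y∙xz a s _)
      pairing-relabel 𝟘 x            = 𝕂.sym (𝕂.zeroʳ s)
      pairing-relabel (f ⊕ g) x      =
        𝕂.trans (𝕂.+-cong (pairing-relabel f x) (pairing-relabel g x)) (𝕂.sym (𝕂.distribˡ s _ _))
      pairing-relabel (a ⊙ f) x      = 𝕂.trans (𝕂.*-congˡ (pairing-relabel f x)) (x∙yz≈y∙xz a s _)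

  private
    module G = Graftings (𝒢 K)
    module G∨ = Graftings (_∨ K (𝒢 K))
    module P = Pairing (𝒢 K)
    module F = FreeOperad K (𝒢 K)
    module F∨ = FreeOperad K (_∨ K (𝒢 K))
    module 𝒢 = Species (𝒢 K)
    module 𝒢∨ = Species (_∨ K (𝒢 K))
    module Free𝒢 = Species F.freeSpecies

    ⟨_∣_⟩₃ : Element K (_∨ K (𝒢 K)) Three → Element K (𝒢 K) Three → 𝕂
    ⟨ f ∣ x ⟩₃ = ⟨_∣_⟩ K (𝒢 K) {Three} f x

    ev : F∨.Decoration → F.Decoration → 𝕂
    ev f = Functional.⟦_⟧ f

  -- The orthogonal of the relations of SP

  coordinates : ∀ (f : F∨.Decoration) → LeftModule._≈ᴹ_ (𝒢∨.obj (fin 2)) f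
    (LeftModule._+ᴹ_ (𝒢∨.obj (fin 2))
      (LeftModule._*ₗ_ (𝒢∨.obj (fin 2)) (ev f (generator K mu)) (cogenerator K mu))
      (LeftModule._*ₗ_ (𝒢∨.obj (fin 2)) (ev f (generator K seg)) (cogenerator K seg)))
  coordinates f x = begin
    ev f x                                                  ≈⟨ f.⟦⟧-cong expansion ⟩
    ev f ((x mu refl *ₗ μ) +ᴹ (x seg refl *ₗ s))            ≈⟨ f.+ᴹ-homo _ _ ⟩
    ev f (x mu refl *ₗ μ) +ₖ ev f (x seg refl *ₗ s)         ≈⟨ 𝕂.+-cong (f.*ₗ-homo _ μ) (f.*ₗ-homo _ s) ⟩
    x mu refl *ₖ ev f μ +ₖ x seg refl *ₖ ev f s             ≈⟨ 𝕂.+-cong (𝕂.*-comm _ _) (𝕂.*-comm _ _) ⟩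
    ev f μ *ₖ x mu refl +ₖ ev f s *ₖ x seg refl             ∎
    where
    open import Relation.Binary.Reasoning.Setoid 𝕂.setoid
    open LeftModule (𝒢.obj (fin 2)) using (_≈ᴹ_; _+ᴹ_; _*ₗ_)
    module f = Linear K {M = 𝒢.obj (fin 2)} {N = scalars K} (Functional.isLinear f)
    μ = generator K mu
    s = generator K seg

    expansion : x ≈ᴹ ((x mu refl *ₗ μ) +ᴹ (x seg refl *ₗ s))
    expansion mu  refl = 𝕂.sym (𝕂.trans (𝕂.+-cong (𝕂.*-identityʳ _) (𝕂.zeroʳ _)) (𝕂.+-identityʳ _))
    expansion seg refl = 𝕂.sym (𝕂.trans (𝕂.+-cong (𝕂.zeroʳ _) (𝕂.*-identityʳ _)) (𝕂.+-identityˡ _))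

  antisymmetricGenerators : AntisymmetricGenerators K (_∨ K (𝒢 K)) (cogenerator K mu) (cogenerator K seg)
  antisymmetricGenerators = record
    -- The signature of `swap₂` computes to minus and negation in the dual is scaling by minus one,
    -- so both sides differ only in a proof about sizes.
    { antisymmetric₁ = λ x → 𝕂.*-congˡ (𝕂.reflexive (cong (x mu) (ℕ.≡-irrelevant _ _)))
    ; antisymmetric₂ = λ x → 𝕂.*-congˡ (𝕂.reflexive (cong (x seg) (ℕ.≡-irrelevant _ _)))
    ; spanning = λ f → ev f (generator K mu) , ev f (generator K seg) , coordinates f
    ; independent = λ eq →
        𝕂.trans (𝕂.sym (at-mu _ _)) (𝕂.trans (eq (generator K mu)) (at-mu _ _)) ,
        𝕂.trans (𝕂.sym (at-seg _ _)) (𝕂.trans (eq (generator K seg)) (at-seg _ _))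
    }
    where
    at-mu : ∀ a b → a *ₖ 1# +ₖ b *ₖ 0# ≈ₖ a
    at-mu a b = 𝕂.trans (𝕂.+-cong (𝕂.*-identityʳ a) (𝕂.zeroʳ b)) (𝕂.+-identityʳ a)
    at-seg : ∀ a b → a *ₖ 0# +ₖ b *ₖ 1# ≈ₖ b
    at-seg a b = 𝕂.trans (𝕂.+-cong (𝕂.zeroʳ a) (𝕂.*-identityʳ b)) (𝕂.+-identityˡ b)

  basis : Fin 3 → Generator → Generator → Element K (𝒢 K) Three
  basis i p q = [ G.canonical i (generator K p) (generator K q) ]

  cobasis : Fin 3 → Generator → Generator → Element K (_∨ K (𝒢 K)) Three
  cobasis i p q = [ G∨.canonical i (cogenerator K p) (cogenerator K q) ]

  coefficient : Element K (_∨ K (𝒢 K)) Three → Fin 3 → Generator → Generator → 𝕂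
  coefficient f i p q = ⟨ f ∣ basis i p q ⟩₃

  -- The generators are fixed by the swap, so the order of the two inner leaves is irrelevant.
  basis-form : ∀ {t} (τ : Three ≃ Three) p q →
    tree t ≡ tree (relabelTree K τ (G.canonical 0F (generator K p) (generator K q))) → [ t ] F.≈ basis (to τ 0F) p q
  basis-form {t} τ p q eq = F.≈-trans (F.same {u = relabelTree K τ (G.canonical 0F _ _)} (F.~-reflexive eq))
    (unswapped (G.canonical-form τ (generator K p) (generator K q)))
    where
    unswapped : ∀ {x i p q} → (x F.≈ [ G.canonical i p q ]) ⊎ (x F.≈ [ G.canonical i p (𝒢.act swap₂ q) ]) →
                x F.≈ [ G.canonical i p q ]
    unswapped (inj₁ eq) = eq
    unswapped {q = q} (inj₂ eq) = F.≈-trans eq (F.same (F.node (λ _ _ → 𝕂.refl) (F.leaf _)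
      (F.node (λ r _ → 𝕂.reflexive (cong (q r) (ℕ.≡-irrelevant _ _))) (F.leaf _) (F.leaf _))))

  rotate : Three ≃ Three
  rotate = ⟪ mk↔ₛ′ next (next ∘ next) (λ { 0F → refl ; 1F → refl ; 2F → refl }) (λ { 0F → refl ; 1F → refl ; 2F → refl }) ⟫

  transpose : Three ≃ Three
  transpose = ⟪ mk↔ₛ′ f f (λ { 0F → refl ; 1F → refl ; 2F → refl }) (λ { 0F → refl ; 1F → refl ; 2F → refl }) ⟫
    where
    f : Fin 3 → Fin 3
    f 0F = 1F
    f 1F = 0F
    f 2F = 2F

  rotation : Fin 3 → Three ≃ Three
  rotation 0F = id≃
  rotation 1F = rotate
  rotation 2F = rotate ∘≃ rotate

  associator derivator : (i j k : Fin 3) → Element K (𝒢 K) Three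
  associator i j k = _⊖_ K (basis k mu mu) (basis i mu mu)
  derivator i j k = _⊖_ K (_⊖_ K (basis i seg mu) (basis k mu seg)) (basis j mu seg)

  relatorOf : ∀ {V x} → SP-Relator K V x → Element K (𝒢 K) V
  relatorOf {x = x} _ = x

  associativity-relabel : ∀ σ → F.relabelling σ (relatorOf associativity) F.≈ associator (to σ 0F) (to σ 1F) (to σ 2F)
  associativity-relabel σ = F.⊕-cong (basis-form (σ ∘≃ (rotate ⁻¹≃)) mu mu refl)
    (F.⊙-cong 𝕂.refl (basis-form σ mu mu refl))

  -- The leaves of the three trees are (a, b, c), (c, a, b) and (b, a, c): the second order comes
  -- from `rotate ⁻¹≃`, the third from `transpose`, where the symmetry of s restores the cyclic
  -- order.
  derivation-relabel : ∀ σ → F.relabelling σ (relatorOf derivation) F.≈ derivator (to σ 0F) (to σ 1F) (to σ 2F)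
  derivation-relabel σ = F.⊕-cong (F.⊕-cong (basis-form σ seg mu refl)
    (F.⊙-cong 𝕂.refl (basis-form (σ ∘≃ (rotate ⁻¹≃)) mu seg refl)))
    (F.⊙-cong 𝕂.refl (basis-form (σ ∘≃ transpose) mu seg refl))

  -- The equations that cut out R⊥ in the coordinates dual to the basis p(i, q(i+1, i+2)).
  record Balanced (f : Element K (_∨ K (𝒢 K)) Three) : Set ℓ where
    field
      mu-mu-constant : ∀ i → coefficient f i mu mu ≈ₖ coefficient f 0F mu mu
      seg-mu-sum     : ∀ i → coefficient f i seg mu ≈ₖ
                       coefficient f (next i) mu seg +ₖ coefficient f (next (next i)) mu seg

  private
    module 𝕂ᵃ = AbelianGroupProperties 𝕂.+-abelianGroup

  x-y≈0⇒x≈y : ∀ {x y} → x +ₖ (-ₖ 1#) *ₖ y ≈ₖ 0# → x ≈ₖ y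
  x-y≈0⇒x≈y {x} {y} p = 𝕂ᵃ.x∙y⁻¹≈ε⇒x≈y x y (𝕂.trans (𝕂.+-congˡ (𝕂.sym (RingProperties.-1*x≈-x ring y))) p)

  x≈y⇒x-y≈0 : ∀ {x y} → x ≈ₖ y → x +ₖ (-ₖ 1#) *ₖ y ≈ₖ 0#
  x≈y⇒x-y≈0 {x} {y} p = 𝕂.trans (𝕂.+-congˡ (RingProperties.-1*x≈-x ring y)) (𝕂ᵃ.x≈y⇒x∙y⁻¹≈ε p)

  private
    minus-minus : ∀ x y z → (x +ₖ (-ₖ 1#) *ₖ z) +ₖ (-ₖ 1#) *ₖ y ≈ₖ x +ₖ (-ₖ 1#) *ₖ (y +ₖ z)
    minus-minus x y z = begin
      (x +ₖ (-ₖ 1#) *ₖ z) +ₖ (-ₖ 1#) *ₖ y   ≈⟨ 𝕂.+-assoc x _ _ ⟩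
      x +ₖ ((-ₖ 1#) *ₖ z +ₖ (-ₖ 1#) *ₖ y)   ≈⟨ 𝕂.+-congˡ (𝕂.distribˡ _ z y) ⟨
      x +ₖ (-ₖ 1#) *ₖ (z +ₖ y)              ≈⟨ 𝕂.+-congˡ (𝕂.*-congˡ (𝕂.+-comm z y)) ⟩
      x +ₖ (-ₖ 1#) *ₖ (y +ₖ z)              ∎
      where open import Relation.Binary.Reasoning.Setoid 𝕂.setoid

  module _ (f : Element K (_∨ K (𝒢 K)) Three) where
    private module pair = Linear K {M = F.freeObj Three} {N = scalars K} (P.pairing-linearʳ Three f)

    pair-⊖ : ∀ x y → ⟨ f ∣ _⊖_ K x y ⟩₃ ≈ₖ ⟨ f ∣ x ⟩₃ +ₖ (-ₖ 1#) *ₖ ⟨ f ∣ y ⟩₃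
    pair-⊖ x y = 𝕂.trans (pair.+ᴹ-homo x ((-ₖ 1#) ⊙ y)) (𝕂.+-congˡ (pair.*ₗ-homo (-ₖ 1#) y))

    pair-derivator : ∀ i j k → ⟨ f ∣ derivator i j k ⟩₃ ≈ₖ
      coefficient f i seg mu +ₖ (-ₖ 1#) *ₖ (coefficient f j mu seg +ₖ coefficient f k mu seg)
    pair-derivator i j k = 𝕂.trans (pair-⊖ (_⊖_ K (basis i seg mu) (basis k mu seg)) (basis j mu seg))
      (𝕂.trans (𝕂.+-congʳ (pair-⊖ (basis i seg mu) (basis k mu seg))) (minus-minus _ _ _))

    -- Relabelling the two relators by rotations already yields every equation.
    orthogonal⇒balanced : (∀ x → relations (SP K) Three x → ⟨ f ∣ x ⟩₃ ≈ₖ 0#) → Balanced f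
    orthogonal⇒balanced f⊥R = record
      { mu-mu-constant = λ
        { 0F → 𝕂.refl
        -- Rotated associativity compares roots 0 and 1, the original one roots 2 and 0.
        ; 1F → 𝕂.sym (associative rotate)
        ; 2F → associative id≃
        }
      ; seg-mu-sum = λ
        { 0F → derivation′ (rotation 0F)
        ; 1F → derivation′ (rotation 1F)
        ; 2F → derivation′ (rotation 2F)
        }
      }
      where
      associative : ∀ σ → coefficient f (to σ 2F) mu mu ≈ₖ coefficient f (to σ 0F) mu mu
      associative σ = x-y≈0⇒x≈y (𝕂.trans (𝕂.sym (pair-⊖ (basis (to σ 2F) mu mu) (basis (to σ 0F) mu mu)))
        (𝕂.trans (pair.⟦⟧-cong (F.≈-sym (associativity-relabel σ))) (f⊥R _ (relabel σ (incl associativity)))))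

      derivation′ : ∀ σ → coefficient f (to σ 0F) seg mu ≈ₖ
                         coefficient f (to σ 1F) mu seg +ₖ coefficient f (to σ 2F) mu seg
      derivation′ σ = x-y≈0⇒x≈y (𝕂.trans (𝕂.sym (pair-derivator (to σ 0F) (to σ 1F) (to σ 2F)))
        (𝕂.trans (pair.⟦⟧-cong (F.≈-sym (derivation-relabel σ))) (f⊥R _ (relabel σ (incl derivation)))))

    kernel : IsSubspace (F.freeObj Three) (λ x → ⟨ f ∣ x ⟩₃ ≈ₖ 0#)
    kernel = equalizer-subspace {M = F.freeObj Three} {N = scalars K}
      (P.pairing-linearʳ Three f) (zero-linear {M = F.freeObj Three} {N = scalars K})

    -- All relabellings have to be met, odd ones included; an odd one merely exchanges the two
    -- summands in `seg-mu-sum`.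
    balanced⇒orthogonal : Balanced f → ∀ x → relations (SP K) Three x → ⟨ f ∣ x ⟩₃ ≈ₖ 0#
    balanced⇒orthogonal balanced x x∈R = 𝕂.trans (pair.⟦⟧-cong (F.≈-sym (Free𝒢.act-id x)))
      (span-relabel F.freeSpecies kernel onRelator x∈R id≃)
      where
      open Balanced balanced

      inner-sum : ∀ (σ : Three ≃ Three) → coefficient f (to σ 0F) seg mu ≈ₖ
                  coefficient f (to σ 1F) mu seg +ₖ coefficient f (to σ 2F) mu seg
      inner-sum σ with permutation-rotation σ
      ... | inj₁ (eq₁ , eq₂) rewrite eq₁ | eq₂ = seg-mu-sum _
      ... | inj₂ (eq₂ , eq₁) rewrite eq₁ | eq₂ = 𝕂.trans (seg-mu-sum _) (𝕂.+-comm _ _)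

      onRelator : ∀ {V x} → SP-Relator K V x → (σ : V ≃ Three) → ⟨ f ∣ F.relabelling σ x ⟩₃ ≈ₖ 0#
      onRelator associativity σ = 𝕂.trans (pair.⟦⟧-cong (associativity-relabel σ))
        (𝕂.trans (pair-⊖ (basis (to σ 2F) mu mu) (basis (to σ 0F) mu mu))
          (x≈y⇒x-y≈0 (𝕂.trans (mu-mu-constant (to σ 2F)) (𝕂.sym (mu-mu-constant (to σ 0F))))))
      onRelator derivation σ = 𝕂.trans (pair.⟦⟧-cong (derivation-relabel σ))
        (𝕂.trans (pair-derivator (to σ 0F) (to σ 1F) (to σ 2F)) (x≈y⇒x-y≈0 (inner-sum σ)))

  -- The three dual relators satisfy the equations of the orthogonal.

  private
    dualRelatorOf : ∀ {V x} → SP!-Relator K V x → Element K (_∨ K (𝒢 K)) V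
    dualRelatorOf {x = x} _ = x

    -- The shape to which the pairing of two basis trees with the same root computes: a sign, which
    -- is 1 since rotations of three letters are even, times the values of the outer and of the
    -- inner generator.
    one : 1# *ₖ (1# *ₖ 1#) ≈ₖ 1#
    one = 𝕂.trans (𝕂.*-identityˡ _) (𝕂.*-identityˡ _)

    nullˡ : ∀ {x} → 1# *ₖ (0# *ₖ x) ≈ₖ 0#
    nullˡ = 𝕂.trans (𝕂.*-identityˡ _) (𝕂.zeroˡ _)

    nullʳ : ∀ {x} → 1# *ₖ (x *ₖ 0#) ≈ₖ 0#
    nullʳ = 𝕂.trans (𝕂.*-identityˡ _) (𝕂.zeroʳ _)

    -- At most one tree of a relator has a given root. The dual relators list the roots as a, c, b,
    -- so root `1F` selects the third summand and root `2F` the second.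
    sum₁ : ∀ {x y z a} → x ≈ₖ a → y ≈ₖ 0# → z ≈ₖ 0# → (x +ₖ y) +ₖ z ≈ₖ a
    sum₁ p q r = 𝕂.trans (𝕂.+-cong (𝕂.trans (𝕂.+-cong p q) (𝕂.+-identityʳ _)) r) (𝕂.+-identityʳ _)

    sum₂ : ∀ {x y z a} → x ≈ₖ 0# → y ≈ₖ a → z ≈ₖ 0# → (x +ₖ y) +ₖ z ≈ₖ a
    sum₂ p q r = 𝕂.trans (𝕂.+-cong (𝕂.trans (𝕂.+-cong p q) (𝕂.+-identityˡ _)) r) (𝕂.+-identityʳ _)

    sum₃ : ∀ {x y z a} → x ≈ₖ 0# → y ≈ₖ 0# → z ≈ₖ a → (x +ₖ y) +ₖ z ≈ₖ a
    sum₃ p q r = 𝕂.trans (𝕂.+-cong (𝕂.trans (𝕂.+-cong p q) (𝕂.+-identityˡ _)) r) (𝕂.+-identityˡ _)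

  nilpotency-balanced : Balanced (dualRelatorOf nilpotency)
  nilpotency-balanced = record
    { mu-mu-constant = λ i → 𝕂.trans (mu-mu i) (𝕂.sym (mu-mu 0F))
    ; seg-mu-sum = λ i → 𝕂.trans (seg-mu i)
        (𝕂.sym (𝕂.trans (𝕂.+-cong (mu-seg (next i)) (mu-seg (next (next i)))) (𝕂.+-identityˡ 0#)))
    }
    where
    mu-mu : ∀ i → coefficient (dualRelatorOf nilpotency) i mu mu ≈ₖ 0#
    mu-mu 0F = nullˡ
    mu-mu 1F = 𝕂.refl
    mu-mu 2F = 𝕂.refl
    seg-mu : ∀ i → coefficient (dualRelatorOf nilpotency) i seg mu ≈ₖ 0#
    seg-mu 0F = nullʳ
    seg-mu 1F = 𝕂.refl
    seg-mu 2F = 𝕂.refl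
    mu-seg : ∀ i → coefficient (dualRelatorOf nilpotency) i mu seg ≈ₖ 0#
    mu-seg 0F = nullˡ
    mu-seg 1F = 𝕂.refl
    mu-seg 2F = 𝕂.refl

  mixed-balanced : Balanced (dualRelatorOf mixed)
  mixed-balanced = record
    { mu-mu-constant = λ i → 𝕂.trans (mu-mu i) (𝕂.sym (mu-mu 0F))
    -- By roots a, b, c the μ, s coordinates are 1, 0, 0 and the s, μ coordinates 0, 1, 1, so the
    -- equations read 0 = 0 + 0, 1 = 0 + 1 and 1 = 1 + 0.
    ; seg-mu-sum = λ
      { 0F → 𝕂.trans (sum₁ nullˡ 𝕂.refl 𝕂.refl) (𝕂.sym (𝕂.trans (𝕂.+-cong mu-seg₁ mu-seg₂) (𝕂.+-identityˡ 0#)))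
      ; 1F → 𝕂.trans (sum₃ 𝕂.refl 𝕂.refl one) (𝕂.sym (𝕂.trans (𝕂.+-cong mu-seg₂ mu-seg₀) (𝕂.+-identityˡ 1#)))
      ; 2F → 𝕂.trans (sum₂ 𝕂.refl one 𝕂.refl) (𝕂.sym (𝕂.trans (𝕂.+-cong mu-seg₀ mu-seg₁) (𝕂.+-identityʳ 1#)))
      }
    }
    where
    mu-mu : ∀ i → coefficient (dualRelatorOf mixed) i mu mu ≈ₖ 0#
    mu-mu 0F = sum₁ nullʳ 𝕂.refl 𝕂.refl
    mu-mu 1F = sum₃ 𝕂.refl 𝕂.refl nullˡ
    mu-mu 2F = sum₂ 𝕂.refl nullˡ 𝕂.refl
    mu-seg₀ : coefficient (dualRelatorOf mixed) 0F mu seg ≈ₖ 1#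
    mu-seg₀ = sum₁ one 𝕂.refl 𝕂.refl
    mu-seg₁ : coefficient (dualRelatorOf mixed) 1F mu seg ≈ₖ 0#
    mu-seg₁ = sum₃ 𝕂.refl 𝕂.refl nullˡ
    mu-seg₂ : coefficient (dualRelatorOf mixed) 2F mu seg ≈ₖ 0#
    mu-seg₂ = sum₂ 𝕂.refl nullˡ 𝕂.refl

  jacobi-balanced : Balanced (dualRelatorOf jacobi)
  jacobi-balanced = record
    { mu-mu-constant = λ i → 𝕂.trans (mu-mu i) (𝕂.sym (mu-mu 0F))
    ; seg-mu-sum = λ i → 𝕂.trans (seg-mu i)
        (𝕂.sym (𝕂.trans (𝕂.+-cong (mu-seg (next i)) (mu-seg (next (next i)))) (𝕂.+-identityˡ 0#)))
    }
    where
    mu-mu : ∀ i → coefficient (dualRelatorOf jacobi) i mu mu ≈ₖ 1#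
    mu-mu 0F = sum₁ one 𝕂.refl 𝕂.refl
    mu-mu 1F = sum₃ 𝕂.refl 𝕂.refl one
    mu-mu 2F = sum₂ 𝕂.refl one 𝕂.refl
    seg-mu : ∀ i → coefficient (dualRelatorOf jacobi) i seg mu ≈ₖ 0#
    seg-mu 0F = sum₁ nullˡ 𝕂.refl 𝕂.refl
    seg-mu 1F = sum₃ 𝕂.refl 𝕂.refl nullˡ
    seg-mu 2F = sum₂ 𝕂.refl nullˡ 𝕂.refl
    mu-seg : ∀ i → coefficient (dualRelatorOf jacobi) i mu seg ≈ₖ 0#
    mu-seg 0F = sum₁ nullʳ 𝕂.refl 𝕂.refl
    mu-seg 1F = sum₃ 𝕂.refl 𝕂.refl nullʳ
    mu-seg 2F = sum₂ 𝕂.refl nullʳ 𝕂.refl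

  relator⇒orthogonal : ∀ {V f} → SP!-Relator K V f → relators (_! K (SP K)) V f
  relator⇒orthogonal nilpotency = incl (two refl) , balanced⇒orthogonal _ nilpotency-balanced
  relator⇒orthogonal mixed      = add (add (incl (two refl)) (incl (two refl))) (incl (two refl)) ,
                                  balanced⇒orthogonal _ mixed-balanced
  relator⇒orthogonal jacobi     = add (add (incl (two refl)) (incl (two refl))) (incl (two refl)) ,
                                  balanced⇒orthogonal _ jacobi-balanced

  -- Coordinates on the two-node trees of the dual, and membership in the ideal

  layer : Generator → Generator → Element K (_∨ K (𝒢 K)) Three → Element K (_∨ K (𝒢 K)) Three
  layer p q f = (coefficient f 0F p q ⊙ cobasis 0F p q ⊕ coefficient f 1F p q ⊙ cobasis 1F p q) ⊕
                coefficient f 2F p q ⊙ cobasis 2F p q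

  -- The four layers match the relators: μ, μ belongs to Jacobi, s, s to nilpotency, and the two
  -- remaining layers jointly to the mixed relator.
  reconstruction : Element K (_∨ K (𝒢 K)) Three → Element K (_∨ K (𝒢 K)) Three
  reconstruction f = (layer mu mu f ⊕ layer mu seg f) ⊕ (layer seg mu f ⊕ layer seg seg f)

  private
    V₃ : LeftModule ring _ _
    V₃ = F∨.freeObj Three

  reconstruction-linear : IsLinear K V₃ V₃ reconstruction
  reconstruction-linear = plus (plus (layer-linear mu mu) (layer-linear mu seg))
                               (plus (layer-linear seg mu) (layer-linear seg seg))
    where
    plus : ∀ {f g} → IsLinear K V₃ V₃ f → IsLinear K V₃ V₃ g → IsLinear K V₃ V₃ (λ x → f x ⊕ g x)
    plus = sum-linear {M = V₃} {N = V₃}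

    layer-linear : ∀ p q → IsLinear K V₃ V₃ (layer p q)
    layer-linear p q = plus (plus (term 0F) (term 1F)) (term 2F)
      where
      term : ∀ i → IsLinear K V₃ V₃ (λ f → coefficient f i p q ⊙ cobasis i p q)
      term i = multiple-linear {M = V₃} {N = V₃} (P.pairing-linearˡ Three (basis i p q)) (cobasis i p q)

  module _ (f g : F∨.Decoration) where
    open LeftModule V₃
    open import Relation.Binary.Reasoning.Setoid ≈ᴹ-setoid
    private
      module D = LeftModule (𝒢∨.obj (fin 2))
      μ s : F∨.Decoration
      μ = cogenerator K mu
      s = cogenerator K seg
      f-mu  = ev f (generator K mu)
      f-seg = ev f (generator K seg)
      g-mu  = ev g (generator K mu)
      g-seg = ev g (generator K seg)
      X : Fin 3 → F∨.Decoration → F∨.Decoration → Element K (_∨ K (𝒢 K)) Three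
      X i f g = [ G∨.canonical i f g ]

      expandˡ : ∀ i h → X i f h ≈ᴹ f-mu *ₗ X i μ h +ᴹ f-seg *ₗ X i s h
      expandˡ i h = begin
        X i f h
          ≈⟨ F∨.same (F∨.node (coordinates f) (F∨.leaf _) (F∨.~-refl _)) ⟩
        X i ((f-mu D.*ₗ μ) D.+ᴹ (f-seg D.*ₗ s)) h
          ≈⟨ F∨.sum (F∨.here (f-mu D.*ₗ μ) (f-seg D.*ₗ s) _ _) ⟩
        X i (f-mu D.*ₗ μ) h +ᴹ X i (f-seg D.*ₗ s) h
          ≈⟨ +ᴹ-cong (F∨.multiple (F∨.here μ _ _)) (F∨.multiple (F∨.here s _ _)) ⟩
        f-mu *ₗ X i μ h +ᴹ f-seg *ₗ X i s h ∎

      expandʳ : ∀ i h → X i h g ≈ᴹ g-mu *ₗ X i h μ +ᴹ g-seg *ₗ X i h s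
      expandʳ i h = begin
        X i h g
          ≈⟨ F∨.same (F∨.node (D.≈ᴹ-refl {h}) (F∨.leaf _) (F∨.node (coordinates g) (F∨.leaf _) (F∨.leaf _))) ⟩
        X i h ((g-mu D.*ₗ μ) D.+ᴹ (g-seg D.*ₗ s))
          ≈⟨ F∨.sum (F∨.right h _ (F∨.here (g-mu D.*ₗ μ) (g-seg D.*ₗ s) _ _)) ⟩
        X i h (g-mu D.*ₗ μ) +ᴹ X i h (g-seg D.*ₗ s)
          ≈⟨ +ᴹ-cong (F∨.multiple (F∨.right h _ (F∨.here μ _ _))) (F∨.multiple (F∨.right h _ (F∨.here s _ _))) ⟩
        g-mu *ₗ X i h μ +ᴹ g-seg *ₗ X i h s ∎

      distrib : ∀ a b d x y → a *ₗ (b *ₗ x +ᴹ d *ₗ y) ≈ᴹ (a *ₖ b) *ₗ x +ᴹ (a *ₖ d) *ₗ y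
      distrib a b d x y = ≈ᴹ-trans (*ₗ-distribˡ a _ _) (≈ᴹ-sym (+ᴹ-cong (*ₗ-assoc a b x) (*ₗ-assoc a d y)))

      only : ∀ {a x} → (1# *ₖ a) *ₗ x ≈ᴹ a *ₗ x
      only = *ₗ-congʳ (𝕂.*-identityˡ _)

      -- Coefficients at the other two roots compute to zero; at root `i` the sign is 1 and the
      -- product of the two evaluations remains.
      layer-canonical : ∀ i p q → layer p q (X i f g) ≈ᴹ
        (ev f (generator K p) *ₖ ev g (generator K q)) *ₗ cobasis i p q
      layer-canonical 0F p q = ≈ᴹ-trans (+ᴹ-cong
        (≈ᴹ-trans (+ᴹ-cong only (*ₗ-zeroˡ _)) (+ᴹ-identityʳ _)) (*ₗ-zeroˡ _)) (+ᴹ-identityʳ _)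
      layer-canonical 1F p q = ≈ᴹ-trans (+ᴹ-cong
        (≈ᴹ-trans (+ᴹ-cong (*ₗ-zeroˡ _) only) (+ᴹ-identityˡ _)) (*ₗ-zeroˡ _)) (+ᴹ-identityʳ _)
      layer-canonical 2F p q = ≈ᴹ-trans (+ᴹ-cong
        (≈ᴹ-trans (+ᴹ-cong (*ₗ-zeroˡ _) (*ₗ-zeroˡ _)) (+ᴹ-identityˡ _)) only) (+ᴹ-identityˡ _)

    reconstruction-canonical : ∀ i → [ G∨.canonical i f g ] ≈ᴹ reconstruction [ G∨.canonical i f g ]
    reconstruction-canonical i = begin
      X i f g
        ≈⟨ expandˡ i g ⟩
      f-mu *ₗ X i μ g +ᴹ f-seg *ₗ X i s g
        ≈⟨ +ᴹ-cong (*ₗ-congˡ (expandʳ i μ)) (*ₗ-congˡ (expandʳ i s)) ⟩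
      f-mu *ₗ (g-mu *ₗ X i μ μ +ᴹ g-seg *ₗ X i μ s) +ᴹ f-seg *ₗ (g-mu *ₗ X i s μ +ᴹ g-seg *ₗ X i s s)
        ≈⟨ +ᴹ-cong (distrib f-mu g-mu g-seg _ _) (distrib f-seg g-mu g-seg _ _) ⟩
      ((f-mu *ₖ g-mu) *ₗ X i μ μ +ᴹ (f-mu *ₖ g-seg) *ₗ X i μ s) +ᴹ
        ((f-seg *ₖ g-mu) *ₗ X i s μ +ᴹ (f-seg *ₖ g-seg) *ₗ X i s s)
        ≈⟨ +ᴹ-cong (+ᴹ-cong (layer-canonical i mu mu) (layer-canonical i mu seg))
                   (+ᴹ-cong (layer-canonical i seg mu) (layer-canonical i seg seg)) ⟨
      reconstruction (X i f g) ∎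

  -- `reconstruction` is linear, so its fixed points form a subspace, and canonical trees with
  -- arbitrary decorations are enough.
  Free²⇒reconstruction : ∀ {V f} → Free² K (_∨ K (𝒢 K)) V f → (σ : V ≃ Three) →
    F∨.relabelling σ f F∨.≈ reconstruction (F∨.relabelling σ f)
  Free²⇒reconstruction = G∨.Free²-induction
    (equalizer-subspace {M = V₃} {N = V₃} (identity-linear V₃) reconstruction-linear)
    (λ i p q → reconstruction-canonical p q i)

  presentedIdeal : ∀ V → Element K (_∨ K (𝒢 K)) V → Set _
  presentedIdeal = relatorIdeal (SP!-presentation K)

  module _ {f : Element K (_∨ K (𝒢 K)) Three} (balanced : Balanced f) where
    open Balanced balanced
    open LeftModule V₃
    private
      rotated : ∀ {x} → SP!-Relator K Three x → (σ : Three ≃ Three) → presentedIdeal Three (F∨.relabelling σ x)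
      rotated r σ = relabel σ (incl (incl r))

      identical : ∀ {t u : TreeOn K F∨.Decoration Three} → tree t ≡ tree u → [ t ] F∨.≈ [ u ]
      identical eq = F∨.same (F∨.~-reflexive eq)

      nilpotent : ∀ i → presentedIdeal Three (cobasis i seg seg)
      nilpotent 0F = resp (identical refl) (rotated nilpotency (rotation 0F))
      nilpotent 1F = resp (identical refl) (rotated nilpotency (rotation 1F))
      nilpotent 2F = resp (identical refl) (rotated nilpotency (rotation 2F))

      mixture : ∀ i → presentedIdeal Three ((cobasis i mu seg ⊕ cobasis (next (next i)) seg mu) ⊕ cobasis (next i) seg mu)
      mixture 0F = resp (F∨.⊕-cong (F∨.⊕-cong (identical refl) (identical refl)) (identical refl)) (rotated mixed (rotation 0F))
      mixture 1F = resp (F∨.⊕-cong (F∨.⊕-cong (identical refl) (identical refl)) (identical refl)) (rotated mixed (rotation 1F))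
      mixture 2F = resp (F∨.⊕-cong (F∨.⊕-cong (identical refl) (identical refl)) (identical refl)) (rotated mixed (rotation 2F))

      seg-seg∈ : presentedIdeal Three (layer seg seg f)
      seg-seg∈ = add (add (scale (c′ 0F) (nilpotent 0F)) (scale (c′ 1F) (nilpotent 1F))) (scale (c′ 2F) (nilpotent 2F))
        where
        c′ : Fin 3 → 𝕂
        c′ i = coefficient f i seg seg

      -- The three coordinates agree, so the layer is the Jacobi relator scaled by any of them,
      -- after reordering its roots a, c, b.
      mu-mu∈ : presentedIdeal Three (layer mu mu f)
      mu-mu∈ = resp (begin
        a *ₗ ((cobasis 0F mu mu +ᴹ cobasis 2F mu mu) +ᴹ cobasis 1F mu mu)
          ≈⟨ *ₗ-congˡ (≈ᴹ-trans (+ᴹ-assoc _ _ _) (≈ᴹ-trans (+ᴹ-congˡ (+ᴹ-comm _ _)) (≈ᴹ-sym (+ᴹ-assoc _ _ _)))) ⟩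
        a *ₗ ((cobasis 0F mu mu +ᴹ cobasis 1F mu mu) +ᴹ cobasis 2F mu mu)
          ≈⟨ ≈ᴹ-trans (*ₗ-distribˡ a _ _) (+ᴹ-congʳ (*ₗ-distribˡ a _ _)) ⟩
        (a *ₗ cobasis 0F mu mu +ᴹ a *ₗ cobasis 1F mu mu) +ᴹ a *ₗ cobasis 2F mu mu
          ≈⟨ +ᴹ-cong (+ᴹ-congˡ (*ₗ-congʳ (mu-mu-constant 1F))) (*ₗ-congʳ (mu-mu-constant 2F)) ⟨
        layer mu mu f ∎)
        (scale a (resp (F∨.⊕-cong (F∨.⊕-cong (identical refl) (identical refl)) (identical refl)) (rotated jacobi id≃)))
        where
        open import Relation.Binary.Reasoning.Setoid ≈ᴹ-setoid
        a = coefficient f 0F mu mu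

      -- The tree μ(i, s) occurs only in the i-th rotation, which forces the scalar to be its
      -- coordinate; `seg-mu-sum` then makes the s, μ coordinates agree.
      mixed∈ : presentedIdeal Three (layer mu seg f ⊕ layer seg mu f)
      mixed∈ = resp (≈ᴹ-sym (≈ᴹ-trans
          (+ᴹ-congˡ (+ᴹ-cong (+ᴹ-cong (*ₗ-congʳ (seg-mu-sum 0F)) (*ₗ-congʳ (seg-mu-sum 1F))) (*ₗ-congʳ (seg-mu-sum 2F))))
          (regroup V₃ (c′ 0F) (c′ 1F) (c′ 2F) (cobasis 0F mu seg) (cobasis 1F mu seg) (cobasis 2F mu seg)
            (cobasis 0F seg mu) (cobasis 1F seg mu) (cobasis 2F seg mu))))
        (add (add (scale (c′ 0F) (mixture 0F)) (scale (c′ 1F) (mixture 1F))) (scale (c′ 2F) (mixture 2F)))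
        where
        c′ : Fin 3 → 𝕂
        c′ i = coefficient f i mu seg

    balanced⇒ideal : f F∨.≈ reconstruction f → presentedIdeal Three f
    balanced⇒ideal f≈ = resp
      (≈ᴹ-sym (≈ᴹ-trans f≈ (shuffle (layer mu mu f) (layer mu seg f) (layer seg mu f) (layer seg seg f))))
      (add mixed∈ (add mu-mu∈ seg-seg∈))
      where
      shuffle : ∀ w x y z → (w +ᴹ x) +ᴹ (y +ᴹ z) ≈ᴹ (x +ᴹ y) +ᴹ (w +ᴹ z)
      shuffle w x y z = ≈ᴹ-trans (+ᴹ-congʳ (+ᴹ-comm w x)) (+ᴹ-interchange K {M = V₃} x w y z)

  -- An identity map: the two species are definitionally equal, but only after a long unfolding.
  dual-Free² : ∀ {V f} → Free² K (_∨ K (generators (SP K))) V f → Free² K (_∨ K (𝒢 K)) V f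
  dual-Free² (incl (two n))  = incl (two n)
  dual-Free² (resp p s)      = resp p (dual-Free² s)
  dual-Free² zero            = zero
  dual-Free² (add s t)       = add (dual-Free² s) (dual-Free² t)
  dual-Free² (scale a s)     = scale a (dual-Free² s)
  dual-Free² (relabel σ s)   = relabel σ (dual-Free² s)

  -- A nonzero `f` lives on a set with three elements, so it is carried to `Three`, where
  -- coordinates are available, and the membership found there is carried back.
  orthogonal⇒ideal : ∀ {V f} → relators (_! K (SP K)) V f → presentedIdeal V f
  orthogonal⇒ideal {V} {f} (f∈Free² , f⊥R) with G∨.Free²-support (dual-Free² f∈Free²)
  ... | inj₂ f≈0 = resp (F∨.≈-sym f≈0) zero
  ... | inj₁ σ   = resp (act-inverseʳ F∨.freeSpecies (σ ⁻¹≃) f)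
    (relabel (σ ⁻¹≃) (balanced⇒ideal (orthogonal⇒balanced (F∨.relabelling σ f) σf⊥R)
      (Free²⇒reconstruction (dual-Free² f∈Free²) σ)))
    where
    open import Relation.Binary.Reasoning.Setoid 𝕂.setoid
    -- The relations are closed under relabelling, so `x` can be pulled back to `V`, where `f` is
    -- known to be orthogonal.
    σf⊥R : ∀ x → relations (SP K) Three x → ⟨ F∨.relabelling σ f ∣ x ⟩₃ ≈ₖ 0#
    σf⊥R x x∈R = begin
      ⟨ F∨.relabelling σ f ∣ x ⟩₃
        ≈⟨ P.pairing-congʳ Three (F∨.relabelling σ f) (F.≈-sym (act-inverseʳ F.freeSpecies σ x)) ⟩
      ⟨ F∨.relabelling σ f ∣ F.relabelling σ (F.relabelling (σ ⁻¹≃) x) ⟩₃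
        ≈⟨ P.pairing-relabel σ f (F.relabelling (σ ⁻¹≃) x) ⟩
      signum K (sign σ) *ₖ ⟨_∣_⟩ K (𝒢 K) {V} f (F.relabelling (σ ⁻¹≃) x)
        ≈⟨ 𝕂.*-congˡ (f⊥R _ (relabel (σ ⁻¹≃) x∈R)) ⟩
      signum K (sign σ) *ₖ 0#
        ≈⟨ 𝕂.zeroʳ _ ⟩
      0# ∎

  -- Equality of the two ideals and the isomorphism.

  dualIdeal : ∀ {m e r} (P : BinaryQuadratic K m e r) → Family K (Operad.species (Free K (_∨ K (generators P)))) _
  dualIdeal P = relatorIdeal (_! K P)

  dual⊆presented : ∀ {V f} → dualIdeal (SP K) V f → presentedIdeal V f
  dual⊆presented = relatorIdeal-mono (_! K (SP K)) (SP!-presentation K) refl orthogonal⇒ideal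

  presented⊆dual : ∀ {V f} → presentedIdeal V f → dualIdeal (SP K) V f
  presented⊆dual = relatorIdeal-mono (SP!-presentation K) (_! K (SP K)) refl (λ r → incl (incl (relator⇒orthogonal r)))

  -- Equality in either quotient is membership of a difference in its ideal: one inclusion makes the
  -- identity well defined, the other makes it injective.
  koszulDual-iso : OperadIso K (KoszulDual K (SP K)) (Ope K (SP!-presentation K))
  koszulDual-iso = record
    { φ = λ _ f → f
    ; φ-iso = λ V → record
      { isLeftModuleMonomorphism = record
        { isLeftModuleHomomorphism = linear K {M = Dual.obj V} {N = Presented.obj V} dual⊆presented
            (λ _ _ → presented-refl V) (λ _ _ → presented-refl V)
        ; injective = presented⊆dual
        }
      -- Whatever equals the chosen preimage in the dual must map to `f`, which is the first
      -- inclusion again.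
      ; surjective = λ f → f , dual⊆presented
      }
    ; φ-act = λ {_} {W} _ _ → presented-refl W
    ; φ-unit = presented-refl ⊤ᶠ
    ; φ-comp = λ {V} {W} _ _ → presented-refl (V ⊎ᶠ W)
    }
    where
    module Dual = Operad (KoszulDual K (SP K))
    module Presented = Operad (Ope K (SP!-presentation K))

    presented-refl : ∀ V {f} → LeftModule._≈ᴹ_ (Presented.obj V) f f
    presented-refl V = LeftModule.≈ᴹ-refl (Presented.obj V)

proposition2p12 : ∀ {c ℓ} (K : Field c ℓ) → CharacteristicZero K →
    AntisymmetricGenerators K (_∨ K (𝒢 K)) (cogenerator K mu) (cogenerator K seg)
    × OperadIso K (KoszulDual K (SP K)) (Ope K (SP!-presentation K))
proposition2p12 K _ = antisymmetricGenerators K , koszulDual-iso K
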